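{- For every integer $r \geq 1$ there exists a constant $d_r > 0$ such that, for every finite Abelian group $G$ of rank $r$ and exponent $n$, one has $\mathsf{t}(G) \leq d_r(n-1)+1$.
   Context: $G$ is written additively; writing $G \simeq C_{n_1}\oplus\cdots\oplus C_{n_r}$ with $1<n_1\mid\cdots\mid n_r$, $r$ is the rank and $n_r$ the exponent. A sequence over $G$ is a finite multiset of elements of $G$; subsequences are sub-multisets; its cross number is $\mathsf{k}(S)=\sum_{g\in S}1/\mathrm{ord}(g)$ (with multiplicity). A tiny zero-sum subsequence of $S$ is a non-empty subsequence $S'$ whose elements sum to $0$ and with $\mathsf{k}(S')\leq 1$. $\mathsf{t}(G)$ is the smallest positive integer $t$ such that every sequence over $G$ of length at least $t$ contains a tiny zero-sum subsequence. -}

module Defs where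

open import Data.Nat using (ℕ; zero; suc; _+_; _*_; _∸_; _≤_; _<_)
open import Data.Nat.Divisibility using (_∣_; _∣?_)
open import Data.Fin using (Fin; toℕ; fromℕ)
import Data.Fin as Fin
import Data.Bool
open import Data.Fin.Properties using (all?)
open import Data.List using (List; []; _∷_; length)
open import Data.List.Relation.Binary.Sublist.Propositional using (_⊆_)
open import Data.Bool using (if_then_else_)
open import Data.Product using (_×_; ∃-syntax)
open import Relation.Binary.PropositionalEquality using (_≡_; _≢_)
open import Relation.Nullary.Decidable using (⌊_⌋)
open import Data.Integer using (+_)
open import Data.Rational using (ℚ; 0ℚ; 1ℚ) renaming (_+_ to _+ℚ_; _≤_ to _≤ℚ_; _/_ to _/ℚ_)

-- Invariants of G ≃ C_{n_0} ⊕ ... ⊕ C_{n_{r-1}} (0-indexed), with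
-- 1 < n_0 ∣ n_1 ∣ ... ∣ n_{r-1}.  The rank of G is r.
IsInvariants : (r : ℕ) → (Fin r → ℕ) → Set
IsInvariants r ns =
  ((i : Fin r) → 1 < ns i) ×
  ((i j : Fin r) → toℕ j ≡ suc (toℕ i) → ns i ∣ ns j)

exponent : (k : ℕ) → (Fin (suc k) → ℕ) → ℕ
exponent k ns = ns (fromℕ k)

Elem : (r : ℕ) → (Fin r → ℕ) → Set
Elem r ns = (i : Fin r) → Fin (ns i)

-- Product of the invariants, i.e. |G| (an upper bound for element orders).
prodFin : (r : ℕ) → (Fin r → ℕ) → ℕ
prodFin zero    f = 1
prodFin (suc r) f = f Fin.zero * prodFin r (λ i → f (Fin.suc i))

kills? : {r : ℕ} {ns : Fin r → ℕ} → ℕ → Elem r ns → Data.Bool.Bool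
kills? {r} {ns} m g = ⌊ all? (λ i → ns i ∣? (m * toℕ (g i))) ⌋

-- ordPredFrom fuel j g : the least k ∈ {suc j, ..., suc j + fuel - 1} with
-- k · g = 0, minus one (fallback: j + fuel).
ordPredFrom : {r : ℕ} {ns : Fin r → ℕ} → ℕ → ℕ → Elem r ns → ℕ
ordPredFrom zero       j g = j
ordPredFrom (suc fuel) j g =
  if kills? (suc j) g then j else ordPredFrom fuel (suc j) g

-- ord(g) = suc (ordPred g) : the least positive k with k · g = 0
-- (searched over 1 .. |G|, which always contains the order).
ordPred : {r : ℕ} {ns : Fin r → ℕ} → Elem r ns → ℕ
ordPred {r} {ns} g = ordPredFrom (prodFin r ns) 0 g

ord : {r : ℕ} {ns : Fin r → ℕ} → Elem r ns → ℕ
ord g = suc (ordPred g)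

crossNumber : {r : ℕ} {ns : Fin r → ℕ} → List (Elem r ns) → ℚ
crossNumber []      = 0ℚ
crossNumber (g ∷ S) = ((+ 1) /ℚ suc (ordPred g)) +ℚ crossNumber S

-- Sum of a sequence, component i as a natural number (to be read mod n_i).
sumComp : {r : ℕ} {ns : Fin r → ℕ} → List (Elem r ns) → Fin r → ℕ
sumComp []      i = 0
sumComp (g ∷ S) i = toℕ (g i) + sumComp S i

IsZeroSum : {r : ℕ} {ns : Fin r → ℕ} → List (Elem r ns) → Set
IsZeroSum {r} {ns} S = (i : Fin r) → ns i ∣ sumComp S i

-- S has a tiny zero-sum subsequence: non-empty T ⊆ S (sub-multiset, realised
-- as a sublist), σ(T) = 0, k(T) ≤ 1.
HasTinyZeroSum : {r : ℕ} {ns : Fin r → ℕ} → List (Elem r ns) → Set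
HasTinyZeroSum S =
  ∃[ T ] (T ⊆ S × T ≢ [] × IsZeroSum T × crossNumber T ≤ℚ 1ℚ)

-- t(G) ≤ m  (for m ≥ 1): every sequence of length ≥ m has a tiny zero-sum
-- subsequence.  Since this property is upward closed in m and t(G) is its
-- least positive witness, t(G) ≤ m is equivalent to it.
TinyBound : (r : ℕ) → (ns : Fin r → ℕ) → ℕ → Set
TinyBound r ns m = (S : List (Elem r ns)) → m ≤ length S → HasTinyZeroSum S

{-# OPTIONS --safe #-}
module Submission where

open import Defs
open import Algebra.Bundles using (AbelianGroup; CommutativeRing)
import Algebra.Properties.AbelianGroup as AbelianGroupProperties
import Algebra.Properties.Group as GroupProperties
import Algebra.Properties.Ring as RingProperties
open import Algebra.Structures using (IsAbelianGroup; IsCommutativeRing)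
open import Data.Bool using (Bool; _∨_; false; not; true)
open import Data.Fin as Fin using (Fin; fromℕ; toℕ)
open import Data.Fin.Properties using (all?; any?; pigeonhole; toℕ-fromℕ<; toℕ-injective; toℕ<n)
import Data.Integer as ℤ
import Data.Integer.Properties as ℤ
open import Data.List as List using (List; []; _++_; _∷_; allFin; applyUpTo; cartesianProduct;
  cartesianProductWith; concat; drop; filter; foldr; length; map; tabulate; take; upTo)
open import Data.List.Membership.Propositional using (_∈_; lose)
open import Data.List.Membership.Propositional.Properties using (∈-++⁺ʳ; ∈-++⁺ˡ; ∈-++⁻; ∈-allFin;
  ∈-applyUpTo⁺; ∈-applyUpTo⁻; ∈-cartesianProductWith⁺; ∈-cartesianProductWith⁻; ∈-cartesianProduct⁺;
  ∈-filter⁺; ∈-map⁺; ∈-map⁻; ∈-upTo⁺; ∈-upTo⁻; ∈-∃++)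
open import Data.List.Properties using (++-identityʳ; concat-++; length-++; length-applyUpTo;
  length-filter; length-map; length-tabulate; length-take; length-upTo; map-++; map-tabulate;
  take++drop≡id; ∷-injective)
open import Data.List.Relation.Binary.Permutation.Propositional using (_↭_; prep; ↭-refl;
  ↭-reflexive; ↭-sym; ↭-trans) renaming (refl to ↭-nil; swap to ↭-swap′; trans to ↭-comp)
open import Data.List.Relation.Binary.Permutation.Propositional.Properties using (++⁺; ++⁺ʳ; ++⁺ˡ;
  All-resp-↭; shift; shifts; ↭-empty-inv; ↭-length; ↭-map-inv; ∈-resp-↭) renaming (++-assoc to
  ++-assoc-↭; map⁺ to ↭-map⁺)
open import Data.List.Relation.Binary.Sublist.Propositional using ([]; _∷_; _∷ʳ_; _⊆_; ⊆-refl)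
open import Data.List.Relation.Binary.Sublist.Propositional.Properties using () renaming (++⁺ʳ to
  ⊆-++ʳ)
open import Data.List.Relation.Unary.All as All using (All; []; _∷_)
open import Data.List.Relation.Unary.All.Properties as All using (all-filter; cartesianProduct⁺)
open import Data.List.Relation.Unary.Any as Any using (here; there)
open import Data.List.Relation.Unary.Unique.Propositional using (Unique; []; _∷_)
open import Data.List.Relation.Unary.Unique.Propositional.Properties using (applyUpTo⁺₁;
  cartesianProductWith⁺; upTo⁺) renaming (map⁺ to Unique-map⁺)
open import Data.Maybe using (nothing)
open import Data.Nat
open import Data.Nat.Coprimality using (coprime-Bézout; prime⇒coprime)
open import Data.Nat.DivMod
open import Data.Nat.Divisibility
open import Data.Nat.GCD using (module Bézout)
open import Data.Nat.ListAction using (product)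
open import Data.Nat.Primality using (Prime; euclidsLemma; prime[2]; prime⇒nonTrivial;
  prime⇒nonZero; ¬prime[0])
open import Data.Nat.Primality.Factorisation using (factorise; module PrimeFactorisation)
open import Data.Nat.Properties
open import Data.Nat.Tactic.RingSolver using (solve-∀)
open import Data.Product using (_,_; _×_; proj₁; proj₂; ∃-syntax)
open import Data.Rational as ℚ using (1ℚ; toℚᵘ)
import Data.Rational.Properties as ℚ
open import Data.Rational.Unnormalised as ℚᵘ using (*≡*; *≤*; _≃_; mkℚᵘ)
import Data.Rational.Unnormalised.Properties as ℚᵘ
open import Data.Sum using ([_,_]′; _⊎_; inj₁; inj₂)
open import Data.Vec as Vec using (Vec; []; _∷_)
open import Data.Vec.Properties using (lookup-replicate; lookup-zipWith; lookup∘tabulate;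
  tabulate-cong; tabulate∘lookup; zipWith-assoc; zipWith-comm; zipWith-identityʳ; zipWith-identityˡ;
  zipWith-inverseʳ; zipWith-inverseˡ; ≡-dec) renaming (∷-injective to ∷ᵛ-injective)
open import Function using (_∘_)
open import Level using (0ℓ)
open import Relation.Binary.PropositionalEquality using (_≡_; _≢_; cong; cong₂; isEquivalence;
  module ≡-Reasoning; refl; setoid; subst; sym; trans)
open import Relation.Nullary using (Dec; contradiction; no; yes; ¬_)
open import Relation.Nullary.Decidable using (_×-dec_; map′; ¬?; ⌊_⌋)
open import Tactic.RingSolver.Core.AlmostCommutativeRing using (AlmostCommutativeRing;
  fromCommutativeRing)
import Tactic.RingSolver.NonReflective as RingSolver

-- Zero-sum subsequences of length p in F_p^d, following the strategy of Alon and Dubiner.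
-- By induction on d, a sequence of length c p either has many terms on an affine hyperplane,
-- where one coordinate can be dropped, or all its hyperplanes are thin.  In the thin case
-- pairs of terms are chosen greedily so that the set Y of sums using one term of each pair
-- grows fast: if no difference of two terms moved much of Y out of Y, then neither would any
-- short combination of differences, but these combinations reach more than 2|Y| points.
-- For small Y they are the boxes spanned by a basis.  For large Y one projects Y along every
-- functional ξ; in F_p, two numbers u and u′ whose ratio is not a fraction with small
-- numerator and denominator reach everything as s u + t u′ with s, t ≤ p/W.  Two disjoint
-- families of at most p/2 pairs then produce every vector, hence a zero sum of length p.
--
-- For general G, a block of terms labelled by q m (killed by q m, cross number at most
-- 1/(q m)) has image in F_q^r under q m σ / n_i; q blocks with zero-sum images merge to a
-- block labelled by m.  Starting from the orders of the terms, this pebbling on the divisors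
-- of n reaches the label 1 from 2(1 + 5c)(n - 1) + 1 terms.

-- Finite sums

-- The linear bound comes from prime fields: for every d there is a c such that, for every prime p,
-- any c p vectors of F_p^d contain p vectors with sum zero (`zero-sum`). Uniformity of c in p is
-- what makes the final bound linear in the exponent n with a factor depending on the rank only.
--
-- Cross numbers enter through labels. A block T has label m if m σ(T) = 0 and k(T) ≤ 1/m; a single
-- term g has label ord(g), and a block with label 1 is a tiny zero-sum subsequence. If q blocks of
-- label q m have images in F_q^r with sum zero, then their union has label m: the factor q is
-- gained in divisibility, and q cross numbers of at most 1/(q m) add up to at most 1/m (`merge`).
-- Stripping the primes of n one by one leaves fewer than c q blocks behind for each label treated,
-- and a potential that charges 3 c for every label bounds the total need by (1 + 5 c) n (`Tower`).
--
-- The prime field bound is an induction on d. A hyperplane with many terms is a copy of F_p^(d-1),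
-- and translations do not affect the vanishing of sums of p terms. Otherwise the terms escape any
-- bounded number of hyperplanes. Pairs (x, y) are then collected, Y being the set of sums with one
-- term from each pair. A new pair enlarges Y by the number of points that y - x moves out of Y.
-- This number is subadditive in the direction, so if it were small on a basis of differences, it
-- would be small for all short combinations; but for a point of Y at most |Y| directions stay
-- inside Y (`spread`).
--
-- For 2 |Y| ≤ k^d the combinations with coefficients below k are numerous enough, and one pair
-- multiplies |Y| by 1 + 1/O(k); the costs for k = 2, 4, 8, ... form a geometric series. For dense Y
-- this would need k = p and too many pairs. There the number of points leaving Y is rewritten, by
-- averaging over all functionals, as a sum of squared differences of hyperplane counts. In each
-- one-dimensional problem every residue is a combination of two suitable values with coefficients
-- at most p/W, so a factor W is saved. At most p/2 pairs thus make Y larger than half of the space,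
-- and two such sets represent every vector.

∑ : {A : Set} → List A → (A → ℕ) → ℕ
∑ []       f = 0
∑ (x ∷ xs) f = f x + ∑ xs f

module _ {A : Set} where

  ∑-mono-∈ : ∀ (xs : List A) {f g} → (∀ {x} → x ∈ xs → f x ≤ g x) → ∑ xs f ≤ ∑ xs g
  ∑-mono-∈ []       f≤g = z≤n
  ∑-mono-∈ (x ∷ xs) f≤g = +-mono-≤ (f≤g (here refl)) (∑-mono-∈ xs (f≤g ∘ there))

  ∑-mono : ∀ (xs : List A) {f g} → (∀ x → f x ≤ g x) → ∑ xs f ≤ ∑ xs g
  ∑-mono xs f≤g = ∑-mono-∈ xs (λ {x} _ → f≤g x)

  ∑-cong : ∀ (xs : List A) {f g} → (∀ x → f x ≡ g x) → ∑ xs f ≡ ∑ xs g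
  ∑-cong []       f≡g = refl
  ∑-cong (x ∷ xs) f≡g = cong₂ _+_ (f≡g x) (∑-cong xs f≡g)

  ∑-+ : ∀ (xs : List A) f g → ∑ xs (λ x → f x + g x) ≡ ∑ xs f + ∑ xs g
  ∑-+ []       f g = refl
  ∑-+ (x ∷ xs) f g = trans (cong (f x + g x +_) (∑-+ xs f g)) (interchange (f x) (g x) _ _)
    where
    interchange : ∀ a b c d → (a + b) + (c + d) ≡ (a + c) + (b + d)
    interchange = solve-∀

  ∑-*ˡ : ∀ (xs : List A) c f → ∑ xs (λ x → c * f x) ≡ c * ∑ xs f
  ∑-*ˡ []       c f = sym (*-zeroʳ c)
  ∑-*ˡ (x ∷ xs) c f = trans (cong (c * f x +_) (∑-*ˡ xs c f)) (sym (*-distribˡ-+ c (f x) _))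

  ∑-const : ∀ (xs : List A) c → ∑ xs (λ _ → c) ≡ length xs * c
  ∑-const []       c = refl
  ∑-const (x ∷ xs) c = cong (c +_) (∑-const xs c)

  ∑-0 : ∀ (xs : List A) → ∑ xs (λ _ → 0) ≡ 0
  ∑-0 xs = trans (∑-const xs 0) (*-zeroʳ (length xs))

  ∑-++ : ∀ (xs ys : List A) f → ∑ (xs ++ ys) f ≡ ∑ xs f + ∑ ys f
  ∑-++ []       ys f = refl
  ∑-++ (x ∷ xs) ys f = trans (cong (f x +_) (∑-++ xs ys f)) (sym (+-assoc (f x) _ _))

  ∑-↭ : ∀ {xs ys : List A} f → xs ↭ ys → ∑ xs f ≡ ∑ ys f
  ∑-↭ f ↭-nil        = refl
  ∑-↭ f (prep x r)   = cong (f x +_) (∑-↭ f r)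
  ∑-↭ f (↭-swap′ x y r) = trans (cong (λ s → f x + (f y + s)) (∑-↭ f r)) (rotate (f x) (f y) _)
    where
    rotate : ∀ a b c → a + (b + c) ≡ b + (a + c)
    rotate = solve-∀
  ∑-↭ f (↭-comp r s)  = trans (∑-↭ f r) (∑-↭ f s)

  ∑-map : ∀ {B : Set} (g : B → A) xs f → ∑ (map g xs) f ≡ ∑ xs (f ∘ g)
  ∑-map g []       f = refl
  ∑-map g (x ∷ xs) f = cong (f (g x) +_) (∑-map g xs f)

  ∑-∈≤ : ∀ {xs : List A} {x} (f : A → ℕ) → x ∈ xs → f x ≤ ∑ xs f
  ∑-∈≤ {y ∷ xs} f (here refl) = m≤m+n (f y) (∑ xs f)
  ∑-∈≤ {y ∷ xs} f (there i)   = ≤-trans (∑-∈≤ f i) (m≤n+m (∑ xs f) (f y))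

  ∈⇒↭ : ∀ {x : A} {xs} → x ∈ xs → ∃[ ys ] xs ↭ x ∷ ys
  ∈⇒↭ {x} x∈xs with ys , zs , refl ← ∈-∃++ x∈xs = ys ++ zs , shift x ys zs

  ∈-tail : ∀ {x y : A} {ys} → x ≢ y → y ∈ x ∷ ys → y ∈ ys
  ∈-tail x≢y (here refl) = contradiction refl x≢y
  ∈-tail x≢y (there i)   = i

  -- Inclusion of a duplicate-free list is upgraded to a decomposition of multisets; inclusions and
  -- injections thereby become inequalities between sums and lengths.
  Unique-⊆⇒↭ : ∀ {xs ys : List A} → Unique xs → (∀ {x} → x ∈ xs → x ∈ ys) → ∃[ zs ] ys ↭ xs ++ zs
  Unique-⊆⇒↭ {[]}     {ys} _          _     = ys , ↭-refl
  Unique-⊆⇒↭ {x ∷ xs} {ys} (x≢ ∷ uxs) xs⊆ys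
    with ys′ , r ← ∈⇒↭ (xs⊆ys (here refl))
    with zs , s ← Unique-⊆⇒↭ uxs (λ {y} y∈xs → ∈-tail (All.lookup x≢ y∈xs) (∈-resp-↭ r (xs⊆ys (there y∈xs))))
    = zs , ↭-trans r (prep x s)

  ∑-⊆ : ∀ {xs ys : List A} f → Unique xs → (∀ {x} → x ∈ xs → x ∈ ys) → ∑ xs f ≤ ∑ ys f
  ∑-⊆ {xs} f u xs⊆ys with zs , r ← Unique-⊆⇒↭ u xs⊆ys = begin
    ∑ xs f           ≤⟨ m≤m+n _ _ ⟩
    ∑ xs f + ∑ zs f  ≡⟨ ∑-++ xs zs f ⟨
    ∑ (xs ++ zs) f   ≡⟨ ∑-↭ f r ⟨
    _                ∎
    where open ≤-Reasoning

interchange-↭ : ∀ {A : Set} (ws xs ys zs : List A) → (ws ++ xs) ++ (ys ++ zs) ↭ (ws ++ ys) ++ (xs ++ zs)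
interchange-↭ ws xs ys zs = ↭-trans (++-assoc-↭ ws xs (ys ++ zs))
  (↭-trans (++⁺ˡ ws (shifts xs ys)) (↭-sym (++-assoc-↭ ws ys (xs ++ zs))))

∑-swap : ∀ {A B : Set} (xs : List A) (ys : List B) (f : A → B → ℕ) →
         ∑ xs (λ x → ∑ ys (f x)) ≡ ∑ ys (λ y → ∑ xs (λ x → f x y))
∑-swap []       ys f = sym (∑-0 ys)
∑-swap (x ∷ xs) ys f = trans (cong (∑ ys (f x) +_) (∑-swap xs ys f)) (sym (∑-+ ys (f x) _))

𝟙 : Bool → ℕ
𝟙 true  = 1
𝟙 false = 0

𝟙? : {P : Set} → Dec P → ℕ
𝟙? P? = 𝟙 ⌊ P? ⌋

𝟙?-yes : ∀ {P : Set} (P? : Dec P) → P → 𝟙? P? ≡ 1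
𝟙?-yes (yes _) _ = refl
𝟙?-yes (no ¬p) p = contradiction p ¬p

𝟙?-no : ∀ {P : Set} (P? : Dec P) → ¬ P → 𝟙? P? ≡ 0
𝟙?-no (yes p) ¬p = contradiction p ¬p
𝟙?-no (no _)  _  = refl

𝟙?-⇔ : ∀ {P Q : Set} (P? : Dec P) (Q? : Dec Q) → (P → Q) → (Q → P) → 𝟙? P? ≡ 𝟙? Q?
𝟙?-⇔ (yes p) Q? f g = sym (𝟙?-yes Q? (f p))
𝟙?-⇔ (no ¬p) Q? f g = sym (𝟙?-no Q? (¬p ∘ g))

-- Counting over an enumerated type

module Enumeration {V : Set} (_≟_ : (x y : V) → Dec (x ≡ y)) (es : List V)
  (unique : Unique es) (complete : ∀ x → x ∈ es) where

  ∑-⊆-all : ∀ {xs} f → Unique xs → ∑ xs f ≤ ∑ es f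
  ∑-⊆-all f u = ∑-⊆ f u (λ {x} _ → complete x)

  length-⊆-all : ∀ {xs} → Unique xs → length xs ≤ length es
  length-⊆-all {xs} u = begin
    length xs        ≡⟨ ∑-1 xs ⟨
    ∑ xs (λ _ → 1)   ≤⟨ ∑-⊆-all (λ _ → 1) u ⟩
    ∑ es (λ _ → 1)   ≡⟨ ∑-1 es ⟩
    length es        ∎
    where
    open ≤-Reasoning
    ∑-1 : ∀ xs → ∑ xs (λ _ → 1) ≡ length xs
    ∑-1 xs = trans (∑-const xs 1) (*-identityʳ _)

  ∑-inj≤ : ∀ (φ : V → V) → (∀ {x y} → φ x ≡ φ y → x ≡ y) → ∀ f → ∑ es (f ∘ φ) ≤ ∑ es f
  ∑-inj≤ φ inj f = ≤-trans (≤-reflexive (sym (∑-map φ es f))) (∑-⊆-all f (Unique-map⁺ inj unique))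

  ∑-bij : ∀ (φ ψ : V → V) → (∀ x → φ (ψ x) ≡ x) → (∀ x → ψ (φ x) ≡ x) →
          ∀ f → ∑ es (f ∘ φ) ≡ ∑ es f
  ∑-bij φ ψ φψ ψφ f = ≤-antisym (∑-inj≤ φ (inj φ ψ ψφ) f) (begin
    ∑ es f              ≡⟨ ∑-cong es (λ x → cong f (sym (φψ x))) ⟩
    ∑ es (f ∘ φ ∘ ψ)    ≤⟨ ∑-inj≤ ψ (inj ψ φ φψ) (f ∘ φ) ⟩
    ∑ es (f ∘ φ)        ∎)
    where
    open ≤-Reasoning
    inj : ∀ (φ ψ : V → V) → (∀ x → ψ (φ x) ≡ x) → ∀ {x y} → φ x ≡ φ y → x ≡ y
    inj φ ψ ψφ {x} {y} eq = trans (sym (ψφ x)) (trans (cong ψ eq) (ψφ y))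

  -- The image of the enumeration is duplicate-free, so the enumeration is this image plus
  -- leftovers; comparing lengths, there are no leftovers.
  injective⇒surjective : ∀ (φ : V → V) → (∀ {x y} → φ x ≡ φ y → x ≡ y) → ∀ y → ∃[ x ] φ x ≡ y
  injective⇒surjective φ inj y with Unique-⊆⇒↭ (Unique-map⁺ inj unique) (λ {x} _ → complete x)
  ... | [] , r with x , _ , y≡φx ← ∈-map⁻ φ (subst (y ∈_) (++-identityʳ (map φ es)) (∈-resp-↭ r (complete y)))
      = x , sym y≡φx
  ... | z ∷ zs , r = contradiction (begin-equality
      length es                                    ≡⟨ ↭-length r ⟩
      length (map φ es ++ z ∷ zs)                  ≡⟨ length-++ (map φ es) ⟩
      length (map φ es) + suc (length zs)          ≡⟨ cong (_+ suc (length zs)) (length-map φ es) ⟩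
      length es + suc (length zs)                  ∎) (m≢1+m+n (length es) ∘ λ eq → trans eq (+-suc _ _))
    where open ≤-Reasoning

  ∑-𝟙≟ : ∀ a (h : V → ℕ) → ∑ es (λ c → 𝟙? (a ≟ c) * h c) ≡ h a
  ∑-𝟙≟ a h = go unique (complete a)
    where
    vanish : ∀ {xs} → All (a ≢_) xs → ∑ xs (λ c → 𝟙? (a ≟ c) * h c) ≡ 0
    vanish []              = refl
    vanish (_∷_ {x} a≢ as) = cong₂ _+_ (cong (_* h x) (𝟙?-no (a ≟ x) a≢)) (vanish as)
    go : ∀ {xs} → Unique xs → a ∈ xs → ∑ xs (λ c → 𝟙? (a ≟ c) * h c) ≡ h a
    go {x ∷ xs} (x≢ ∷ u) (here refl) = trans
      (cong₂ _+_ (trans (cong (_* h a) (𝟙?-yes (a ≟ a) refl)) (*-identityˡ _)) (vanish x≢))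
      (+-identityʳ _)
    go {x ∷ xs} (x≢ ∷ u) (there i) =
      cong₂ _+_ (cong (_* h x) (𝟙?-no (a ≟ x) (All.lookup x≢ i ∘ sym))) (go u i)

-- Translations in finite abelian groups

module FiniteAbelianGroup {V : Set} {_∙_ : V → V → V} {ε : V} {_⁻¹ : V → V}
  (isAbelianGroup : IsAbelianGroup _≡_ _∙_ ε _⁻¹)
  (_≟_ : (x y : V) → Dec (x ≡ y)) (es : List V)
  (unique : Unique es) (complete : ∀ x → x ∈ es) where

  open IsAbelianGroup isAbelianGroup using (assoc; comm; identityˡ; identityʳ; inverseˡ; inverseʳ)
  open Enumeration _≟_ es unique complete public

  abelianGroup : AbelianGroup 0ℓ 0ℓ
  abelianGroup = record { isAbelianGroup = isAbelianGroup }

  open GroupProperties (AbelianGroup.group abelianGroup) using (∙-cancelˡ)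

  x∙a∙a⁻¹ : ∀ x a → (x ∙ a) ∙ (a ⁻¹) ≡ x
  x∙a∙a⁻¹ x a = trans (assoc x a _) (trans (cong (x ∙_) (inverseʳ a)) (identityʳ x))

  x∙a⁻¹∙a : ∀ x a → (x ∙ (a ⁻¹)) ∙ a ≡ x
  x∙a⁻¹∙a x a = trans (assoc x _ a) (trans (cong (x ∙_) (inverseˡ a)) (identityʳ x))

  ∑-translate : ∀ a (f : V → ℕ) → ∑ es (λ x → f (x ∙ a)) ≡ ∑ es f
  ∑-translate a = ∑-bij (_∙ a) (_∙ (a ⁻¹)) (λ x → x∙a⁻¹∙a x a) (λ x → x∙a∙a⁻¹ x a)

  ∑-reflect : ∀ a (f : V → ℕ) → ∑ es (λ x → f (a ∙ (x ⁻¹))) ≡ ∑ es f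
  ∑-reflect a = ∑-bij φ φ invol invol
    where
    φ : V → V
    φ x = a ∙ (x ⁻¹)
    open AbelianGroupProperties abelianGroup using (⁻¹-∙-comm)
    open GroupProperties (AbelianGroup.group abelianGroup) using (⁻¹-involutive)
    invol : ∀ x → φ (φ x) ≡ x
    invol x = begin
      a ∙ ((a ∙ (x ⁻¹)) ⁻¹)        ≡⟨ cong (a ∙_) (⁻¹-∙-comm a (x ⁻¹)) ⟨
      a ∙ ((a ⁻¹) ∙ ((x ⁻¹) ⁻¹))   ≡⟨ cong (λ y → a ∙ ((a ⁻¹) ∙ y)) (⁻¹-involutive x) ⟩
      a ∙ ((a ⁻¹) ∙ x)             ≡⟨ assoc a (a ⁻¹) x ⟨
      (a ∙ (a ⁻¹)) ∙ x             ≡⟨ cong (_∙ x) (inverseʳ a) ⟩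
      ε ∙ x                        ≡⟨ identityˡ x ⟩
      x                            ∎
      where open ≡-Reasoning

  card : (V → Bool) → ℕ
  card Y = ∑ es (𝟙 ∘ Y)

  -- `leave Y` serves as a seminorm on directions: it vanishes at `ε` and is subadditive. `stay Y`
  -- is the autocorrelation of the indicator of `Y`, which is easy to sum over directions.
  stay leave : (V → Bool) → V → ℕ
  stay  Y a = ∑ es (λ x → 𝟙 (Y x) * 𝟙 (Y (x ∙ a)))
  leave Y a = ∑ es (λ x → 𝟙 (Y x) * 𝟙 (not (Y (x ∙ a))))

  stay+leave : ∀ Y a → stay Y a + leave Y a ≡ card Y
  stay+leave Y a = trans (sym (∑-+ es _ _)) (∑-cong es (λ x → split (Y x) (Y (x ∙ a))))
    where
    split : ∀ b c → 𝟙 b * 𝟙 c + 𝟙 b * 𝟙 (not c) ≡ 𝟙 b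
    split true  true  = refl
    split true  false = refl
    split false _     = refl

  leave-ε : ∀ Y → leave Y ε ≡ 0
  leave-ε Y = trans (∑-cong es (λ x → trans (cong (λ z → 𝟙 (Y x) * 𝟙 (not (Y z))) (identityʳ x)) (excluded (Y x)))) (∑-0 es)
    where
    excluded : ∀ b → 𝟙 b * 𝟙 (not b) ≡ 0
    excluded true  = refl
    excluded false = refl

  -- A point that has left after both translations left either at the first or at the second one,
  -- and translating by `a` turns the second count into `leave Y b`.
  leave-∙ : ∀ Y a b → leave Y (a ∙ b) ≤ leave Y a + leave Y b
  leave-∙ Y a b = begin
    leave Y (a ∙ b)
      ≤⟨ ∑-mono es (λ x → via (Y x) (Y (x ∙ a)) (Y (x ∙ (a ∙ b)))) ⟩
    ∑ es (λ x → 𝟙 (Y x) * 𝟙 (not (Y (x ∙ a))) + 𝟙 (Y (x ∙ a)) * 𝟙 (not (Y (x ∙ (a ∙ b)))))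
      ≡⟨ ∑-+ es _ _ ⟩
    leave Y a + ∑ es (λ x → 𝟙 (Y (x ∙ a)) * 𝟙 (not (Y (x ∙ (a ∙ b)))))
      ≡⟨ cong (leave Y a +_) (∑-cong es (λ x → cong (λ z → 𝟙 (Y (x ∙ a)) * 𝟙 (not (Y z))) (assoc x a b))) ⟨
    leave Y a + ∑ es (λ x → 𝟙 (Y (x ∙ a)) * 𝟙 (not (Y ((x ∙ a) ∙ b))))
      ≡⟨ cong (leave Y a +_) (∑-translate a (λ x → 𝟙 (Y x) * 𝟙 (not (Y (x ∙ b))))) ⟩
    leave Y a + leave Y b ∎
    where
    open ≤-Reasoning
    via : ∀ u v w → 𝟙 u * 𝟙 (not w) ≤ 𝟙 u * 𝟙 (not v) + 𝟙 v * 𝟙 (not w)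
    via false _     _     = z≤n
    via true  true  true  = z≤n
    via true  true  false = ≤-refl
    via true  false true  = z≤n
    via true  false false = ≤-refl

  -- After the substitution w = v ∙ b the union consists of a translate of `Y` by `c` and of `Y`
  -- itself; what `Y` adds is exactly what `c` moves out of `Y`. This measures the growth of a sum
  -- set when a pair is added.
  card-∪-translate : ∀ Y a b c → c ∙ b ≡ a →
    card (λ v → Y (v ∙ a) ∨ Y (v ∙ b)) ≡ card Y + leave Y c
  card-∪-translate Y a b c c∙b≡a = begin
    ∑ es (λ v → 𝟙 (Y (v ∙ a) ∨ Y (v ∙ b)))
      ≡⟨ ∑-cong es (λ v → trans (split (Y (v ∙ a)) (Y (v ∙ b)))
           (cong (λ z → 𝟙 (Y z) + 𝟙 (Y (v ∙ b)) * 𝟙 (not (Y z))) (shifted v))) ⟩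
    ∑ es (λ v → 𝟙 (Y ((v ∙ b) ∙ c)) + 𝟙 (Y (v ∙ b)) * 𝟙 (not (Y ((v ∙ b) ∙ c))))
      ≡⟨ ∑-translate b (λ w → 𝟙 (Y (w ∙ c)) + 𝟙 (Y w) * 𝟙 (not (Y (w ∙ c)))) ⟩
    ∑ es (λ w → 𝟙 (Y (w ∙ c)) + 𝟙 (Y w) * 𝟙 (not (Y (w ∙ c))))
      ≡⟨ ∑-+ es _ _ ⟩
    ∑ es (λ w → 𝟙 (Y (w ∙ c))) + leave Y c
      ≡⟨ cong (_+ leave Y c) (∑-translate c (𝟙 ∘ Y)) ⟩
    card Y + leave Y c ∎
    where
    open ≡-Reasoning
    split : ∀ u v → 𝟙 (u ∨ v) ≡ 𝟙 u + 𝟙 v * 𝟙 (not u)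
    split true  true  = refl
    split true  false = refl
    split false true  = refl
    split false false = refl
    shifted : ∀ v → v ∙ a ≡ (v ∙ b) ∙ c
    shifted v = begin
      v ∙ a         ≡⟨ cong (v ∙_) c∙b≡a ⟨
      v ∙ (c ∙ b)   ≡⟨ cong (v ∙_) (comm c b) ⟩
      v ∙ (b ∙ c)   ≡⟨ assoc v b c ⟨
      (v ∙ b) ∙ c   ∎

  -- For a fixed x in `Y` the points x ∙ z are distinct, so at most `card Y` of the directions z
  -- keep x inside `Y`.
  ∑-stay≤ : ∀ Y zs → Unique zs → ∑ zs (stay Y) ≤ card Y * card Y
  ∑-stay≤ Y zs u = begin
    ∑ zs (λ z → ∑ es (λ x → 𝟙 (Y x) * 𝟙 (Y (x ∙ z))))
      ≡⟨ ∑-swap zs es _ ⟩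
    ∑ es (λ x → ∑ zs (λ z → 𝟙 (Y x) * 𝟙 (Y (x ∙ z))))
      ≡⟨ ∑-cong es (λ x → ∑-*ˡ zs (𝟙 (Y x)) _) ⟩
    ∑ es (λ x → 𝟙 (Y x) * ∑ zs (λ z → 𝟙 (Y (x ∙ z))))
      ≤⟨ ∑-mono es (λ x → *-monoʳ-≤ (𝟙 (Y x)) (fibre x)) ⟩
    ∑ es (λ x → 𝟙 (Y x) * card Y)
      ≡⟨ ∑-cong es (λ x → *-comm (𝟙 (Y x)) (card Y)) ⟩
    ∑ es (λ x → card Y * 𝟙 (Y x))
      ≡⟨ ∑-*ˡ es (card Y) _ ⟩
    card Y * card Y ∎
    where
    open ≤-Reasoning
    fibre : ∀ x → ∑ zs (λ z → 𝟙 (Y (x ∙ z))) ≤ card Y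
    fibre x = begin
      ∑ zs (λ z → 𝟙 (Y (x ∙ z)))   ≡⟨ ∑-map (x ∙_) zs (𝟙 ∘ Y) ⟨
      ∑ (map (x ∙_) zs) (𝟙 ∘ Y)    ≤⟨ ∑-⊆-all (𝟙 ∘ Y) (Unique-map⁺ (λ {y} {z} → ∙-cancelˡ x y z) u) ⟩
      card Y                        ∎

  -- By ∑-stay≤ at most half of Y stays in Y, on average over zs.
  spread : ∀ Y zs B → Unique zs → 2 * card Y ≤ length zs →
           (∀ {z} → z ∈ zs → leave Y z ≤ B) → card Y ≤ 2 * B
  spread Y []          B u 2Y≤ leave≤ = ≤-trans (m≤m+n _ _) (≤-trans 2Y≤ z≤n)
  spread Y zs@(_ ∷ _)  B u 2Y≤ leave≤ = *-cancelˡ-≤ L (+-cancelˡ-≤ (L * k) _ _ (begin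
    L * k + L * k             ≡⟨ double (L * k) ⟨
    2 * (L * k)               ≤⟨ *-monoʳ-≤ 2 bound ⟩
    2 * (k * k + L * B)       ≡⟨ expand k L B ⟩
    (2 * k) * k + L * (2 * B) ≤⟨ +-monoˡ-≤ _ (*-monoˡ-≤ k 2Y≤) ⟩
    L * k + L * (2 * B)       ∎))
    where
    open ≤-Reasoning
    k L : ℕ
    k = card Y
    L = length zs
    double : ∀ a → 2 * a ≡ a + a
    double = solve-∀
    expand : ∀ k L B → 2 * (k * k + L * B) ≡ (2 * k) * k + L * (2 * B)
    expand = solve-∀
    bound : L * k ≤ k * k + L * B
    bound = begin
      L * k                                 ≡⟨ ∑-const zs k ⟨
      ∑ zs (λ _ → k)                        ≡⟨ ∑-cong zs (stay+leave Y) ⟨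
      ∑ zs (λ z → stay Y z + leave Y z)     ≡⟨ ∑-+ zs (stay Y) (leave Y) ⟩
      ∑ zs (stay Y) + ∑ zs (leave Y)        ≤⟨ +-mono-≤ (∑-stay≤ Y zs u) (∑-mono-∈ zs leave≤) ⟩
      k * k + ∑ zs (λ _ → B)                ≡⟨ cong (k * k +_) (∑-const zs B) ⟩
      k * k + L * B                         ∎

  -- `Y` and the reflected set of all z ∙ y ⁻¹ with y in `Z` are together larger than the group, so
  -- they meet.
  two-sets-cover : ∀ Y Z z → length es < card Y + card Z →
                   ∃[ x ] (Y x ≡ true × Z (z ∙ (x ⁻¹)) ≡ true)
  two-sets-cover Y Z z big = find es (begin-strict
    ∑ es (λ _ → 1)                                        ≡⟨ ∑-const es 1 ⟩
    length es * 1                                         ≡⟨ *-identityʳ _ ⟩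
    length es                                             <⟨ big ⟩
    card Y + card Z                                       ≡⟨ cong (card Y +_) (∑-reflect z (𝟙 ∘ Z)) ⟨
    card Y + ∑ es (λ x → 𝟙 (Z (z ∙ (x ⁻¹))))              ≡⟨ ∑-+ es _ _ ⟨
    ∑ es (λ x → 𝟙 (Y x) + 𝟙 (Z (z ∙ (x ⁻¹))))             ∎)
    where
    open ≤-Reasoning
    find : ∀ xs → ∑ xs (λ _ → 1) < ∑ xs (λ x → 𝟙 (Y x) + 𝟙 (Z (z ∙ (x ⁻¹)))) →
           ∃[ x ] (Y x ≡ true × Z (z ∙ (x ⁻¹)) ≡ true)
    find []       ()
    find (x ∷ xs) lt with Y x in eqY | Z (z ∙ (x ⁻¹)) in eqZ
    ... | true  | true  = x , eqY , eqZ
    ... | true  | false = find xs (s<s⁻¹ lt)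
    ... | false | true  = find xs (s<s⁻¹ lt)
    ... | false | false = find xs (<-trans (n<1+n _) lt)

-- Prime fields and vector spaces over them

-- An interface to the integers modulo p: the later arguments use nothing but the field laws,
-- reduction `ι` from the naturals, and a choice `res` of representatives below p.
record PrimeField (p : ℕ) : Set₁ where
  infixl 6 _+ᶠ_
  infixl 7 _*ᶠ_
  field
    F                 : Set
    _+ᶠ_ _*ᶠ_         : F → F → F
    -ᶠ_ inv           : F → F
    0ᶠ 1ᶠ             : F
    isCommutativeRing : IsCommutativeRing _≡_ _+ᶠ_ _*ᶠ_ -ᶠ_ 0ᶠ 1ᶠ
    invʳ              : ∀ {x} → x ≢ 0ᶠ → x *ᶠ inv x ≡ 1ᶠ
    ι                 : ℕ → F
    res               : F → ℕ
    ι-+               : ∀ m n → ι (m + n) ≡ ι m +ᶠ ι n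
    ι-*               : ∀ m n → ι (m * n) ≡ ι m *ᶠ ι n
    ι-1               : ι 1 ≡ 1ᶠ
    ι-res             : ∀ x → ι (res x) ≡ x
    res<p             : ∀ x → res x < p
    ι≡0⇒∣             : ∀ n → ι n ≡ 0ᶠ → p ∣ n
    ∣⇒ι≡0             : ∀ n → p ∣ n → ι n ≡ 0ᶠ

-- Residues modulo p

module Residues (k : ℕ) where

  private
    p = suc k

  ι : ℕ → Fin p
  ι n = n mod p

  toℕ-ι : ∀ n → toℕ (ι n) ≡ n % p
  toℕ-ι n = toℕ-fromℕ< (m%n<n n p)

  ι-cong : ∀ m n → m % p ≡ n % p → ι m ≡ ι n
  ι-cong m n eq = toℕ-injective (trans (toℕ-ι m) (trans eq (sym (toℕ-ι n))))

  ι-toℕ : ∀ x → ι (toℕ x) ≡ x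
  ι-toℕ x = toℕ-injective (trans (toℕ-ι (toℕ x)) (m<n⇒m%n≡m (toℕ<n x)))

  add mul : Fin p → Fin p → Fin p
  add x y = ι (toℕ x + toℕ y)
  mul x y = ι (toℕ x * toℕ y)

  neg : Fin p → Fin p
  neg x = ι (p ∸ toℕ x)

  ι-+ : ∀ m n → ι (m + n) ≡ add (ι m) (ι n)
  ι-+ m n = ι-cong (m + n) (toℕ (ι m) + toℕ (ι n)) (begin
    (m + n) % p                          ≡⟨ %-distribˡ-+ m n p ⟩
    (m % p + n % p) % p                  ≡⟨ cong₂ (λ a b → (a + b) % p) (toℕ-ι m) (toℕ-ι n) ⟨
    (toℕ (ι m) + toℕ (ι n)) % p          ∎)
    where open ≡-Reasoning

  ι-* : ∀ m n → ι (m * n) ≡ mul (ι m) (ι n)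
  ι-* m n = ι-cong (m * n) (toℕ (ι m) * toℕ (ι n)) (begin
    (m * n) % p                          ≡⟨ %-distribˡ-* m n p ⟩
    (m % p * (n % p)) % p                ≡⟨ cong₂ (λ a b → (a * b) % p) (toℕ-ι m) (toℕ-ι n) ⟨
    (toℕ (ι m) * toℕ (ι n)) % p          ∎)
    where open ≡-Reasoning

  ι≡0⇒∣ : ∀ n → ι n ≡ ι 0 → p ∣ n
  ι≡0⇒∣ n eq = m%n≡0⇒n∣m n p (trans (sym (toℕ-ι n)) (cong toℕ eq))

  ∣⇒ι≡0 : ∀ n → p ∣ n → ι n ≡ ι 0
  ∣⇒ι≡0 n p∣n = ι-cong n 0 (n∣m⇒m%n≡0 n p p∣n)

  add-ι-toℕ : ∀ x n → add x (ι n) ≡ ι (toℕ x + n)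
  add-ι-toℕ x n = trans (cong (λ z → add z (ι n)) (sym (ι-toℕ x))) (sym (ι-+ (toℕ x) n))

  mul-ι-toℕ : ∀ x n → mul x (ι n) ≡ ι (toℕ x * n)
  mul-ι-toℕ x n = trans (cong (λ z → mul z (ι n)) (sym (ι-toℕ x))) (sym (ι-* (toℕ x) n))

  add-comm : ∀ x y → add x y ≡ add y x
  add-comm x y = cong ι (+-comm (toℕ x) (toℕ y))

  mul-comm : ∀ x y → mul x y ≡ mul y x
  mul-comm x y = cong ι (*-comm (toℕ x) (toℕ y))

  add-assoc : ∀ x y z → add (add x y) z ≡ add x (add y z)
  add-assoc x y z = begin
    add (add x y) z                   ≡⟨ add-comm (add x y) z ⟩
    add z (ι (toℕ x + toℕ y))         ≡⟨ add-ι-toℕ z (toℕ x + toℕ y) ⟩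
    ι (toℕ z + (toℕ x + toℕ y))       ≡⟨ cong ι (rotate (toℕ z) (toℕ x) (toℕ y)) ⟩
    ι (toℕ x + (toℕ y + toℕ z))       ≡⟨ add-ι-toℕ x (toℕ y + toℕ z) ⟨
    add x (add y z)                   ∎
    where
    open ≡-Reasoning
    rotate : ∀ c a b → c + (a + b) ≡ a + (b + c)
    rotate = solve-∀

  mul-assoc : ∀ x y z → mul (mul x y) z ≡ mul x (mul y z)
  mul-assoc x y z = begin
    mul (mul x y) z                   ≡⟨ mul-comm (mul x y) z ⟩
    mul z (ι (toℕ x * toℕ y))         ≡⟨ mul-ι-toℕ z (toℕ x * toℕ y) ⟩
    ι (toℕ z * (toℕ x * toℕ y))       ≡⟨ cong ι (rotate (toℕ z) (toℕ x) (toℕ y)) ⟩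
    ι (toℕ x * (toℕ y * toℕ z))       ≡⟨ mul-ι-toℕ x (toℕ y * toℕ z) ⟨
    mul x (mul y z)                   ∎
    where
    open ≡-Reasoning
    rotate : ∀ c a b → c * (a * b) ≡ a * (b * c)
    rotate = solve-∀

  add-identityʳ : ∀ x → add x (ι 0) ≡ x
  add-identityʳ x = trans (add-ι-toℕ x 0) (trans (cong ι (+-identityʳ (toℕ x))) (ι-toℕ x))

  mul-identityʳ : ∀ x → mul x (ι 1) ≡ x
  mul-identityʳ x = trans (mul-ι-toℕ x 1) (trans (cong ι (*-identityʳ (toℕ x))) (ι-toℕ x))

  add-inverseʳ : ∀ x → add x (neg x) ≡ ι 0
  add-inverseʳ x = begin
    add x (neg x)                ≡⟨ add-ι-toℕ x (p ∸ toℕ x) ⟩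
    ι (toℕ x + (p ∸ toℕ x))      ≡⟨ cong ι (m+[n∸m]≡n (<⇒≤ (toℕ<n x))) ⟩
    ι p                          ≡⟨ ∣⇒ι≡0 p ∣-refl ⟩
    ι 0                          ∎
    where open ≡-Reasoning

  mul-distribˡ : ∀ x y z → mul x (add y z) ≡ add (mul x y) (mul x z)
  mul-distribˡ x y z = begin
    mul x (ι (toℕ y + toℕ z))               ≡⟨ mul-ι-toℕ x (toℕ y + toℕ z) ⟩
    ι (toℕ x * (toℕ y + toℕ z))             ≡⟨ cong ι (*-distribˡ-+ (toℕ x) (toℕ y) (toℕ z)) ⟩
    ι (toℕ x * toℕ y + toℕ x * toℕ z)       ≡⟨ ι-+ (toℕ x * toℕ y) (toℕ x * toℕ z) ⟩
    add (mul x y) (mul x z)                 ∎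
    where open ≡-Reasoning

  isCommutativeRing : IsCommutativeRing _≡_ add mul neg (ι 0) (ι 1)
  isCommutativeRing = record
    { isRing = record
      { +-isAbelianGroup = record
        { isGroup = record
          { isMonoid = record
            { isSemigroup = record
              { isMagma = record { isEquivalence = isEquivalence ; ∙-cong = cong₂ add }
              ; assoc   = add-assoc
              }
            ; identity = (λ x → trans (add-comm (ι 0) x) (add-identityʳ x)) , add-identityʳ
            }
          ; inverse = (λ x → trans (add-comm (neg x) x) (add-inverseʳ x)) , add-inverseʳ
          ; ⁻¹-cong = cong neg
          }
        ; comm = add-comm
        }
      ; *-cong     = cong₂ mul
      ; *-assoc    = mul-assoc
      ; *-identity = (λ x → trans (mul-comm (ι 1) x) (mul-identityʳ x)) , mul-identityʳ
      ; distrib    = mul-distribˡ , λ x y z →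
          trans (mul-comm (add y z) x) (trans (mul-distribˡ x y z) (cong₂ add (mul-comm x y) (mul-comm x z)))
      }
    ; *-comm = mul-comm
    }

  -- The two shapes of a Bézout identity say v x ≡ -1 and v x ≡ 1 modulo p, hence the sign in the
  -- first case.
  bézout-inverse : ∀ (x : Fin p) → Bézout.Identity 1 p (toℕ x) → Fin p
  bézout-inverse x (Bézout.+- u v eq) = neg (ι v)
  bézout-inverse x (Bézout.-+ u v eq) = ι v

  bézout-inverseʳ : ∀ x (b : Bézout.Identity 1 p (toℕ x)) → mul x (bézout-inverse x b) ≡ ι 1
  bézout-inverseʳ x (Bézout.-+ u v eq) = begin
    mul x (ι v)        ≡⟨ mul-ι-toℕ x v ⟩
    ι (toℕ x * v)      ≡⟨ cong ι (trans (*-comm (toℕ x) v) (sym eq)) ⟩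
    ι (1 + u * p)      ≡⟨ ι-cong (1 + u * p) 1 ([m+kn]%n≡m%n 1 u p) ⟩
    ι 1                ∎
    where open ≡-Reasoning
  bézout-inverseʳ x (Bézout.+- u v eq) = begin
    mul x (neg (ι v))                          ≡⟨ mul-ι-toℕ x (p ∸ w) ⟩
    ι (toℕ x * (p ∸ w))                        ≡⟨ ι-cong (toℕ x * (p ∸ w)) (toℕ x * (p ∸ w) + u * p) (sym ([m+kn]%n≡m%n (toℕ x * (p ∸ w)) u p)) ⟩
    ι (toℕ x * (p ∸ w) + u * p)                ≡⟨ cong ι (cong (toℕ x * (p ∸ w) +_) (sym eq)) ⟩
    ι (toℕ x * (p ∸ w) + (1 + v * toℕ x))      ≡⟨ cong ι (regroup (toℕ x) (p ∸ w) v) ⟩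
    ι (1 + toℕ x * (v + (p ∸ w)))              ≡⟨ ι-+ 1 (toℕ x * (v + (p ∸ w))) ⟩
    add (ι 1) (ι (toℕ x * (v + (p ∸ w))))      ≡⟨ cong (add (ι 1)) (∣⇒ι≡0 (toℕ x * (v + (p ∸ w))) (∣n⇒∣m*n (toℕ x) (ι≡0⇒∣ (v + (p ∸ w)) vanish))) ⟩
    add (ι 1) (ι 0)                            ≡⟨ add-identityʳ (ι 1) ⟩
    ι 1                                        ∎
    where
    open ≡-Reasoning
    w : ℕ
    w = toℕ (ι v)
    regroup : ∀ a b c → a * b + (1 + c * a) ≡ 1 + a * (c + b)
    regroup = solve-∀
    vanish : ι (v + (p ∸ w)) ≡ ι 0
    vanish = trans (ι-+ v (p ∸ w)) (add-inverseʳ (ι v))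

  module _ (p-prime : Prime p) where

    coprime-identity : ∀ (x : Fin p) → x ≢ ι 0 → Bézout.Identity 1 p (toℕ x)
    coprime-identity x x≢0 = coprime-Bézout (prime⇒coprime p-prime {{≢-nonZero (x≢0 ∘ toℕ≡0)}} (toℕ<n x))
      where
      toℕ≡0 : toℕ x ≡ 0 → x ≡ ι 0
      toℕ≡0 eq = toℕ-injective (trans eq (sym (toℕ-ι 0)))

    inverse : Fin p → Fin p
    inverse x with x Fin.≟ ι 0
    -- An arbitrary value; the inverse law is stated for nonzero arguments.
    ... | yes _  = ι 0
    ... | no x≢0 = bézout-inverse x (coprime-identity x x≢0)

    inverseʳ : ∀ {x} → x ≢ ι 0 → mul x (inverse x) ≡ ι 1
    inverseʳ {x} x≢0 with x Fin.≟ ι 0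
    ... | yes x≡0 = contradiction x≡0 x≢0
    ... | no x≢0′ = bézout-inverseʳ x (coprime-identity x x≢0′)

    primeField : PrimeField p
    primeField = record
      { F                 = Fin p
      ; isCommutativeRing = isCommutativeRing
      ; inv               = inverse
      ; invʳ              = inverseʳ
      ; ι                 = ι
      ; res               = toℕ
      ; ι-+               = ι-+
      ; ι-*               = ι-*
      ; ι-1               = refl
      ; ι-res             = ι-toℕ
      ; res<p             = toℕ<n
      ; ι≡0⇒∣             = ι≡0⇒∣
      ; ∣⇒ι≡0             = ∣⇒ι≡0
      }

-- Coordinate vectors and dot products

length-cartesianProductWith : ∀ {A B C : Set} (f : A → B → C) xs ys →
  length (cartesianProductWith f xs ys) ≡ length xs * length ys
length-cartesianProductWith f []       ys = refl
length-cartesianProductWith f (x ∷ xs) ys = trans (length-++ (map (f x) ys))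
  (cong₂ _+_ (length-map (f x) ys) (length-cartesianProductWith f xs ys))

∑-cartesianProductWith : ∀ {A B C : Set} (f : A → B → C) xs ys h →
  ∑ (cartesianProductWith f xs ys) h ≡ ∑ xs (λ x → ∑ ys (λ y → h (f x y)))
∑-cartesianProductWith f []       ys h = refl
∑-cartesianProductWith f (x ∷ xs) ys h = trans (∑-++ (map (f x) ys) _ h)
  (cong₂ _+_ (∑-map (f x) ys h) (∑-cartesianProductWith f xs ys h))

vectors : {A : Set} → List A → ∀ d → List (Vec A d)
vectors xs zero    = [] ∷ []
vectors xs (suc d) = cartesianProductWith _∷_ xs (vectors xs d)

length-vectors : ∀ {A : Set} (xs : List A) d → length (vectors xs d) ≡ length xs ^ d
length-vectors xs zero    = refl
length-vectors xs (suc d) = trans (length-cartesianProductWith _∷_ xs (vectors xs d))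
  (cong (length xs *_) (length-vectors xs d))

vectors-unique : ∀ {A : Set} {xs : List A} → Unique xs → ∀ d → Unique (vectors xs d)
vectors-unique u zero    = [] ∷ []
vectors-unique u (suc d) = cartesianProductWith⁺ _∷_ ∷ᵛ-injective u (vectors-unique u d)

∈-vectors : ∀ {A : Set} {xs : List A} {d} (v : Vec A d) → (∀ i → Vec.lookup v i ∈ xs) → v ∈ vectors xs d
∈-vectors []      _  = here refl
∈-vectors (x ∷ v) v∈ = ∈-cartesianProductWith⁺ _∷_ (v∈ Fin.zero) (∈-vectors v (v∈ ∘ Fin.suc))

module LinearAlgebra {p : ℕ} (K : PrimeField p) where

  open PrimeField K public

  commutativeRing : CommutativeRing 0ℓ 0ℓ
  commutativeRing = record { isCommutativeRing = isCommutativeRing }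

  open CommutativeRing commutativeRing public using ()
    renaming ( +-assoc to +ᶠ-assoc; +-comm to +ᶠ-comm; +-identityˡ to +ᶠ-identityˡ; +-identityʳ to +ᶠ-identityʳ
             ; -‿inverseˡ to -ᶠ-inverseˡ; -‿inverseʳ to -ᶠ-inverseʳ; +-isAbelianGroup to +ᶠ-isAbelianGroup
             ; *-assoc to *ᶠ-assoc; *-comm to *ᶠ-comm; *-identityˡ to *ᶠ-identityˡ; *-identityʳ to *ᶠ-identityʳ
             ; distribʳ to *ᶠ-distribʳ; zeroˡ to *ᶠ-zeroˡ; zeroʳ to *ᶠ-zeroʳ)

  open RingProperties (CommutativeRing.ring commutativeRing) public using (-‿distribˡ-*; -‿distribʳ-*)
  module +ᶠ = GroupProperties (CommutativeRing.+-group commutativeRing)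

  almostCommutativeRing : AlmostCommutativeRing 0ℓ 0ℓ
  almostCommutativeRing = fromCommutativeRing commutativeRing (λ _ → nothing)

  module Solver = RingSolver almostCommutativeRing

  _≟ᶠ_ : (x y : F) → Dec (x ≡ y)
  x ≟ᶠ y = map′ (λ eq → trans (sym (ι-res x)) (trans (cong ι eq) (ι-res y))) (cong res) (res x ≟ res y)

  ι-0 : ι 0 ≡ 0ᶠ
  ι-0 = ∣⇒ι≡0 0 (p ∣0)

  ι-injective-< : ∀ {i j} → i < j → j < p → ι i ≢ ι j
  ι-injective-< {i} {j} i<j j<p eq = <⇒≱ (≤-<-trans (m∸n≤m j i) j<p)
    (∣⇒≤ {{>-nonZero (m<n⇒0<n∸m i<j)}} (ι≡0⇒∣ (j ∸ i) (+ᶠ.∙-cancelˡ (ι i) _ _ (begin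
      ι i +ᶠ ι (j ∸ i)    ≡⟨ ι-+ i (j ∸ i) ⟨
      ι (i + (j ∸ i))     ≡⟨ cong ι (m+[n∸m]≡n (<⇒≤ i<j)) ⟩
      ι j                 ≡⟨ eq ⟨
      ι i                 ≡⟨ +ᶠ-identityʳ (ι i) ⟨
      ι i +ᶠ 0ᶠ           ∎))))
    where open ≡-Reasoning

  ι≢0 : ∀ {n} → 0 < n → n < p → ι n ≢ 0ᶠ
  ι≢0 0<n n<p eq = ι-injective-< 0<n n<p (trans ι-0 (sym eq))

  elements : List F
  elements = applyUpTo ι p

  elements-complete : ∀ x → x ∈ elements
  elements-complete x = subst (_∈ elements) (ι-res x) (∈-applyUpTo⁺ ι (res<p x))

  elements-unique : Unique elements
  elements-unique = applyUpTo⁺₁ ι p (λ i<j j<p → ι-injective-< i<j j<p)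

  module 𝔽 = FiniteAbelianGroup +ᶠ-isAbelianGroup _≟ᶠ_ elements elements-unique elements-complete

  *ᶠ-inv-cancel : ∀ {u} → u ≢ 0ᶠ → ∀ x → (x *ᶠ inv u) *ᶠ u ≡ x
  *ᶠ-inv-cancel {u} u≢0 x = begin
    (x *ᶠ inv u) *ᶠ u   ≡⟨ *ᶠ-assoc x (inv u) u ⟩
    x *ᶠ (inv u *ᶠ u)   ≡⟨ cong (x *ᶠ_) (trans (*ᶠ-comm (inv u) u) (invʳ u≢0)) ⟩
    x *ᶠ 1ᶠ             ≡⟨ *ᶠ-identityʳ x ⟩
    x                   ∎
    where open ≡-Reasoning

  *ᶠ-cancelʳ-0 : ∀ {x u} → u ≢ 0ᶠ → x *ᶠ u ≡ 0ᶠ → x ≡ 0ᶠ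
  *ᶠ-cancelʳ-0 {x} {u} u≢0 xu≡0 = begin
    x                       ≡⟨ *ᶠ-identityʳ x ⟨
    x *ᶠ 1ᶠ                 ≡⟨ cong (x *ᶠ_) (invʳ u≢0) ⟨
    x *ᶠ (u *ᶠ inv u)       ≡⟨ *ᶠ-assoc x u (inv u) ⟨
    (x *ᶠ u) *ᶠ inv u       ≡⟨ cong (_*ᶠ inv u) xu≡0 ⟩
    0ᶠ *ᶠ inv u             ≡⟨ *ᶠ-zeroˡ (inv u) ⟩
    0ᶠ                      ∎
    where open ≡-Reasoning

  infixl 6 _⊕_
  infix  8 ⊖_
  infixr 7 _•_
  _⊕_ : ∀ {d} → Vec F d → Vec F d → Vec F d
  _⊕_ = Vec.zipWith _+ᶠ_

  ⊖_ : ∀ {d} → Vec F d → Vec F d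
  ⊖_ = Vec.map -ᶠ_

  _•_ : ∀ {d} → F → Vec F d → Vec F d
  c • x = Vec.map (c *ᶠ_) x

  𝟎 : ∀ {d} → Vec F d
  𝟎 = Vec.replicate _ 0ᶠ

  dot : ∀ {d} → Vec F d → Vec F d → F
  dot []      []      = 0ᶠ
  dot (a ∷ ξ) (x ∷ v) = a *ᶠ x +ᶠ dot ξ v

  _≟ᵛ_ : ∀ {d} (x y : Vec F d) → Dec (x ≡ y)
  _≟ᵛ_ = ≡-dec _≟ᶠ_

  ⊕-isAbelianGroup : ∀ d → IsAbelianGroup _≡_ (_⊕_ {d}) 𝟎 ⊖_
  ⊕-isAbelianGroup d = record
    { isGroup = record
      { isMonoid = record
        { isSemigroup = record
          { isMagma = record { isEquivalence = isEquivalence ; ∙-cong = cong₂ _⊕_ }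
          ; assoc   = zipWith-assoc +ᶠ-assoc
          }
        ; identity = zipWith-identityˡ +ᶠ-identityˡ , zipWith-identityʳ +ᶠ-identityʳ
        }
      ; inverse = zipWith-inverseˡ -ᶠ-inverseˡ , zipWith-inverseʳ -ᶠ-inverseʳ
      ; ⁻¹-cong = cong ⊖_
      }
    ; comm = zipWith-comm +ᶠ-comm
    }

  space : ∀ d → List (Vec F d)
  space = vectors elements

  module 𝕍 (d : ℕ) where
    open FiniteAbelianGroup (⊕-isAbelianGroup d) _≟ᵛ_ (space d) (vectors-unique elements-unique d)
      (λ v → ∈-vectors v (λ i → elements-complete _)) public
    open IsAbelianGroup (⊕-isAbelianGroup d) public using (assoc; comm; identityˡ; identityʳ; inverseˡ; inverseʳ)

  sumᵛ : ∀ {d} → List (Vec F d) → Vec F d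
  sumᵛ = List.foldr _⊕_ 𝟎

  sumᵛ-++ : ∀ {d} (S T : List (Vec F d)) → sumᵛ (S ++ T) ≡ sumᵛ S ⊕ sumᵛ T
  sumᵛ-++ {d} []      T = sym (𝕍.identityˡ d _)
  sumᵛ-++ {d} (x ∷ S) T = trans (cong (x ⊕_) (sumᵛ-++ S T)) (sym (𝕍.assoc d x _ _))

  length-elements : length elements ≡ p
  length-elements = length-applyUpTo ι p

  length-space : ∀ d → length (space d) ≡ p ^ d
  length-space d = trans (length-vectors elements d) (cong (_^ d) length-elements)

  dot-comm : ∀ {d} (ξ x : Vec F d) → dot ξ x ≡ dot x ξ
  dot-comm []      []      = refl
  dot-comm (a ∷ ξ) (x ∷ v) = cong₂ _+ᶠ_ (*ᶠ-comm a x) (dot-comm ξ v)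

  dot-⊕ʳ : ∀ {d} (ξ x y : Vec F d) → dot ξ (x ⊕ y) ≡ dot ξ x +ᶠ dot ξ y
  dot-⊕ʳ []      []      []      = sym (+ᶠ-identityʳ 0ᶠ)
  dot-⊕ʳ (a ∷ ξ) (x ∷ v) (y ∷ w) = trans (cong (a *ᶠ (x +ᶠ y) +ᶠ_) (dot-⊕ʳ ξ v w)) (expand a x y _ _)
    where
    open Solver using (solve; _⊜_) renaming (_⊕_ to _:+_; _⊗_ to _:*_)
    expand : ∀ a x y u v → a *ᶠ (x +ᶠ y) +ᶠ (u +ᶠ v) ≡ (a *ᶠ x +ᶠ u) +ᶠ (a *ᶠ y +ᶠ v)
    expand = solve 5 (λ a x y u v → ((a :* (x :+ y)) :+ (u :+ v)) ⊜ (((a :* x) :+ u) :+ ((a :* y) :+ v))) refl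

  dot-•ʳ : ∀ {d} (ξ : Vec F d) c x → dot ξ (c • x) ≡ c *ᶠ dot ξ x
  dot-•ʳ []      c []      = sym (*ᶠ-zeroʳ c)
  dot-•ʳ (a ∷ ξ) c (x ∷ v) = trans (cong (a *ᶠ (c *ᶠ x) +ᶠ_) (dot-•ʳ ξ c v)) (expand a c x _)
    where
    open Solver using (solve; _⊜_) renaming (_⊕_ to _:+_; _⊗_ to _:*_)
    expand : ∀ a c x u → a *ᶠ (c *ᶠ x) +ᶠ c *ᶠ u ≡ c *ᶠ (a *ᶠ x +ᶠ u)
    expand = solve 4 (λ a c x u → ((a :* (c :* x)) :+ (c :* u)) ⊜ (c :* ((a :* x) :+ u))) refl

  dot-𝟎ʳ : ∀ {d} (ξ : Vec F d) → dot ξ 𝟎 ≡ 0ᶠ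
  dot-𝟎ʳ []      = refl
  dot-𝟎ʳ (a ∷ ξ) = trans (cong₂ _+ᶠ_ (*ᶠ-zeroʳ a) (dot-𝟎ʳ ξ)) (+ᶠ-identityʳ 0ᶠ)

  dot-⊖ʳ : ∀ {d} (ξ x : Vec F d) → dot ξ (⊖ x) ≡ -ᶠ dot ξ x
  dot-⊖ʳ {d} ξ x = +ᶠ.inverseʳ-unique (dot ξ x) (dot ξ (⊖ x)) (begin
    dot ξ x +ᶠ dot ξ (⊖ x)   ≡⟨ dot-⊕ʳ ξ x (⊖ x) ⟨
    dot ξ (x ⊕ ⊖ x)          ≡⟨ cong (dot ξ) (𝕍.inverseʳ d x) ⟩
    dot ξ 𝟎                  ≡⟨ dot-𝟎ʳ ξ ⟩
    0ᶠ                       ∎)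
    where open ≡-Reasoning

  dot-⊕ˡ : ∀ {d} (ξ η x : Vec F d) → dot (ξ ⊕ η) x ≡ dot ξ x +ᶠ dot η x
  dot-⊕ˡ ξ η x = trans (dot-comm (ξ ⊕ η) x) (trans (dot-⊕ʳ x ξ η) (cong₂ _+ᶠ_ (dot-comm x ξ) (dot-comm x η)))

  dot-•ˡ : ∀ {d} c (ξ x : Vec F d) → dot (c • ξ) x ≡ c *ᶠ dot ξ x
  dot-•ˡ c ξ x = trans (dot-comm (c • ξ) x) (trans (dot-•ʳ x c ξ) (cong (c *ᶠ_) (dot-comm x ξ)))

  dot-𝟎ˡ : ∀ {d} (x : Vec F d) → dot 𝟎 x ≡ 0ᶠ
  dot-𝟎ˡ x = trans (dot-comm 𝟎 x) (dot-𝟎ʳ x)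

  dot-⊖ˡ : ∀ {d} (ξ x : Vec F d) → dot (⊖ ξ) x ≡ -ᶠ dot ξ x
  dot-⊖ˡ ξ x = trans (dot-comm (⊖ ξ) x) (trans (dot-⊖ʳ x ξ) (cong -ᶠ_ (dot-comm x ξ)))

  -- If the leading coordinate of z is nonzero, the other coordinates of ξ determine the leading
  -- one. If it is zero, the leading coordinate of ξ is free and the count is p times the count for
  -- the tail of z.
  hyperplane-size : ∀ e (z : Vec F (suc e)) → z ≢ 𝟎 → ∀ b →
    ∑ (space (suc e)) (λ ξ → 𝟙? (dot ξ z ≟ᶠ b)) ≡ p ^ e
  hyperplane-size e (z ∷ v) z≢𝟎 b with z ≟ᶠ 0ᶠ
  ... | no z≢0 = begin
    ∑ (space (suc e)) (λ ξ → 𝟙? (dot ξ (z ∷ v) ≟ᶠ b))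
      ≡⟨ ∑-cartesianProductWith _∷_ elements (space e) _ ⟩
    ∑ elements (λ a → ∑ (space e) (λ ξ → 𝟙? ((a *ᶠ z +ᶠ dot ξ v) ≟ᶠ b)))
      ≡⟨ ∑-swap elements (space e) _ ⟩
    ∑ (space e) (λ ξ → ∑ elements (λ a → 𝟙? ((a *ᶠ z +ᶠ dot ξ v) ≟ᶠ b)))
      ≡⟨ ∑-cong (space e) (λ ξ → unique-solution (dot ξ v)) ⟩
    ∑ (space e) (λ _ → 1)
      ≡⟨ trans (∑-const (space e) 1) (trans (*-identityʳ _) (length-space e)) ⟩
    p ^ e ∎
    where
    open ≡-Reasoning
    solution : F → F
    solution c = (b +ᶠ -ᶠ c) *ᶠ inv z
    to : ∀ c a → a *ᶠ z +ᶠ c ≡ b → solution c ≡ a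
    to c a eq = begin
      (b +ᶠ -ᶠ c) *ᶠ inv z                   ≡⟨ cong (λ b → (b +ᶠ -ᶠ c) *ᶠ inv z) eq ⟨
      ((a *ᶠ z +ᶠ c) +ᶠ -ᶠ c) *ᶠ inv z       ≡⟨ cong (_*ᶠ inv z) (𝔽.x∙a∙a⁻¹ (a *ᶠ z) c) ⟩
      (a *ᶠ z) *ᶠ inv z                      ≡⟨ *ᶠ-assoc a z (inv z) ⟩
      a *ᶠ (z *ᶠ inv z)                      ≡⟨ cong (a *ᶠ_) (invʳ z≢0) ⟩
      a *ᶠ 1ᶠ                                ≡⟨ *ᶠ-identityʳ a ⟩
      a                                      ∎
    from : ∀ c a → solution c ≡ a → a *ᶠ z +ᶠ c ≡ b
    from c a refl = trans (cong (_+ᶠ c) (*ᶠ-inv-cancel z≢0 (b +ᶠ -ᶠ c))) (𝔽.x∙a⁻¹∙a b c)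
    unique-solution : ∀ c → ∑ elements (λ a → 𝟙? ((a *ᶠ z +ᶠ c) ≟ᶠ b)) ≡ 1
    unique-solution c = trans
      (∑-cong elements (λ a → trans (𝟙?-⇔ (_ ≟ᶠ b) (solution c ≟ᶠ a) (to c a) (from c a)) (sym (*-identityʳ _))))
      (𝔽.∑-𝟙≟ (solution c) (λ _ → 1))
  hyperplane-size zero    (z ∷ [])  z≢𝟎 b | yes refl = contradiction refl z≢𝟎
  hyperplane-size (suc e) (z ∷ v)   z≢𝟎 b | yes refl = begin
    ∑ (space (suc (suc e))) (λ ξ → 𝟙? (dot ξ (z ∷ v) ≟ᶠ b))
      ≡⟨ ∑-cartesianProductWith _∷_ elements (space (suc e)) _ ⟩
    ∑ elements (λ a → ∑ (space (suc e)) (λ ξ → 𝟙? ((a *ᶠ z +ᶠ dot ξ v) ≟ᶠ b)))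
      ≡⟨ ∑-cong elements (λ a → ∑-cong (space (suc e)) (λ ξ → cong (λ c → 𝟙? (c ≟ᶠ b))
           (trans (cong (_+ᶠ dot ξ v) (*ᶠ-zeroʳ a)) (+ᶠ-identityˡ _)))) ⟩
    ∑ elements (λ a → ∑ (space (suc e)) (λ ξ → 𝟙? (dot ξ v ≟ᶠ b)))
      ≡⟨ ∑-cong elements (λ _ → hyperplane-size e v (z≢𝟎 ∘ cong (0ᶠ ∷_)) b) ⟩
    ∑ elements (λ _ → p ^ e)
      ≡⟨ trans (∑-const elements _) (cong (_* p ^ e) length-elements) ⟩
    p ^ suc e ∎
    where open ≡-Reasoning

-- Hyperplane sections of a set

sq : ℕ → ℕ
sq n = n * n

sq-∣-∣ : ∀ m n → sq ∣ m - n ∣ + 2 * (m * n) ≡ sq m + sq n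
sq-∣-∣ m n with ≤-total m n
... | inj₁ m≤n = begin
  sq ∣ m - n ∣ + 2 * (m * n)              ≡⟨ cong (λ k → sq k + 2 * (m * n)) (m≤n⇒∣m-n∣≡n∸m m≤n) ⟩
  sq (n ∸ m) + 2 * (m * n)                ≡⟨ cong (λ k → sq (n ∸ m) + 2 * (m * k)) (m+[n∸m]≡n m≤n) ⟨
  sq (n ∸ m) + 2 * (m * (m + (n ∸ m)))    ≡⟨ square m (n ∸ m) ⟩
  sq m + sq (m + (n ∸ m))                 ≡⟨ cong (λ k → sq m + sq k) (m+[n∸m]≡n m≤n) ⟩
  sq m + sq n                             ∎
  where
  open ≡-Reasoning
  square : ∀ m k → k * k + 2 * (m * (m + k)) ≡ m * m + (m + k) * (m + k)
  square = solve-∀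
... | inj₂ n≤m = begin
  sq ∣ m - n ∣ + 2 * (m * n)              ≡⟨ cong (λ k → sq k + 2 * (m * n)) (trans (∣-∣-comm m n) (m≤n⇒∣m-n∣≡n∸m n≤m)) ⟩
  sq (m ∸ n) + 2 * (m * n)                ≡⟨ cong (λ k → sq (m ∸ n) + 2 * (k * n)) (m+[n∸m]≡n n≤m) ⟨
  sq (m ∸ n) + 2 * ((n + (m ∸ n)) * n)    ≡⟨ square n (m ∸ n) ⟩
  sq (n + (m ∸ n)) + sq n                 ≡⟨ cong (λ k → sq k + sq n) (m+[n∸m]≡n n≤m) ⟩
  sq m + sq n                             ∎
  where
  open ≡-Reasoning
  square : ∀ n k → k * k + 2 * ((n + k) * n) ≡ (n + k) * (n + k) + n * n
  square = solve-∀

-- Square the triangle inequality and use 2 u v ≤ u² + v².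
sq-triangle : ∀ a b c → sq ∣ a - c ∣ ≤ 2 * sq ∣ a - b ∣ + 2 * sq ∣ b - c ∣
sq-triangle a b c = begin
  sq ∣ a - c ∣                             ≤⟨ *-mono-≤ (∣-∣-triangle a b c) (∣-∣-triangle a b c) ⟩
  sq (u + v)                               ≡⟨ expand u v ⟩
  2 * (u * v) + (sq u + sq v)              ≤⟨ +-monoˡ-≤ _ (m≤n+m _ (sq ∣ u - v ∣)) ⟩
  sq ∣ u - v ∣ + 2 * (u * v) + (sq u + sq v) ≡⟨ cong (_+ (sq u + sq v)) (sq-∣-∣ u v) ⟩
  sq u + sq v + (sq u + sq v)              ≡⟨ collect (sq u) (sq v) ⟩
  2 * sq u + 2 * sq v                      ∎
  where
  open ≤-Reasoning
  u v : ℕ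
  u = ∣ a - b ∣
  v = ∣ b - c ∣
  expand : ∀ u v → (u + v) * (u + v) ≡ 2 * (u * v) + (u * u + v * v)
  expand = solve-∀
  collect : ∀ x y → x + y + (x + y) ≡ 2 * x + 2 * y
  collect = solve-∀

module Variation {p : ℕ} (K : PrimeField p) where
  open LinearAlgebra K

  -- `variation g u` is the squared Euclidean distance between g and its translate by u. Being
  -- quadratic it expands into autocorrelations, and these can be summed over all functionals by
  -- double counting.
  variation correlation : (F → ℕ) → F → ℕ
  variation   g u = ∑ elements (λ c → sq ∣ g c - g (c +ᶠ u) ∣)
  correlation g u = ∑ elements (λ c → g c * g (c +ᶠ u))

  variation-neg : ∀ g u → variation g (-ᶠ u) ≡ variation g u
  variation-neg g u = trans (sym (𝔽.∑-translate u (λ c → sq ∣ g c - g (c +ᶠ -ᶠ u) ∣)))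
    (∑-cong elements (λ c → cong sq (trans (∣-∣-comm (g (c +ᶠ u)) _)
      (cong (λ z → ∣ g z - g (c +ᶠ u) ∣) (𝔽.x∙a∙a⁻¹ c u)))))

  variation-+ : ∀ g u v → variation g (u +ᶠ v) ≤ 2 * variation g u + 2 * variation g v
  variation-+ g u v = begin
    variation g (u +ᶠ v)
      ≡⟨ ∑-cong elements (λ c → cong (λ z → sq ∣ g c - g z ∣) (sym (+ᶠ-assoc c u v))) ⟩
    ∑ elements (λ c → sq ∣ g c - g ((c +ᶠ u) +ᶠ v) ∣)
      ≤⟨ ∑-mono elements (λ c → sq-triangle (g c) (g (c +ᶠ u)) _) ⟩
    ∑ elements (λ c → 2 * sq ∣ g c - g (c +ᶠ u) ∣ + 2 * h (c +ᶠ u))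
      ≡⟨ ∑-+ elements _ _ ⟩
    ∑ elements (λ c → 2 * sq ∣ g c - g (c +ᶠ u) ∣) + ∑ elements (λ c → 2 * h (c +ᶠ u))
      ≡⟨ cong₂ _+_ (∑-*ˡ elements 2 _)
           (trans (∑-*ˡ elements 2 _) (cong (2 *_) (𝔽.∑-translate u h))) ⟩
    2 * variation g u + 2 * variation g v ∎
    where
    open ≤-Reasoning
    h : F → ℕ
    h c = sq ∣ g c - g (c +ᶠ v) ∣

  variation+correlation : ∀ g u → variation g u + 2 * correlation g u ≡ 2 * correlation g 0ᶠ
  variation+correlation g u = begin
    variation g u + 2 * correlation g u
      ≡⟨ cong (variation g u +_) (∑-*ˡ elements 2 _) ⟨
    variation g u + ∑ elements (λ c → 2 * (g c * g (c +ᶠ u)))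
      ≡⟨ ∑-+ elements _ _ ⟨
    ∑ elements (λ c → sq ∣ g c - g (c +ᶠ u) ∣ + 2 * (g c * g (c +ᶠ u)))
      ≡⟨ ∑-cong elements (λ c → sq-∣-∣ (g c) (g (c +ᶠ u))) ⟩
    ∑ elements (λ c → sq (g c) + sq (g (c +ᶠ u)))
      ≡⟨ ∑-+ elements _ _ ⟩
    ∑ elements (sq ∘ g) + ∑ elements (λ c → sq (g (c +ᶠ u)))
      ≡⟨ cong (∑ elements (sq ∘ g) +_) (𝔽.∑-translate u (sq ∘ g)) ⟩
    ∑ elements (sq ∘ g) + ∑ elements (sq ∘ g)
      ≡⟨ double (∑ elements (sq ∘ g)) ⟩
    2 * ∑ elements (sq ∘ g)
      ≡⟨ cong (2 *_) (∑-cong elements (λ c → cong (λ z → g c * g z) (+ᶠ-identityʳ c))) ⟨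
    2 * correlation g 0ᶠ ∎
    where
    open ≡-Reasoning
    double : ∀ a → a + a ≡ 2 * a
    double = solve-∀

  module Radon (e : ℕ) (Y : Vec F (suc e) → Bool) where
    private
      d = suc e
    open 𝕍 d using (card; stay; leave; stay+leave; ∑-𝟙≟; x∙a⁻¹∙a; identityʳ; identityˡ)

    A : Vec F d → ℕ
    A x = 𝟙 (Y x)

    -- The discrete Radon transform of the indicator of `Y`.
    profile : Vec F d → F → ℕ
    profile ξ c = ∑ (space d) (λ y → 𝟙? (dot ξ y ≟ᶠ c) * A y)

    correlation-profile : ∀ ξ u →
      correlation (profile ξ) u ≡ ∑ (space d) (λ x → profile ξ (dot ξ x +ᶠ u) * A x)
    correlation-profile ξ u = begin
      ∑ elements (λ c → profile ξ c * g c)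
        ≡⟨ ∑-cong elements (λ c → trans (*-comm (profile ξ c) (g c)) (sym (∑-*ˡ (space d) (g c) _))) ⟩
      ∑ elements (λ c → ∑ (space d) (λ x → g c * (𝟙? (dot ξ x ≟ᶠ c) * A x)))
        ≡⟨ ∑-swap elements (space d) _ ⟩
      ∑ (space d) (λ x → ∑ elements (λ c → g c * (𝟙? (dot ξ x ≟ᶠ c) * A x)))
        ≡⟨ ∑-cong (space d) (λ x → trans
             (∑-cong elements (λ c → rotate (g c) (𝟙? (dot ξ x ≟ᶠ c)) (A x)))
             (𝔽.∑-𝟙≟ (dot ξ x) (λ c → g c * A x))) ⟩
      ∑ (space d) (λ x → g (dot ξ x) * A x) ∎
      where
      open ≡-Reasoning
      g : F → ℕ
      g c = profile ξ (c +ᶠ u)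
      rotate : ∀ a b c → a * (b * c) ≡ b * (a * c)
      rotate = solve-∀

    -- A nonzero vector is annihilated by `q` functionals, the zero vector by all p ^ d = `q` + `D`
    -- of them.
    q D : ℕ
    q = p ^ e
    D = (p ∸ 1) * p ^ e

    p^d≡q+D : p ^ d ≡ q + D
    p^d≡q+D = cong (_* p ^ e) {p} {suc (p ∸ 1)} (sym (m+[n∸m]≡n (≤-trans (s≤s z≤n) (res<p 0ᶠ))))

    incidence : ∀ x y → ∑ (space d) (λ ξ → 𝟙? (dot ξ y ≟ᶠ dot ξ x)) ≡ q + D * 𝟙? (x ≟ᵛ y)
    incidence x y with x ≟ᵛ y
    ... | yes refl = begin
      ∑ (space d) (λ ξ → 𝟙? (dot ξ x ≟ᶠ dot ξ x))   ≡⟨ ∑-cong (space d) (λ ξ → 𝟙?-yes (dot ξ x ≟ᶠ dot ξ x) refl) ⟩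
      ∑ (space d) (λ _ → 1)                          ≡⟨ trans (∑-const (space d) 1) (*-identityʳ _) ⟩
      length (space d)                               ≡⟨ length-space d ⟩
      p ^ d                                          ≡⟨ p^d≡q+D ⟩
      q + D                                          ≡⟨ cong (q +_) (*-identityʳ D) ⟨
      q + D * 1                                      ∎
      where open ≡-Reasoning
    ... | no x≢y = begin
      ∑ (space d) (λ ξ → 𝟙? (dot ξ y ≟ᶠ dot ξ x))   ≡⟨ ∑-cong (space d) (λ ξ → 𝟙?-⇔ (dot ξ y ≟ᶠ dot ξ x) (dot ξ z ≟ᶠ 0ᶠ) (to ξ) (from ξ)) ⟩
      ∑ (space d) (λ ξ → 𝟙? (dot ξ z ≟ᶠ 0ᶠ))        ≡⟨ hyperplane-size e z z≢𝟎 0ᶠ ⟩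
      q                                              ≡⟨ +-identityʳ q ⟨
      q + 0                                          ≡⟨ cong (q +_) (*-zeroʳ D) ⟨
      q + D * 0                                      ∎
      where
      open ≡-Reasoning
      z : Vec F d
      z = y ⊕ ⊖ x
      dot-z : ∀ ξ → dot ξ z ≡ dot ξ y +ᶠ -ᶠ dot ξ x
      dot-z ξ = trans (dot-⊕ʳ ξ y (⊖ x)) (cong (dot ξ y +ᶠ_) (dot-⊖ʳ ξ x))
      z≢𝟎 : z ≢ 𝟎
      z≢𝟎 z≡𝟎 = x≢y (sym (trans (sym (x∙a⁻¹∙a y x)) (trans (cong (_⊕ x) z≡𝟎) (identityˡ x))))
      to : ∀ ξ → dot ξ y ≡ dot ξ x → dot ξ z ≡ 0ᶠ
      to ξ eq = trans (dot-z ξ) (trans (cong (_+ᶠ -ᶠ dot ξ x) eq) (-ᶠ-inverseʳ _))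
      from : ∀ ξ → dot ξ z ≡ 0ᶠ → dot ξ y ≡ dot ξ x
      from ξ eq = trans (sym (𝔽.x∙a⁻¹∙a (dot ξ y) (dot ξ x)))
        (trans (cong (_+ᶠ dot ξ x) (trans (sym (dot-z ξ)) eq)) (+ᶠ-identityˡ _))

    -- Both sides count the triples (ξ, x, y) with x and y in `Y` and ξ · y = ξ · (x ⊕ a): a pair
    -- (x, y) contributes `q`, and `D` more if y = x ⊕ a.
    ∑-correlation : ∀ a →
      ∑ (space d) (λ ξ → correlation (profile ξ) (dot ξ a)) ≡ q * card Y * card Y + D * stay Y a
    ∑-correlation a = begin
      ∑ (space d) (λ ξ → correlation (profile ξ) (dot ξ a))
        ≡⟨ ∑-cong (space d) (λ ξ → trans (correlation-profile ξ (dot ξ a))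
             (∑-cong (space d) (λ x → trans (*-comm _ (A x)) (cong (λ c → A x * profile ξ c) (sym (dot-⊕ʳ ξ x a)))))) ⟩
      ∑ (space d) (λ ξ → ∑ (space d) (λ x → A x * profile ξ (dot ξ (x ⊕ a))))
        ≡⟨ trans (∑-swap (space d) (space d) _) (∑-cong (space d) (λ x → ∑-*ˡ (space d) (A x) _)) ⟩
      ∑ (space d) (λ x → A x * ∑ (space d) (λ ξ → profile ξ (dot ξ (x ⊕ a))))
        ≡⟨ ∑-cong (space d) (λ x → trans (cong (A x *_) (∑-profile (x ⊕ a))) (expand (A x) q (card Y) D _)) ⟩
      ∑ (space d) (λ x → q * card Y * A x + D * (A x * A (x ⊕ a)))
        ≡⟨ trans (∑-+ (space d) _ _) (cong₂ _+_ (∑-*ˡ (space d) (q * card Y) A) (∑-*ˡ (space d) D _)) ⟩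
      q * card Y * card Y + D * stay Y a ∎
      where
      open ≡-Reasoning
      expand : ∀ a q c D s → a * (q * c + D * s) ≡ q * c * a + D * (a * s)
      expand = solve-∀
      distribute : ∀ q D i a → (q + D * i) * a ≡ q * a + D * (i * a)
      distribute = solve-∀
      ∑-profile : ∀ x → ∑ (space d) (λ ξ → profile ξ (dot ξ x)) ≡ q * card Y + D * A x
      ∑-profile x = begin
        ∑ (space d) (λ ξ → ∑ (space d) (λ y → 𝟙? (dot ξ y ≟ᶠ dot ξ x) * A y))
          ≡⟨ ∑-swap (space d) (space d) _ ⟩
        ∑ (space d) (λ y → ∑ (space d) (λ ξ → 𝟙? (dot ξ y ≟ᶠ dot ξ x) * A y))
          ≡⟨ ∑-cong (space d) (λ y → trans (∑-cong (space d) (λ ξ → *-comm _ (A y)))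
               (trans (∑-*ˡ (space d) (A y) _) (trans (*-comm (A y) _) (cong (_* A y) (incidence x y))))) ⟩
        ∑ (space d) (λ y → (q + D * 𝟙? (x ≟ᵛ y)) * A y)
          ≡⟨ ∑-cong (space d) (λ y → distribute q D (𝟙? (x ≟ᵛ y)) (A y)) ⟩
        ∑ (space d) (λ y → q * A y + D * (𝟙? (x ≟ᵛ y) * A y))
          ≡⟨ trans (∑-+ (space d) _ _) (cong₂ _+_ (∑-*ˡ (space d) q A) (∑-*ˡ (space d) D _)) ⟩
        q * card Y + D * ∑ (space d) (λ y → 𝟙? (x ≟ᵛ y) * A y)
          ≡⟨ cong (λ s → q * card Y + D * s) (∑-𝟙≟ x A) ⟩
        q * card Y + D * A x ∎

    stay-𝟎 : stay Y 𝟎 ≡ card Y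
    stay-𝟎 = ∑-cong (space d) (λ x → trans (cong (λ z → A x * A z) (identityʳ x)) (idem (Y x)))
      where
      idem : ∀ b → 𝟙 b * 𝟙 b ≡ 𝟙 b
      idem true  = refl
      idem false = refl

    -- Discrete Radon inversion: the variations of the hyperplane counts of Y in all
    -- directions determine how much of Y a translation moves out of Y.
    ∑-variation : ∀ a → ∑ (space d) (λ ξ → variation (profile ξ) (dot ξ a)) ≡ 2 * D * leave Y a
    ∑-variation a = +-cancelʳ-≡ (2 * (q * card Y * card Y + D * stay Y a)) _ _ (begin
      ∑ (space d) N + 2 * (q * card Y * card Y + D * stay Y a)
        ≡⟨ cong (λ s → ∑ (space d) N + 2 * s) (∑-correlation a) ⟨
      ∑ (space d) N + 2 * ∑ (space d) (λ ξ → correlation (profile ξ) (dot ξ a))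
        ≡⟨ cong (∑ (space d) N +_) (∑-*ˡ (space d) 2 _) ⟨
      ∑ (space d) N + ∑ (space d) (λ ξ → 2 * correlation (profile ξ) (dot ξ a))
        ≡⟨ ∑-+ (space d) _ _ ⟨
      ∑ (space d) (λ ξ → N ξ + 2 * correlation (profile ξ) (dot ξ a))
        ≡⟨ ∑-cong (space d) (λ ξ → variation+correlation (profile ξ) (dot ξ a)) ⟩
      ∑ (space d) (λ ξ → 2 * correlation (profile ξ) 0ᶠ)
        ≡⟨ ∑-cong (space d) (λ ξ → cong (λ c → 2 * correlation (profile ξ) c) (sym (dot-𝟎ʳ ξ))) ⟩
      ∑ (space d) (λ ξ → 2 * correlation (profile ξ) (dot ξ 𝟎))
        ≡⟨ ∑-*ˡ (space d) 2 _ ⟩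
      2 * ∑ (space d) (λ ξ → correlation (profile ξ) (dot ξ 𝟎))
        ≡⟨ cong (2 *_) (∑-correlation 𝟎) ⟩
      2 * (q * card Y * card Y + D * stay Y 𝟎)
        ≡⟨ cong (λ s → 2 * (q * card Y * card Y + D * s)) (trans stay-𝟎 (sym (stay+leave Y a))) ⟩
      2 * (q * card Y * card Y + D * (stay Y a + leave Y a))
        ≡⟨ regroup (q * card Y * card Y) D (stay Y a) (leave Y a) ⟩
      2 * D * leave Y a + 2 * (q * card Y * card Y + D * stay Y a) ∎)
      where
      open ≡-Reasoning
      N : Vec F d → ℕ
      N ξ = variation (profile ξ) (dot ξ a)
      regroup : ∀ c D s l → 2 * (c + D * (s + l)) ≡ 2 * D * l + 2 * (c + D * s)
      regroup = solve-∀

-- Small multiples in prime fields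

∑-shift : ∀ t m n (f : ℕ → ℕ) → t + m ≤ n → ∑ (upTo m) (λ s → f (t + s)) ≤ ∑ (upTo n) f
∑-shift t m n f t+m≤n = ≤-trans (≤-reflexive (sym (∑-map (t +_) (upTo m) f)))
  (∑-⊆ f (Unique-map⁺ (λ {i} {j} → +-cancelˡ-≡ t i j) (upTo⁺ m)) inside)
  where
  inside : ∀ {x} → x ∈ map (t +_) (upTo m) → x ∈ upTo n
  inside x∈ with s , s∈ , refl ← ∈-map⁻ (t +_) x∈ = ∈-upTo⁺ (<-≤-trans (+-monoʳ-< t (∈-upTo⁻ s∈)) t+m≤n)

m*n≤o⇒m≤o/n : ∀ m n {o} .{{_ : NonZero n}} → m * n ≤ o → m ≤ o / n
m*n≤o⇒m≤o/n m n le = ≤-trans (≤-reflexive (sym (m*n/n≡m m n))) (/-monoˡ-≤ n le)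

module Approximation {p : ℕ} (K : PrimeField p) (W : ℕ) .{{_ : NonZero W}} (W<p : W < p) where
  open LinearAlgebra K

  private
    instance
      p≢0 : NonZero p
      p≢0 = >-nonZero (≤-<-trans z≤n W<p)

  H : ℕ
  H = p / W

  H>0 : 0 < H
  H>0 = m≥n⇒m/n>0 (<⇒≤ W<p)

  _≈±_ : F → F → Set
  x ≈± y = (x ≡ y) ⊎ (x ≡ -ᶠ y)

  -- u and u′ are linked when j u′ = ± r u with j small and r of medium size, so
  -- that the multiples of u and u′ by at most H already cover the whole field.
  Linked : F → F → Set
  Linked u u′ = ∃[ j ] ∃[ r ] (j ≤ W × W * W ≤ r × r * W ≤ p × (ι j *ᶠ u′) ≈± (ι r *ᶠ u))

  -- The ratios ± r / j with r < W² and 1 ≤ j ≤ W are those for which Dirichlet's approximation may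
  -- fail to give a link.
  fractions smallRatios : List F
  fractions   = cartesianProductWith (λ r j → ι r *ᶠ inv (ι (suc j))) (upTo (W * W)) (upTo W)
  smallRatios = fractions ++ map -ᶠ_ fractions

  length-smallRatios : length smallRatios ≡ 2 * (W * W * W)
  length-smallRatios = trans (length-++ fractions) (trans
    (cong₂ _+_ len (trans (length-map -ᶠ_ fractions) len)) (double (W * W * W)))
    where
    len : length fractions ≡ W * W * W
    len = trans (length-cartesianProductWith _ (upTo (W * W)) (upTo W))
      (cong₂ _*_ (length-upTo (W * W)) (length-upTo W))
    double : ∀ a → a + a ≡ 2 * a
    double = solve-∀

  ι-% : ∀ n → ι (n % p) ≡ ι n
  ι-% n = sym (begin
    ι n                              ≡⟨ cong ι (m≡m%n+[m/n]*n n p) ⟩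
    ι (n % p + n / p * p)            ≡⟨ ι-+ _ _ ⟩
    ι (n % p) +ᶠ ι (n / p * p)       ≡⟨ cong (ι (n % p) +ᶠ_) (∣⇒ι≡0 _ (n∣m*n (n / p))) ⟩
    ι (n % p) +ᶠ 0ᶠ                  ≡⟨ +ᶠ-identityʳ _ ⟩
    ι (n % p)                        ∎)
    where open ≡-Reasoning

  same-quotient : ∀ x y → x / p ≡ y / p → y ≤ x + p
  same-quotient x y eq = begin
    y                      ≡⟨ m≡m%n+[m/n]*n y p ⟩
    y % p + y / p * p      ≤⟨ +-mono-≤ (m%n≤n y p) (≤-reflexive (cong (_* p) (sym eq))) ⟩
    p + x / p * p          ≤⟨ +-monoʳ-≤ p (m/n*n≤m x p) ⟩
    p + x                  ≡⟨ +-comm p x ⟩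
    x + p                  ∎
    where open ≤-Reasoning

  -- Among the W + 1 multiples 0, ρ, ..., W ρ two have residues in the same one of W intervals of
  -- length p / W; the difference of these two multiples is small up to sign.
  dirichlet : ∀ ρ → ∃[ j ] ∃[ r ] (0 < j × j ≤ W × r * W ≤ p × (ι j *ᶠ ρ) ≈± ι r)
  dirichlet ρ with pigeonhole (n<1+n W) box
    where
    box : Fin (suc W) → Fin W
    box j = Fin.fromℕ< {(toℕ j * res ρ) % p * W / p} (m<n*o⇒m/o<n (begin-strict
      (toℕ j * res ρ) % p * W   <⟨ *-monoˡ-< W (m%n<n _ p) ⟩
      p * W                     ≡⟨ *-comm p W ⟩
      W * p                     ∎))
      where open ≤-Reasoning
  ... | i , j , i<j , same = toℕ j ∸ toℕ i , gap
    where
    a b : ℕ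
    a = (toℕ i * res ρ) % p
    b = (toℕ j * res ρ) % p
    ι-multiple : ∀ k → ι ((k * res ρ) % p) ≡ ι k *ᶠ ρ
    ι-multiple k = trans (ι-% (k * res ρ)) (trans (ι-* k (res ρ)) (cong (ι k *ᶠ_) (ι-res ρ)))
    boxes : a * W / p ≡ b * W / p
    boxes = trans (sym (toℕ-fromℕ< _)) (trans (cong toℕ same) (toℕ-fromℕ< _))
    ιb≡ : ι b ≡ ι a +ᶠ ι (toℕ j ∸ toℕ i) *ᶠ ρ
    ιb≡ = begin
      ι b                                           ≡⟨ ι-multiple (toℕ j) ⟩
      ι (toℕ j) *ᶠ ρ                                ≡⟨ cong (λ k → ι k *ᶠ ρ) (m+[n∸m]≡n (<⇒≤ i<j)) ⟨
      ι (toℕ i + (toℕ j ∸ toℕ i)) *ᶠ ρ              ≡⟨ cong (_*ᶠ ρ) (ι-+ _ _) ⟩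
      (ι (toℕ i) +ᶠ ι (toℕ j ∸ toℕ i)) *ᶠ ρ         ≡⟨ *ᶠ-distribʳ ρ _ _ ⟩
      ι (toℕ i) *ᶠ ρ +ᶠ ι (toℕ j ∸ toℕ i) *ᶠ ρ      ≡⟨ cong (_+ᶠ ι (toℕ j ∸ toℕ i) *ᶠ ρ) (ι-multiple (toℕ i)) ⟨
      ι a +ᶠ ι (toℕ j ∸ toℕ i) *ᶠ ρ                 ∎
      where open ≡-Reasoning
    small : ∀ x y → x * W / p ≡ y * W / p → x ≤ y → (y ∸ x) * W ≤ p
    small x y eq x≤y = ≤-trans (≤-reflexive (*-distribʳ-∸ W y x))
      (≤-trans (∸-monoˡ-≤ (x * W) (same-quotient (x * W) (y * W) eq)) (≤-reflexive (m+n∸m≡n (x * W) p)))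
    gap : ∃[ r ] (0 < toℕ j ∸ toℕ i × toℕ j ∸ toℕ i ≤ W × r * W ≤ p × (ι (toℕ j ∸ toℕ i) *ᶠ ρ) ≈± ι r)
    gap with ≤-total a b
    ... | inj₁ a≤b = b ∸ a , m<n⇒0<n∸m i<j , ≤-trans (m∸n≤m (toℕ j) (toℕ i)) (s≤s⁻¹ (toℕ<n j)) , small a b boxes a≤b
      , inj₁ (+ᶠ.∙-cancelˡ (ι a) _ _ (trans (sym ιb≡) (trans (cong ι (sym (m+[n∸m]≡n a≤b))) (ι-+ a (b ∸ a)))))
    ... | inj₂ b≤a = a ∸ b , m<n⇒0<n∸m i<j , ≤-trans (m∸n≤m (toℕ j) (toℕ i)) (s≤s⁻¹ (toℕ<n j)) , small b a (sym boxes) b≤a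
      , inj₂ (+ᶠ.inverseˡ-unique _ _ (+ᶠ.∙-cancelˡ (ι a) _ _ (begin
          ι a +ᶠ (ι (toℕ j ∸ toℕ i) *ᶠ ρ +ᶠ ι (a ∸ b))    ≡⟨ +ᶠ-assoc _ _ _ ⟨
          (ι a +ᶠ ι (toℕ j ∸ toℕ i) *ᶠ ρ) +ᶠ ι (a ∸ b)    ≡⟨ cong (_+ᶠ ι (a ∸ b)) ιb≡ ⟨
          ι b +ᶠ ι (a ∸ b)                                ≡⟨ ι-+ b (a ∸ b) ⟨
          ι (b + (a ∸ b))                                 ≡⟨ cong ι (m+[n∸m]≡n b≤a) ⟩
          ι a                                             ≡⟨ +ᶠ-identityʳ (ι a) ⟨
          ι a +ᶠ 0ᶠ                                       ∎)))
      where open ≡-Reasoning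

  -- Dirichlet gives j ρ = ± r. If r ≥ W², this is a link after multiplication by u; if not, ρ = ± r
  -- / j is in the list.
  ratio : ∀ ρ → ρ ∈ smallRatios ⊎ (∀ u → Linked u (ρ *ᶠ u))
  ratio ρ with dirichlet ρ
  ... | zero , r , () , _
  ... | suc j , r , _ , j≤W , rW≤p , jρ≈±r with r <? W * W
  ...   | no r≮ = inj₂ (λ u → suc j , r , j≤W , ≮⇒≥ r≮ , rW≤p , scale u jρ≈±r)
    where
    scale : ∀ u → (ι (suc j) *ᶠ ρ) ≈± ι r → (ι (suc j) *ᶠ (ρ *ᶠ u)) ≈± (ι r *ᶠ u)
    scale u (inj₁ eq) = inj₁ (trans (sym (*ᶠ-assoc _ ρ u)) (cong (_*ᶠ u) eq))
    scale u (inj₂ eq) = inj₂ (trans (sym (*ᶠ-assoc _ ρ u)) (trans (cong (_*ᶠ u) eq) (sym (-‿distribˡ-* (ι r) u))))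
  ...   | yes r< = inj₁ (member jρ≈±r)
    where
    fraction∈ : ι r *ᶠ inv (ι (suc j)) ∈ fractions
    fraction∈ = ∈-cartesianProductWith⁺ _ (∈-upTo⁺ r<) (∈-upTo⁺ j≤W)
    divide : ∀ x → ι (suc j) *ᶠ ρ ≡ x → ρ ≡ x *ᶠ inv (ι (suc j))
    divide x eq = begin
      ρ                                          ≡⟨ *ᶠ-identityʳ ρ ⟨
      ρ *ᶠ 1ᶠ                                    ≡⟨ cong (ρ *ᶠ_) (invʳ (ι≢0 (s≤s z≤n) (≤-<-trans j≤W W<p))) ⟨
      ρ *ᶠ (ι (suc j) *ᶠ inv (ι (suc j)))        ≡⟨ *ᶠ-assoc ρ _ _ ⟨
      (ρ *ᶠ ι (suc j)) *ᶠ inv (ι (suc j))        ≡⟨ cong (_*ᶠ inv (ι (suc j))) (trans (*ᶠ-comm ρ _) eq) ⟩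
      x *ᶠ inv (ι (suc j))                       ∎
      where open ≡-Reasoning
    member : (ι (suc j) *ᶠ ρ) ≈± ι r → ρ ∈ smallRatios
    member (inj₁ eq) = subst (_∈ smallRatios) (sym (divide _ eq)) (∈-++⁺ˡ fraction∈)
    member (inj₂ eq) = subst (_∈ smallRatios)
      (sym (trans (divide _ eq) (sym (-‿distribˡ-* (ι r) _)))) (∈-++⁺ʳ _ (∈-map⁺ -ᶠ_ fraction∈))

  divide-by : ∀ {u} → u ≢ 0ᶠ → ∀ x r .{{_ : NonZero r}} → let n = res (x *ᶠ inv u) in
    x ≡ ι (n % r) *ᶠ u +ᶠ ι (n / r) *ᶠ (ι r *ᶠ u)
  divide-by {u} u≢0 x r = begin
    x                                              ≡⟨ *ᶠ-inv-cancel u≢0 x ⟨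
    (x *ᶠ inv u) *ᶠ u                              ≡⟨ cong (_*ᶠ u) (ι-res (x *ᶠ inv u)) ⟨
    ι n *ᶠ u                                       ≡⟨ cong (λ k → ι k *ᶠ u) (m≡m%n+[m/n]*n n r) ⟩
    ι (n % r + n / r * r) *ᶠ u                     ≡⟨ cong (_*ᶠ u) (trans (ι-+ _ _) (cong (ι (n % r) +ᶠ_) (ι-* _ r))) ⟩
    (ι (n % r) +ᶠ ι (n / r) *ᶠ ι r) *ᶠ u           ≡⟨ *ᶠ-distribʳ u _ _ ⟩
    ι (n % r) *ᶠ u +ᶠ (ι (n / r) *ᶠ ι r) *ᶠ u      ≡⟨ cong (ι (n % r) *ᶠ u +ᶠ_) (*ᶠ-assoc _ (ι r) u) ⟩
    ι (n % r) *ᶠ u +ᶠ ι (n / r) *ᶠ (ι r *ᶠ u)      ∎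
    where
    open ≡-Reasoning
    n : ℕ
    n = res (x *ᶠ inv u)

  module Multiples (N : F → ℕ) (N-+ : ∀ u v → N (u +ᶠ v) ≤ 2 * N u + 2 * N v) (N-neg : ∀ u → N (-ᶠ u) ≡ N u) where

    -- The range extends to 2 H because it has to contain t + s for t ≤ H and s < H.
    average : F → ℕ
    average u = ∑ (upTo (suc (2 * H))) (λ s → N (ι s *ᶠ u))

    -- Write t u = (t + s) u - s u for each s < H and add up the resulting H inequalities.
    multiple≤average : ∀ {t} u → t ≤ H → H * N (ι t *ᶠ u) ≤ 4 * average u
    multiple≤average {t} u t≤H = begin
      H * N (ι t *ᶠ u)
        ≡⟨ cong (_* N (ι t *ᶠ u)) (length-upTo H) ⟨
      length (upTo H) * N (ι t *ᶠ u)
        ≡⟨ ∑-const (upTo H) _ ⟨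
      ∑ (upTo H) (λ _ → N (ι t *ᶠ u))
        ≤⟨ ∑-mono (upTo H) difference ⟩
      ∑ (upTo H) (λ s → 2 * N (ι (t + s) *ᶠ u) + 2 * N (ι s *ᶠ u))
        ≡⟨ trans (∑-+ (upTo H) _ _) (cong₂ _+_ (∑-*ˡ (upTo H) 2 _) (∑-*ˡ (upTo H) 2 _)) ⟩
      2 * ∑ (upTo H) (λ s → N (ι (t + s) *ᶠ u)) + 2 * ∑ (upTo H) (λ s → N (ι s *ᶠ u))
        ≤⟨ +-mono-≤ (*-monoʳ-≤ 2 (∑-shift t H (suc (2 * H)) (λ s → N (ι s *ᶠ u)) (m≤n⇒m≤1+n (≤-trans (+-monoˡ-≤ H t≤H) (≤-reflexive (double H))))))
                    (*-monoʳ-≤ 2 (∑-shift 0 H (suc (2 * H)) (λ s → N (ι s *ᶠ u)) (m≤n⇒m≤1+n (m≤m+n H _)))) ⟩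
      2 * average u + 2 * average u
        ≡⟨ collect (average u) ⟩
      4 * average u ∎
      where
      open ≤-Reasoning
      double : ∀ a → a + a ≡ 2 * a
      double = solve-∀
      collect : ∀ a → 2 * a + 2 * a ≡ 4 * a
      collect = solve-∀
      difference : ∀ s → N (ι t *ᶠ u) ≤ 2 * N (ι (t + s) *ᶠ u) + 2 * N (ι s *ᶠ u)
      difference s = begin
        N (ι t *ᶠ u)
          ≡⟨ cong N (𝔽.x∙a∙a⁻¹ (ι t *ᶠ u) (ι s *ᶠ u)) ⟨
        N ((ι t *ᶠ u +ᶠ ι s *ᶠ u) +ᶠ -ᶠ (ι s *ᶠ u))
          ≡⟨ cong (λ z → N (z +ᶠ -ᶠ (ι s *ᶠ u))) (trans (cong (_*ᶠ u) (ι-+ t s)) (*ᶠ-distribʳ u (ι t) (ι s))) ⟨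
        N (ι (t + s) *ᶠ u +ᶠ -ᶠ (ι s *ᶠ u))
          ≤⟨ N-+ _ _ ⟩
        2 * N (ι (t + s) *ᶠ u) + 2 * N (-ᶠ (ι s *ᶠ u))
          ≡⟨ cong (λ n → 2 * N (ι (t + s) *ᶠ u) + 2 * n) (N-neg _) ⟩
        2 * N (ι (t + s) *ᶠ u) + 2 * N (ι s *ᶠ u) ∎

    -- Division with remainder writes x as s u + t u′ with s, t ≤ H.
    linked-bound : ∀ {u u′} → u ≢ 0ᶠ → Linked u u′ → ∀ x → H * N x ≤ 8 * average u + 8 * average u′
    linked-bound {u} {u′} u≢0 (j , r , j≤W , WW≤r , rW≤p , ju′≈±ru) x = begin
      H * N x
        ≤⟨ *-monoʳ-≤ H (decompose ju′≈±ru) ⟩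
      H * (2 * N (ι s *ᶠ u) + 2 * N (ι t *ᶠ u′))
        ≡⟨ expand H (N (ι s *ᶠ u)) _ ⟩
      2 * (H * N (ι s *ᶠ u)) + 2 * (H * N (ι t *ᶠ u′))
        ≤⟨ +-mono-≤ (*-monoʳ-≤ 2 (multiple≤average u s≤H)) (*-monoʳ-≤ 2 (multiple≤average u′ t≤H)) ⟩
      2 * (4 * average u) + 2 * (4 * average u′)
        ≡⟨ collect (average u) (average u′) ⟩
      8 * average u + 8 * average u′ ∎
      where
      open ≤-Reasoning
      instance
        r≢0 : NonZero r
        r≢0 = >-nonZero (<-≤-trans (*-mono-< (>-nonZero⁻¹ W) (>-nonZero⁻¹ W)) WW≤r)
      n s q t : ℕ
      n = res (x *ᶠ inv u)
      s = n % r
      q = n / r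
      t = q * j
      s≤H : s ≤ H
      s≤H = ≤-trans (m%n≤n n r) (m*n≤o⇒m≤o/n r W rW≤p)
      t≤H : t ≤ H
      t≤H = m*n≤o⇒m≤o/n t W (begin
        q * j * W      ≤⟨ *-monoˡ-≤ W (*-monoʳ-≤ q j≤W) ⟩
        q * W * W      ≡⟨ *-assoc q W W ⟩
        q * (W * W)    ≤⟨ *-monoʳ-≤ q WW≤r ⟩
        q * r          ≤⟨ m/n*n≤m n r ⟩
        n              ≤⟨ <⇒≤ (res<p _) ⟩
        p              ∎)
      expand : ∀ h a b → h * (2 * a + 2 * b) ≡ 2 * (h * a) + 2 * (h * b)
      expand = solve-∀
      collect : ∀ a b → 2 * (4 * a) + 2 * (4 * b) ≡ 8 * a + 8 * b
      collect = solve-∀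
      x≡ : x ≡ ι s *ᶠ u +ᶠ ι q *ᶠ (ι r *ᶠ u)
      x≡ = divide-by u≢0 x r
      ιt*u′ : ι q *ᶠ (ι j *ᶠ u′) ≡ ι t *ᶠ u′
      ιt*u′ = trans (sym (*ᶠ-assoc (ι q) (ι j) u′)) (cong (_*ᶠ u′) (sym (ι-* q j)))
      decompose : (ι j *ᶠ u′) ≈± (ι r *ᶠ u) → N x ≤ 2 * N (ι s *ᶠ u) + 2 * N (ι t *ᶠ u′)
      decompose (inj₁ eq) = begin
        N x                                       ≡⟨ cong N x≡ ⟩
        N (ι s *ᶠ u +ᶠ ι q *ᶠ (ι r *ᶠ u))         ≡⟨ cong (λ z → N (ι s *ᶠ u +ᶠ z)) (trans (cong (ι q *ᶠ_) (sym eq)) ιt*u′) ⟩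
        N (ι s *ᶠ u +ᶠ ι t *ᶠ u′)                 ≤⟨ N-+ _ _ ⟩
        2 * N (ι s *ᶠ u) + 2 * N (ι t *ᶠ u′)      ∎
      decompose (inj₂ eq) = begin
        N x                                       ≡⟨ cong N x≡ ⟩
        N (ι s *ᶠ u +ᶠ ι q *ᶠ (ι r *ᶠ u))         ≤⟨ N-+ _ _ ⟩
        2 * N (ι s *ᶠ u) + 2 * N (ι q *ᶠ (ι r *ᶠ u)) ≡⟨ cong (λ m → 2 * N (ι s *ᶠ u) + 2 * m) (trans (sym (N-neg _)) (cong N negated)) ⟩
        2 * N (ι s *ᶠ u) + 2 * N (ι t *ᶠ u′)      ∎
        where
        negated : -ᶠ (ι q *ᶠ (ι r *ᶠ u)) ≡ ι t *ᶠ u′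
        negated = trans (-‿distribʳ-* (ι q) _) (trans (cong (ι q *ᶠ_) (sym eq)) ιt*u′)

-- Biorthogonal systems

Fin-⊎ : ∀ {m} {P Q : Fin m → Set} → (∀ i → P i ⊎ Q i) → (∀ i → P i) ⊎ ∃[ i ] Q i
Fin-⊎ {zero}  f = inj₁ λ ()
Fin-⊎ {suc m} f with f Fin.zero | Fin-⊎ (f ∘ Fin.suc)
... | inj₂ q | _            = inj₂ (Fin.zero , q)
... | inj₁ p | inj₂ (i , q) = inj₂ (Fin.suc i , q)
... | inj₁ p | inj₁ ps      = inj₁ λ { Fin.zero → p ; (Fin.suc i) → ps i }

lookup-≡ : ∀ {A : Set} {m} (x y : Vec A m) → (∀ i → Vec.lookup x i ≡ Vec.lookup y i) → x ≡ y
lookup-≡ x y eq = trans (sym (tabulate∘lookup x)) (trans (tabulate-cong eq) (tabulate∘lookup y))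

module Frames {p : ℕ} (K : PrimeField p) (1<p : 1 < p) (e : ℕ) where
  open LinearAlgebra K

  private
    d = suc e
    V = Vec F d
  open 𝕍 d using (x∙a⁻¹∙a; identityˡ)

  record Biorthogonal {m} (a ξ : Fin m → V) : Set where
    field
      diagonal    : ∀ i → dot (ξ i) (a i) ≡ 1ᶠ
      offDiagonal : ∀ {i j} → i ≢ j → dot (ξ i) (a j) ≡ 0ᶠ
  open Biorthogonal

  1≢0 : 1ᶠ ≢ 0ᶠ
  1≢0 eq = ι≢0 (s≤s z≤n) 1<p (trans ι-1 eq)

  flip : ∀ {m} {a ξ : Fin m → V} → Biorthogonal a ξ → Biorthogonal ξ a
  flip {a = a} {ξ} b = record
    { diagonal    = λ i → trans (dot-comm (a i) (ξ i)) (diagonal b i)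
    ; offDiagonal = λ {i} {j} i≢j → trans (dot-comm (a i) (ξ j)) (offDiagonal b (i≢j ∘ sym))
    }

  rest : ∀ {m} {a ξ : Fin (suc m) → V} → Biorthogonal a ξ → Biorthogonal (a ∘ Fin.suc) (ξ ∘ Fin.suc)
  rest b = record
    { diagonal    = λ i → diagonal b (Fin.suc i)
    ; offDiagonal = λ i≢j → offDiagonal b (λ { refl → i≢j refl })
    }

  -- Counting: if no such ξ existed, evaluation at the fewer than d vectors would be linear with
  -- trivial kernel, hence would embed p ^ d points into p ^ m.
  orthogonal-vector : ∀ {m} → m < d → (a : Fin m → V) → ∃[ ξ ] (ξ ≢ 𝟎 × ∀ i → dot ξ (a i) ≡ 0ᶠ)
  orthogonal-vector {m} m<d a
    with Any.any? (λ ξ → ¬? (ξ ≟ᵛ 𝟎) ×-dec (Vec.tabulate (λ i → dot ξ (a i)) ≟ᵛ 𝟎)) (space d)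
  ... | yes found with ξ , ξ≢𝟎 , values ← Any.satisfied found
      = ξ , ξ≢𝟎 , λ i → trans (sym (lookup∘tabulate _ i)) (trans (cong (λ v → Vec.lookup v i) values) (lookup-replicate i 0ᶠ))
  ... | no none = contradiction p^d≤p^m (<⇒≱ (^-monoʳ-< p 1<p m<d))
    where
    φ : V → Vec F m
    φ ξ = Vec.tabulate (λ i → dot ξ (a i))
    φ-injective : ∀ {ξ η} → φ ξ ≡ φ η → ξ ≡ η
    φ-injective {ξ} {η} eq with (ξ ⊕ ⊖ η) ≟ᵛ 𝟎
    ... | yes z≡𝟎 = trans (sym (x∙a⁻¹∙a ξ η)) (trans (cong (_⊕ η) z≡𝟎) (identityˡ η))
    ... | no z≢𝟎  = contradiction (lose (complete-space (ξ ⊕ ⊖ η)) (z≢𝟎 , lookup-≡ _ _ vanish)) none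
      where
      complete-space : ∀ v → v ∈ space d
      complete-space v = ∈-vectors v (λ i → elements-complete _)
      values : ∀ i → dot ξ (a i) ≡ dot η (a i)
      values i = trans (sym (lookup∘tabulate _ i)) (trans (cong (λ v → Vec.lookup v i) eq) (lookup∘tabulate _ i))
      vanish : ∀ i → Vec.lookup (φ (ξ ⊕ ⊖ η)) i ≡ Vec.lookup 𝟎 i
      vanish i = begin
        Vec.lookup (φ (ξ ⊕ ⊖ η)) i         ≡⟨ lookup∘tabulate _ i ⟩
        dot (ξ ⊕ ⊖ η) (a i)                ≡⟨ dot-⊕ˡ ξ (⊖ η) (a i) ⟩
        dot ξ (a i) +ᶠ dot (⊖ η) (a i)     ≡⟨ cong₂ _+ᶠ_ (values i) (dot-⊖ˡ η (a i)) ⟩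
        dot η (a i) +ᶠ -ᶠ dot η (a i)      ≡⟨ -ᶠ-inverseʳ _ ⟩
        0ᶠ                                 ≡⟨ lookup-replicate i 0ᶠ ⟨
        Vec.lookup 𝟎 i                     ∎
        where open ≡-Reasoning
    p^d≤p^m : p ^ d ≤ p ^ m
    p^d≤p^m = begin
      p ^ d                         ≡⟨ length-space d ⟨
      length (space d)              ≡⟨ length-map φ (space d) ⟨
      length (map φ (space d))      ≤⟨ 𝕍.length-⊆-all m (Unique-map⁺ φ-injective (vectors-unique elements-unique d)) ⟩
      length (space m)              ≡⟨ length-space m ⟩
      p ^ m                         ∎
      where open ≤-Reasoning

  extendᵃ : ∀ {m} → V → (Fin m → V) → Fin (suc m) → V
  extendᵃ x a Fin.zero    = x
  extendᵃ x a (Fin.suc i) = a i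

  -- A dual Gram-Schmidt step: η is scaled to take the value 1 at x, and multiples of it are
  -- subtracted from the old functionals to make them vanish at x. Since η vanishes on the old
  -- vectors, the old pairings survive.
  extend : ∀ {m} {a ξ : Fin m → V} → Biorthogonal a ξ → ∀ η x → (∀ i → dot η (a i) ≡ 0ᶠ) → dot η x ≢ 0ᶠ →
           ∃[ ξ′ ] Biorthogonal (extendᵃ x a) ξ′
  extend {m} {a} {ξ} b η x η⊥a ηx≢0 = ξ′ , record { diagonal = diag ; offDiagonal = off _ _ }
    where
    η′ : V
    η′ = inv (dot η x) • η
    η′x : dot η′ x ≡ 1ᶠ
    η′x = trans (dot-•ˡ _ η x) (trans (*ᶠ-comm _ _) (invʳ ηx≢0))
    η′a : ∀ i → dot η′ (a i) ≡ 0ᶠ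
    η′a i = trans (dot-•ˡ _ η (a i)) (trans (cong (inv (dot η x) *ᶠ_) (η⊥a i)) (*ᶠ-zeroʳ _))
    ξ′ : Fin (suc m) → V
    ξ′ = extendᵃ η′ (λ i → ξ i ⊕ ⊖ (dot (ξ i) x • η′))
    dot-ξ′ : ∀ i y → dot (ξ′ (Fin.suc i)) y ≡ dot (ξ i) y +ᶠ -ᶠ (dot (ξ i) x *ᶠ dot η′ y)
    dot-ξ′ i y = trans (dot-⊕ˡ (ξ i) (⊖ (dot (ξ i) x • η′)) y) (cong (dot (ξ i) y +ᶠ_)
      (trans (dot-⊖ˡ (dot (ξ i) x • η′) y) (cong -ᶠ_ (dot-•ˡ (dot (ξ i) x) η′ y))))
    dot-ξ′-a : ∀ i j → dot (ξ′ (Fin.suc i)) (a j) ≡ dot (ξ i) (a j)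
    dot-ξ′-a i j = begin
      dot (ξ′ (Fin.suc i)) (a j)                                  ≡⟨ dot-ξ′ i (a j) ⟩
      dot (ξ i) (a j) +ᶠ -ᶠ (dot (ξ i) x *ᶠ dot η′ (a j))         ≡⟨ cong (λ z → dot (ξ i) (a j) +ᶠ -ᶠ (dot (ξ i) x *ᶠ z)) (η′a j) ⟩
      dot (ξ i) (a j) +ᶠ -ᶠ (dot (ξ i) x *ᶠ 0ᶠ)                   ≡⟨ cong (λ z → dot (ξ i) (a j) +ᶠ -ᶠ z) (*ᶠ-zeroʳ _) ⟩
      dot (ξ i) (a j) +ᶠ -ᶠ 0ᶠ                                    ≡⟨ cong (dot (ξ i) (a j) +ᶠ_) +ᶠ.ε⁻¹≈ε ⟩
      dot (ξ i) (a j) +ᶠ 0ᶠ                                       ≡⟨ +ᶠ-identityʳ _ ⟩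
      dot (ξ i) (a j)                                             ∎
      where open ≡-Reasoning
    diag : ∀ i → dot (ξ′ i) (extendᵃ x a i) ≡ 1ᶠ
    diag Fin.zero    = η′x
    diag (Fin.suc i) = trans (dot-ξ′-a i i) (diagonal b i)
    off : ∀ i j → i ≢ j → dot (ξ′ i) (extendᵃ x a j) ≡ 0ᶠ
    off Fin.zero    Fin.zero    i≢j = contradiction refl i≢j
    off Fin.zero    (Fin.suc j) i≢j = η′a j
    off (Fin.suc i) Fin.zero    i≢j = begin
      dot (ξ′ (Fin.suc i)) x                            ≡⟨ dot-ξ′ i x ⟩
      dot (ξ i) x +ᶠ -ᶠ (dot (ξ i) x *ᶠ dot η′ x)       ≡⟨ cong (λ z → dot (ξ i) x +ᶠ -ᶠ (dot (ξ i) x *ᶠ z)) η′x ⟩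
      dot (ξ i) x +ᶠ -ᶠ (dot (ξ i) x *ᶠ 1ᶠ)             ≡⟨ cong (λ z → dot (ξ i) x +ᶠ -ᶠ z) (*ᶠ-identityʳ _) ⟩
      dot (ξ i) x +ᶠ -ᶠ dot (ξ i) x                     ≡⟨ -ᶠ-inverseʳ _ ⟩
      0ᶠ                                                ∎
      where open ≡-Reasoning
    off (Fin.suc i) (Fin.suc j) i≢j = trans (dot-ξ′-a i j) (offDiagonal b (i≢j ∘ cong Fin.suc))

  -- General position of D, in a form that passes to differences with a fixed point and suffices for
  -- building frames inside D.
  Spread : ℕ → (V → Set) → Set
  Spread C D = ∀ (hs : List (V × F)) → length hs ≤ C → All (λ h → proj₁ h ≢ 𝟎) hs →
               ∃[ x ] (D x × All (λ h → dot (proj₁ h) x ≢ proj₂ h) hs)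

  -- Each new vector has to avoid just one hyperplane, the kernel of a functional that annihilates
  -- all earlier vectors.
  biorthogonal-system : ∀ {C D} → 1 ≤ C → Spread C D → ∀ m → m ≤ d →
    ∃[ a ] ∃[ ξ ] ((∀ i → D (a i)) × Biorthogonal {m} a ξ)
  biorthogonal-system 1≤C spread zero    _ = (λ ()) , (λ ()) , (λ ()) , record { diagonal = λ () ; offDiagonal = λ {} }
  biorthogonal-system 1≤C spread (suc m) m<d
    with a , ξ , Da , b ← biorthogonal-system 1≤C spread m (<⇒≤ m<d)
    with η , η≢𝟎 , η⊥a ← orthogonal-vector m<d a
    with x , Dx , ηx≢0 ∷ [] ← spread ((η , 0ᶠ) ∷ []) 1≤C (η≢𝟎 ∷ [])
    with ξ′ , b′ ← extend b η x η⊥a ηx≢0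
    = extendᵃ x a , ξ′ , (λ { Fin.zero → Dx ; (Fin.suc i) → Da i }) , b′

  comb : ∀ {m} → Vec F m → (Fin m → V) → V
  comb []      f = 𝟎
  comb (t ∷ v) f = t • f Fin.zero ⊕ comb v (f ∘ Fin.suc)

  dot-comb-0 : ∀ {m} η (v : Vec F m) f → (∀ i → dot η (f i) ≡ 0ᶠ) → dot η (comb v f) ≡ 0ᶠ
  dot-comb-0 η []      f _   = dot-𝟎ʳ η
  dot-comb-0 η (t ∷ v) f η⊥f = begin
    dot η (t • f Fin.zero ⊕ comb v (f ∘ Fin.suc))      ≡⟨ dot-⊕ʳ η _ _ ⟩
    dot η (t • f Fin.zero) +ᶠ dot η (comb v (f ∘ Fin.suc))
      ≡⟨ cong₂ _+ᶠ_ (trans (dot-•ʳ η t _) (trans (cong (t *ᶠ_) (η⊥f Fin.zero)) (*ᶠ-zeroʳ t))) (dot-comb-0 η v _ (η⊥f ∘ Fin.suc)) ⟩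
    0ᶠ +ᶠ 0ᶠ                                           ≡⟨ +ᶠ-identityʳ 0ᶠ ⟩
    0ᶠ                                                 ∎
    where open ≡-Reasoning

  dot-comb : ∀ {m} {a ξ : Fin m → V} → Biorthogonal a ξ → ∀ v i → dot (ξ i) (comb v a) ≡ Vec.lookup v i
  dot-comb {a = a} {ξ} b (t ∷ v) Fin.zero = begin
    dot (ξ Fin.zero) (t • a Fin.zero ⊕ comb v (a ∘ Fin.suc))      ≡⟨ dot-⊕ʳ (ξ Fin.zero) _ _ ⟩
    dot (ξ Fin.zero) (t • a Fin.zero) +ᶠ dot (ξ Fin.zero) (comb v (a ∘ Fin.suc))
      ≡⟨ cong₂ _+ᶠ_ (trans (dot-•ʳ (ξ Fin.zero) t _) (trans (cong (t *ᶠ_) (diagonal b Fin.zero)) (*ᶠ-identityʳ t)))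
                    (dot-comb-0 (ξ Fin.zero) v _ (λ i → offDiagonal b λ ())) ⟩
    t +ᶠ 0ᶠ                                                       ≡⟨ +ᶠ-identityʳ t ⟩
    t                                                             ∎
    where open ≡-Reasoning
  dot-comb {a = a} {ξ} b (t ∷ v) (Fin.suc i) = begin
    dot (ξ (Fin.suc i)) (t • a Fin.zero ⊕ comb v (a ∘ Fin.suc))   ≡⟨ dot-⊕ʳ (ξ (Fin.suc i)) _ _ ⟩
    dot (ξ (Fin.suc i)) (t • a Fin.zero) +ᶠ dot (ξ (Fin.suc i)) (comb v (a ∘ Fin.suc))
      ≡⟨ cong₂ _+ᶠ_ (trans (dot-•ʳ (ξ (Fin.suc i)) t _) (trans (cong (t *ᶠ_) (offDiagonal b λ ())) (*ᶠ-zeroʳ t)))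
                    (dot-comb (rest b) v i) ⟩
    0ᶠ +ᶠ Vec.lookup v i                                          ≡⟨ +ᶠ-identityˡ _ ⟩
    Vec.lookup v i                                                ∎
    where open ≡-Reasoning

  comb-injective : ∀ {m} {a ξ : Fin m → V} → Biorthogonal a ξ → ∀ {v w} → comb v a ≡ comb w a → v ≡ w
  comb-injective {ξ = ξ} b {v} {w} eq = lookup-≡ v w (λ i →
    trans (sym (dot-comb b v i)) (trans (cong (dot (ξ i)) eq) (dot-comb b w i)))

  -- With d vectors the combination map is injective on a finite space, hence onto; pairing with the
  -- `a i` then reads off the coefficients.
  coordinates : ∀ {a ξ : Fin d → V} → Biorthogonal a ξ → ∀ η → η ≡ comb (Vec.tabulate (λ i → dot η (a i))) ξ
  coordinates {a} {ξ} b η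
    with v , refl ← 𝕍.injective⇒surjective d (λ v → comb v ξ) (comb-injective (flip b)) η
    = cong (λ v → comb v ξ) (lookup-≡ v (Vec.tabulate values) (λ i → sym (trans (lookup∘tabulate values i)
        (trans (dot-comm (comb v ξ) (a i)) (dot-comb (flip b) v i)))))
    where
    values : Fin d → F
    values i = dot (comb v ξ) (a i)

  module _ (W : ℕ) .{{_ : NonZero W}} (W<p : W < p) where
    open Approximation K W W<p

    combs : (Fin d → V) → List V
    combs ξ = map (λ v → comb v ξ) (vectors smallRatios d)

    nonzero? : (η : V) → Dec (η ≢ 𝟎)
    nonzero? η = ¬? (η ≟ᵛ 𝟎)

    badHyperplanes : (Fin d → V) → List (V × F)
    badHyperplanes ξ = cartesianProduct (filter nonzero? (combs ξ)) smallRatios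

    length-badHyperplanes : ∀ ξ → length (badHyperplanes ξ) ≤ (2 * (W * W * W)) ^ suc d
    length-badHyperplanes ξ = begin
      length (badHyperplanes ξ)
        ≡⟨ length-cartesianProductWith _,_ (filter nonzero? (combs ξ)) smallRatios ⟩
      length (filter nonzero? (combs ξ)) * length smallRatios
        ≤⟨ *-monoˡ-≤ (length smallRatios) (length-filter nonzero? (combs ξ)) ⟩
      length (combs ξ) * length smallRatios
        ≡⟨ cong (_* length smallRatios) (trans (length-map _ (vectors smallRatios d)) (length-vectors smallRatios d)) ⟩
      length smallRatios ^ d * length smallRatios
        ≡⟨ *-comm (length smallRatios ^ d) _ ⟩
      length smallRatios ^ suc d
        ≡⟨ cong (_^ suc d) length-smallRatios ⟩
      (2 * (W * W * W)) ^ suc d ∎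
      where
      open ≤-Reasoning

    -- Among d + 1 well chosen vectors every nonzero functional sees two linked values:
    -- the functionals all of whose coordinates are small ratios are finitely many, and
    -- the extra vector avoids the bad hyperplanes that they define.
    frame : ∀ {D} → Spread (suc ((2 * (W * W * W)) ^ suc d)) D →
      ∃[ a ] ∃[ ξ ] ∃[ x ] ((∀ i → D (a i)) × D x × Biorthogonal {d} a ξ ×
        (∀ η → η ≢ 𝟎 → ∃[ i ] ∃[ j ] (dot η (extendᵃ x a i) ≢ 0ᶠ × Linked (dot η (extendᵃ x a i)) (dot η (extendᵃ x a j)))))
    frame {D} spread
      with a , ξ , Da , b ← biorthogonal-system (s≤s z≤n) spread d ≤-refl
      with x , Dx , avoid ← spread (badHyperplanes ξ) (m≤n⇒m≤1+n (length-badHyperplanes ξ))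
             (cartesianProduct⁺ (setoid V) (setoid F) _ _ (λ {η} η∈ _ → All.lookup (all-filter nonzero? (combs ξ)) η∈))
      = a , ξ , x , Da , Dx , b , linked
      where
      linked : ∀ η → η ≢ 𝟎 → ∃[ i ] ∃[ j ] (dot η (extendᵃ x a i) ≢ 0ᶠ × Linked (dot η (extendᵃ x a i)) (dot η (extendᵃ x a j)))
      linked η η≢𝟎 with any? (λ i → ¬? (dot η (a i) ≟ᶠ 0ᶠ))
      ... | no none = contradiction η≡𝟎 η≢𝟎
        where
        values : ∀ i → dot η (a i) ≡ dot 𝟎 (a i)
        values i with dot η (a i) ≟ᶠ 0ᶠ
        ... | yes eq = trans eq (sym (dot-𝟎ˡ (a i)))
        ... | no neq = contradiction (i , neq) none
        η≡𝟎 : η ≡ 𝟎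
        η≡𝟎 = trans (coordinates b η) (trans (cong (λ v → comb v ξ) (tabulate-cong values)) (sym (coordinates b 𝟎)))
      ... | yes (l , u≢0) = finish (Fin-⊎ (λ i → ratio (dot η′ (a i))))
        where
        u : F
        u = dot η (a l)
        η′ : V
        -- Dividing by `u` turns the values of η into ratios to `u`, which is what `ratio`
        -- classifies.
        η′ = inv u • η
        rescale : ∀ y → dot η′ y *ᶠ u ≡ dot η y
        rescale y = trans (cong (_*ᶠ u) (trans (dot-•ˡ (inv u) η y) (*ᶠ-comm _ _))) (*ᶠ-inv-cancel u≢0 (dot η y))
        η′≢𝟎 : η′ ≢ 𝟎
        η′≢𝟎 η′≡𝟎 = u≢0 (trans (sym (rescale (a l))) (trans (cong (_*ᶠ u)
          (trans (cong (λ z → dot z (a l)) η′≡𝟎) (dot-𝟎ˡ (a l)))) (*ᶠ-zeroˡ u)))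
        finish : (∀ i → dot η′ (a i) ∈ smallRatios) ⊎ ∃[ i ] (∀ u → Linked u (dot η′ (a i) *ᶠ u)) →
                 ∃[ i ] ∃[ j ] (dot η (extendᵃ x a i) ≢ 0ᶠ × Linked (dot η (extendᵃ x a i)) (dot η (extendᵃ x a j)))
        finish (inj₂ (i , link)) = Fin.suc l , Fin.suc i , u≢0 , subst (Linked u) (rescale (a i)) (link u)
        -- All coordinates of `η′` are small ratios, so `η′` is one of the listed combinations and
        -- `x` was chosen off its bad hyperplanes.
        finish (inj₁ small) with ratio (dot η′ x)
        ... | inj₂ link = Fin.suc l , Fin.zero , u≢0 , subst (Linked u) (rescale x) (link u)
        ... | inj₁ x∈   = contradiction refl (All.lookup avoid (∈-cartesianProduct⁺
              (∈-filter⁺ nonzero? (subst (_∈ combs ξ) (sym (coordinates b η′))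
                (∈-map⁺ (λ v → comb v ξ) (∈-vectors (Vec.tabulate (λ i → dot η′ (a i)))
                  (λ i → subst (_∈ smallRatios) (sym (lookup∘tabulate (λ i → dot η′ (a i)) i)) (small i))))) η′≢𝟎)
              x∈))

-- Growth of sets under translations

∑-allFin-suc : ∀ m (f : Fin (suc m) → ℕ) → ∑ (allFin (suc m)) f ≡ f Fin.zero + ∑ (allFin m) (f ∘ Fin.suc)
∑-allFin-suc m f = cong (f Fin.zero +_) (trans (cong (λ xs → ∑ xs f) (sym (map-tabulate (λ i → i) Fin.suc)))
  (∑-map Fin.suc (allFin m) f))

∑-max : ∀ {A : Set} (xs : List A) (f : A → ℕ) (x₀ : A) → ∃[ x ] ∑ xs f ≤ length xs * f x
∑-max []       f x₀ = x₀ , z≤n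
∑-max (x ∷ xs) f x₀ with y , ≤y ← ∑-max xs f x₀ with ≤-total (f x) (f y)
... | inj₁ fx≤fy = y , +-mono-≤ fx≤fy ≤y
... | inj₂ fy≤fx = x , +-monoʳ-≤ (f x) (≤-trans ≤y (*-monoʳ-≤ (length xs) fy≤fx))

∈-vectors⁻ : ∀ {A : Set} (xs : List A) {d} {v : Vec A d} → v ∈ vectors xs d → ∀ i → Vec.lookup v i ∈ xs
∈-vectors⁻ xs {suc d} v∈ i with a , w , a∈ , w∈ , refl ← ∈-cartesianProductWith⁻ _∷_ xs (vectors xs d) v∈ with i
... | Fin.zero  = a∈
... | Fin.suc j = ∈-vectors⁻ xs w∈ j

module Growth {p : ℕ} (K : PrimeField p) (1<p : 1 < p) (e : ℕ) where
  open LinearAlgebra K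
  open Frames K 1<p e
  open Variation K

  private
    d = suc e
    V = Vec F d
  open 𝕍 d using (card; leave; leave-ε; leave-∙; spread)

  ι-suc-• : ∀ s (x : V) → ι (suc s) • x ≡ x ⊕ ι s • x
  ι-suc-• s = pointwise
    where
    scalar : ∀ y → ι (suc s) *ᶠ y ≡ y +ᶠ ι s *ᶠ y
    scalar y = trans (cong (_*ᶠ y) (trans (ι-+ 1 s) (cong (_+ᶠ ι s) ι-1)))
      (trans (*ᶠ-distribʳ y 1ᶠ (ι s)) (cong (_+ᶠ ι s *ᶠ y) (*ᶠ-identityˡ y)))
    pointwise : ∀ {d} (x : Vec F d) → ι (suc s) • x ≡ x ⊕ ι s • x
    pointwise []      = refl
    pointwise (y ∷ x) = cong₂ _∷_ (scalar y) (pointwise x)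

  ι-0-• : ∀ {d} (x : Vec F d) → ι 0 • x ≡ 𝟎
  ι-0-• []      = refl
  ι-0-• (y ∷ x) = cong₂ _∷_ (trans (cong (_*ᶠ y) ι-0) (*ᶠ-zeroˡ y)) (ι-0-• x)

  module _ (Y : V → Bool) where

    leave-multiple : ∀ s x → leave Y (ι s • x) ≤ s * leave Y x
    leave-multiple zero    x = ≤-reflexive (trans (cong (leave Y) (ι-0-• x)) (leave-ε Y))
    leave-multiple (suc s) x = begin
      leave Y (ι (suc s) • x)              ≡⟨ cong (leave Y) (ι-suc-• s x) ⟩
      leave Y (x ⊕ ι s • x)                ≤⟨ leave-∙ Y x (ι s • x) ⟩
      leave Y x + leave Y (ι s • x)        ≤⟨ +-monoʳ-≤ (leave Y x) (leave-multiple s x) ⟩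
      leave Y x + s * leave Y x            ∎
      where open ≤-Reasoning

    total : ∀ {m} → (Fin m → V) → ℕ
    total {m} b = ∑ (allFin m) (leave Y ∘ b)

    leave-comb : ∀ k {m} (v : Vec F m) f → (∀ i → Vec.lookup v i ∈ applyUpTo ι k) → leave Y (comb v f) ≤ k * total f
    leave-comb k []      f _  = ≤-trans (≤-reflexive (leave-ε Y)) z≤n
    leave-comb k {suc m} (t ∷ v) f v∈ with s , s<k , refl ← ∈-applyUpTo⁻ ι (v∈ Fin.zero) = begin
      leave Y (ι s • f Fin.zero ⊕ comb v (f ∘ Fin.suc))
        ≤⟨ leave-∙ Y _ _ ⟩
      leave Y (ι s • f Fin.zero) + leave Y (comb v (f ∘ Fin.suc))
        ≤⟨ +-mono-≤ (≤-trans (leave-multiple s (f Fin.zero)) (*-monoˡ-≤ _ (<⇒≤ s<k))) (leave-comb k v _ (v∈ ∘ Fin.suc)) ⟩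
      k * leave Y (f Fin.zero) + k * total (f ∘ Fin.suc)
        ≡⟨ *-distribˡ-+ k _ _ ⟨
      k * (leave Y (f Fin.zero) + total (f ∘ Fin.suc))
        ≡⟨ cong (k *_) (∑-allFin-suc m (leave Y ∘ f)) ⟨
      k * total f ∎
      where open ≤-Reasoning

    -- The combinations with coefficients below k are k ^ d distinct directions by biorthogonality,
    -- and subadditivity bounds `leave` on all of them, so `spread` applies.
    small-growth : ∀ {a ξ : Fin d → V} → Biorthogonal a ξ → ∀ k → k ≤ p → 2 * card Y ≤ k ^ d → card Y ≤ 2 * (k * total a)
    small-growth {a} b k k≤p 2Y≤ = spread Y box (k * total a) box-unique (≤-trans 2Y≤ (≤-reflexive (sym length-box))) leave-box
      where
      box : List V
      box = map (λ v → comb v a) (vectors (applyUpTo ι k) d)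
      box-unique : Unique box
      box-unique = Unique-map⁺ (comb-injective b)
        (vectors-unique (applyUpTo⁺₁ ι k (λ i<j j<k → ι-injective-< i<j (<-≤-trans j<k k≤p))) d)
      length-box : length box ≡ k ^ d
      length-box = trans (length-map _ (vectors (applyUpTo ι k) d))
        (trans (length-vectors (applyUpTo ι k) d) (cong (_^ d) (length-applyUpTo ι k)))
      leave-box : ∀ {z} → z ∈ box → leave Y z ≤ k * total a
      leave-box z∈ with v , v∈ , refl ← ∈-map⁻ (λ v → comb v a) z∈ = leave-comb k v a (∈-vectors⁻ (applyUpTo ι k) v∈)

    module _ (W : ℕ) .{{_ : NonZero W}} (W<p : W < p) where
      open Approximation K W W<p
      open Radon e Y

      module _ {m} (b : Fin m → V)
        (linked : ∀ η → η ≢ 𝟎 → ∃[ i ] ∃[ j ] (dot η (b i) ≢ 0ᶠ × Linked (dot η (b i)) (dot η (b j)))) where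

        steps : List ℕ
        steps = upTo (suc (2 * H))

        N-bound : ∀ a ξ → H * variation (profile ξ) (dot ξ a) ≤
          16 * ∑ (allFin m) (λ i → ∑ steps (λ s → variation (profile ξ) (dot ξ (ι s • b i))))
        N-bound a ξ with ξ ≟ᵛ 𝟎
        -- The zero functional has no linked values, but it sees `a` as 0, and translation by 0 has
        -- no variation.
        ... | yes refl = ≤-trans (≤-reflexive (trans (cong (H *_) N≡0) (*-zeroʳ H))) z≤n
          where
          N≡0 : variation (profile 𝟎) (dot 𝟎 a) ≡ 0
          N≡0 = trans (∑-cong elements (λ c → trans
            (cong (λ z → sq ∣ profile 𝟎 c - profile 𝟎 z ∣) (trans (cong (c +ᶠ_) (dot-𝟎ˡ a)) (+ᶠ-identityʳ c)))
            (cong sq (∣n-n∣≡0 (profile 𝟎 c))))) (∑-0 elements)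
        ... | no ξ≢𝟎 = via-linked (linked ξ ξ≢𝟎)
          where
          open ≤-Reasoning
          N : F → ℕ
          N = variation (profile ξ)
          open Multiples N (variation-+ (profile ξ)) (variation-neg (profile ξ))
          collect : ∀ a → 8 * a + 8 * a ≡ 16 * a
          collect = solve-∀
          via-linked : ∃[ i ] ∃[ j ] (dot ξ (b i) ≢ 0ᶠ × Linked (dot ξ (b i)) (dot ξ (b j))) →
            H * N (dot ξ a) ≤ 16 * ∑ (allFin m) (λ i → ∑ steps (λ s → N (dot ξ (ι s • b i))))
          via-linked (i , j , u≢0 , link) = begin
            H * N (dot ξ a)
              ≤⟨ linked-bound u≢0 link (dot ξ a) ⟩
            8 * average (dot ξ (b i)) + 8 * average (dot ξ (b j))
              ≤⟨ +-mono-≤ (*-monoʳ-≤ 8 (∑-∈≤ (λ i → average (dot ξ (b i))) (∈-allFin i)))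
                          (*-monoʳ-≤ 8 (∑-∈≤ (λ i → average (dot ξ (b i))) (∈-allFin j))) ⟩
            8 * ∑ (allFin m) (λ i → average (dot ξ (b i))) + 8 * ∑ (allFin m) (λ i → average (dot ξ (b i)))
              ≡⟨ collect (∑ (allFin m) (λ i → average (dot ξ (b i)))) ⟩
            16 * ∑ (allFin m) (λ i → average (dot ξ (b i)))
              ≡⟨ cong (16 *_) (∑-cong (allFin m) (λ i → ∑-cong steps (λ s → cong N (dot-•ʳ ξ (ι s) (b i))))) ⟨
            16 * ∑ (allFin m) (λ i → ∑ steps (λ s → N (dot ξ (ι s • b i)))) ∎

        -- Summing `N-bound` over ξ and inverting the Radon transform on both sides compares `leave`
        -- at a with `leave` at the multiples s b i, s ≤ 2 H; each of these is at most 2 H times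
        -- `leave` at b i. One factor H cancels, so the loss is of order p / W instead of p.
        leave-bound : ∀ a → leave Y a ≤ 32 * suc (2 * H) * total b
        leave-bound a = *-cancelˡ-≤ (2 * D) {{>-nonZero 2D>0}} (*-cancelˡ-≤ H {{>-nonZero H>0}} (begin
          H * (2 * D * leave Y a)
            ≡⟨ cong (H *_) (∑-variation a) ⟨
          H * ∑ (space d) (λ ξ → variation (profile ξ) (dot ξ a))
            ≡⟨ ∑-*ˡ (space d) H _ ⟨
          ∑ (space d) (λ ξ → H * variation (profile ξ) (dot ξ a))
            ≤⟨ ∑-mono (space d) (N-bound a) ⟩
          ∑ (space d) (λ ξ → 16 * ∑ (allFin m) (λ i → ∑ steps (λ s → variation (profile ξ) (dot ξ (ι s • b i)))))
            ≡⟨ ∑-*ˡ (space d) 16 _ ⟩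
          16 * ∑ (space d) (λ ξ → ∑ (allFin m) (λ i → ∑ steps (λ s → variation (profile ξ) (dot ξ (ι s • b i)))))
            ≡⟨ cong (16 *_) (trans (∑-swap (space d) (allFin m) _) (∑-cong (allFin m) (λ i → ∑-swap (space d) steps _))) ⟩
          16 * ∑ (allFin m) (λ i → ∑ steps (λ s → ∑ (space d) (λ ξ → variation (profile ξ) (dot ξ (ι s • b i)))))
            ≡⟨ cong (16 *_) (∑-cong (allFin m) (λ i → ∑-cong steps (λ s → ∑-variation (ι s • b i)))) ⟩
          16 * ∑ (allFin m) (λ i → ∑ steps (λ s → 2 * D * leave Y (ι s • b i)))
            ≤⟨ *-monoʳ-≤ 16 (∑-mono (allFin m) (λ i → per-vector (b i))) ⟩
          16 * ∑ (allFin m) (λ i → suc (2 * H) * (2 * D * (2 * H)) * leave Y (b i))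
            ≡⟨ cong (16 *_) (∑-*ˡ (allFin m) (suc (2 * H) * (2 * D * (2 * H))) (leave Y ∘ b)) ⟩
          16 * (suc (2 * H) * (2 * D * (2 * H)) * total b)
            ≡⟨ regroup H D (suc (2 * H)) (total b) ⟩
          H * (2 * D * (32 * suc (2 * H) * total b)) ∎))
          where
          open ≤-Reasoning
          2D>0 : 0 < 2 * D
          2D>0 = *-mono-< {0} {2} {0} (s≤s z≤n) (*-mono-< {0} {p ∸ 1} {0} (m<n⇒0<n∸m 1<p) (m^n>0 p {{>-nonZero (<-trans (s≤s z≤n) 1<p)}} e))
          regroup : ∀ h D k t → 16 * (k * (2 * D * (2 * h)) * t) ≡ h * (2 * D * (32 * k * t))
          regroup = solve-∀
          reorder : ∀ D h l → 2 * D * (2 * h * l) ≡ 2 * D * (2 * h) * l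
          reorder = solve-∀
          per-vector : ∀ x → ∑ steps (λ s → 2 * D * leave Y (ι s • x)) ≤ suc (2 * H) * (2 * D * (2 * H)) * leave Y x
          per-vector x = begin
            ∑ steps (λ s → 2 * D * leave Y (ι s • x))
              ≤⟨ ∑-mono-∈ steps (λ {s} s∈ → *-monoʳ-≤ (2 * D) (≤-trans (leave-multiple s x) (*-monoˡ-≤ (leave Y x) (s≤s⁻¹ (∈-upTo⁻ s∈))))) ⟩
            ∑ steps (λ _ → 2 * D * (2 * H * leave Y x))
              ≡⟨ ∑-const steps _ ⟩
            length steps * (2 * D * (2 * H * leave Y x))
              ≡⟨ cong₂ _*_ (length-upTo (suc (2 * H))) (reorder D H (leave Y x)) ⟩
            suc (2 * H) * (2 * D * (2 * H) * leave Y x)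
              ≡⟨ *-assoc (suc (2 * H)) (2 * D * (2 * H)) (leave Y x) ⟨
            suc (2 * H) * (2 * D * (2 * H)) * leave Y x ∎

        large-growth : 2 * card Y ≤ p ^ d → card Y ≤ 2 * (32 * suc (2 * H) * total b)
        large-growth 2Y≤ = spread Y (space d) _ (vectors-unique elements-unique d)
          (≤-trans 2Y≤ (≤-reflexive (sym (length-space d)))) (λ {z} _ → leave-bound z)

      -- Small sets grow along boxes spanned by a basis contained in D, large sets by
      -- the comparison with line averages in leave-bound.
      data Regime : ℕ → Set where
        sparse : ∀ k → k ≤ p → 2 * card Y ≤ k ^ d → Regime (2 * k * suc d)
        dense  : 2 * card Y ≤ p ^ d → Regime (64 * suc (2 * H) * suc d)

      growth : ∀ {D} → Spread (suc ((2 * (W * W * W)) ^ suc d)) D → ∀ {Q} → Regime Q →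
               ∃[ x ] (D x × card Y ≤ Q * leave Y x)
      growth {D} spreadD {Q} regime =
        let a , ξ , x , Da , Dx , b , linked = frame W W<p spreadD
            i , total≤                       = ∑-max (allFin (suc d)) (leave Y ∘ extendᵃ x a) Fin.zero
        in extendᵃ x a i , member a x Da Dx i , bound a ξ x b linked i total≤ regime
        where
        open ≤-Reasoning
        member : ∀ a x → (∀ i → D (a i)) → D x → ∀ i → D (extendᵃ x a i)
        member a x Da Dx Fin.zero    = Dx
        member a x Da Dx (Fin.suc i) = Da i
        module _ (a ξ : Fin d → V) (x : V) (b : Biorthogonal a ξ)
          (linked : ∀ η → η ≢ 𝟎 → ∃[ i ] ∃[ j ] (dot η (extendᵃ x a i) ≢ 0ᶠ × Linked (dot η (extendᵃ x a i)) (dot η (extendᵃ x a j))))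
          (i : Fin (suc d)) (total≤ : ∑ (allFin (suc d)) (leave Y ∘ extendᵃ x a) ≤ length (allFin (suc d)) * leave Y (extendᵃ x a i)) where
          T M : ℕ
          T = total (extendᵃ x a)
          M = leave Y (extendᵃ x a i)
          T≤ : T ≤ suc d * M
          T≤ = ≤-trans total≤ (≤-reflexive (cong (_* M) (length-tabulate {n = suc d} (λ i → i))))
          total-a≤ : total a ≤ T
          total-a≤ = ≤-trans (m≤n+m _ (leave Y x)) (≤-reflexive (sym (∑-allFin-suc d (leave Y ∘ extendᵃ x a))))
          bound : ∀ {Q} → Regime Q → card Y ≤ Q * M
          bound (sparse k k≤p 2Y≤) = begin
            card Y                       ≤⟨ small-growth b k k≤p 2Y≤ ⟩
            2 * (k * total a)            ≤⟨ *-monoʳ-≤ 2 (*-monoʳ-≤ k (≤-trans total-a≤ T≤)) ⟩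
            2 * (k * (suc d * M))        ≡⟨ reassoc k (suc d) M ⟩
            2 * k * suc d * M            ∎
            where
            reassoc : ∀ k c m → 2 * (k * (c * m)) ≡ 2 * k * c * m
            reassoc = solve-∀
          bound (dense 2Y≤) = begin
            card Y                                       ≤⟨ large-growth (extendᵃ x a) linked 2Y≤ ⟩
            2 * (32 * suc (2 * H) * T)                   ≤⟨ *-monoʳ-≤ 2 (*-monoʳ-≤ (32 * suc (2 * H)) T≤) ⟩
            2 * (32 * suc (2 * H) * (suc d * M))         ≡⟨ reassoc (suc (2 * H)) (suc d) M ⟩
            64 * suc (2 * H) * suc d * M                 ∎
            where
            reassoc : ∀ k c m → 2 * (32 * k * (c * m)) ≡ 64 * k * c * m
            reassoc = solve-∀

-- Greedy choice of pairs

module Process {p : ℕ} (K : PrimeField p) (1<p : 1 < p) (e : ℕ) where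
  open LinearAlgebra K
  open Frames K 1<p e
  open Growth K 1<p e

  private
    d = suc e
    V = Vec F d
  open 𝕍 d

  flat : List (V × V) → List V
  flat []             = []
  flat ((x , y) ∷ ps) = x ∷ y ∷ flat ps

  -- Membership is tested by subtracting either term of the first pair, so that adding a pair is
  -- literally a union of two translates.
  Sums : List (V × V) → V → Bool
  Sums []             v = ⌊ 𝟎 ≟ᵛ v ⌋
  Sums ((x , y) ∷ ps) v = Sums ps (v ⊕ ⊖ x) ∨ Sums ps (v ⊕ ⊖ y)

  card-Sums-[] : card (Sums []) ≡ 1
  card-Sums-[] = trans (∑-cong (space d) (λ v → sym (*-identityʳ (𝟙? (𝟎 ≟ᵛ v))))) (∑-𝟙≟ 𝟎 (λ _ → 1))

  card-Sums-∷ : ∀ x y ps → card (Sums ((x , y) ∷ ps)) ≡ card (Sums ps) + leave (Sums ps) (y ⊕ ⊖ x)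
  card-Sums-∷ x y ps = card-∪-translate (Sums ps) (⊖ x) (⊖ y) (y ⊕ ⊖ x) (begin
    (y ⊕ ⊖ x) ⊕ ⊖ y    ≡⟨ cong (_⊕ ⊖ y) (comm y (⊖ x)) ⟩
    (⊖ x ⊕ y) ⊕ ⊖ y    ≡⟨ x∙a∙a⁻¹ (⊖ x) y ⟩
    ⊖ x                ∎)
    where open ≡-Reasoning

  length-flat : ∀ ps → length (flat ps) ≡ 2 * length ps
  length-flat []       = refl
  length-flat (_ ∷ ps) = trans (cong (suc ∘ suc) (length-flat ps)) (sym (*-suc 2 (length ps)))

  Sums⇒choice : ∀ ps v → Sums ps v ≡ true → ∃[ T ] ∃[ U ] (flat ps ↭ T ++ U × length T ≡ length ps × sumᵛ T ≡ v)
  Sums⇒choice [] v eq with 𝟎 ≟ᵛ v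
  ... | yes 𝟎≡v = [] , [] , ↭-refl , refl , 𝟎≡v
  Sums⇒choice ((x , y) ∷ ps) v eq with Sums ps (v ⊕ ⊖ x) in eqx
  ... | true with T , U , r , len , sum ← Sums⇒choice ps _ eqx
      = x ∷ T , y ∷ U , prep x (↭-trans (prep y r) (↭-sym (shift y T U))) , cong suc len
      , trans (cong (x ⊕_) sum) (trans (comm x _) (x∙a⁻¹∙a v x))
  ... | false with T , U , r , len , sum ← Sums⇒choice ps _ eq
      = y ∷ T , x ∷ U , ↭-swap-both , cong suc len
      , trans (cong (y ⊕_) sum) (trans (comm y _) (x∙a⁻¹∙a v y))
      where
      ↭-swap-both : x ∷ y ∷ flat ps ↭ y ∷ T ++ x ∷ U
      ↭-swap-both = ↭-trans (↭-swap′ x y r) (prep y (↭-sym (shift x T U)))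

  count : V → F → List V → ℕ
  count ξ b S = ∑ S (λ x → 𝟙? (dot ξ x ≟ᶠ b))

  Thin : ℕ → List V → Set
  Thin m S = ∀ ξ b → ξ ≢ 𝟎 → count ξ b S ≤ m

  Thin-resp-↭ : ∀ {m S} T S′ → S ↭ T ++ S′ → Thin m S → Thin m S′
  Thin-resp-↭ {m} {S} T S′ r thin ξ b ξ≢𝟎 = begin
    count ξ b S′                   ≤⟨ m≤n+m _ _ ⟩
    count ξ b T + count ξ b S′     ≡⟨ ∑-++ T S′ _ ⟨
    count ξ b (T ++ S′)            ≡⟨ ∑-↭ _ r ⟨
    count ξ b S                    ≤⟨ thin ξ b ξ≢𝟎 ⟩
    m                              ∎
    where open ≤-Reasoning

  module _ {m : ℕ} where

    -- The hyperplanes hold at most C m terms of S counted with multiplicity, so some term is on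
    -- none of them.
    avoiding-point : ∀ {C} S → Thin m S → C * m < length S → Spread C (_∈ S)
    avoiding-point {C} S thin large hs hs≤C hs≢𝟎 with search S
      where
      Avoids : V → Set
      Avoids x = All (λ h → dot (proj₁ h) x ≢ proj₂ h) hs
      on : V × F → V → ℕ
      on (ξ , b) x = 𝟙? (dot ξ x ≟ᶠ b)
      avoids? : ∀ x hs → All (λ h → dot (proj₁ h) x ≢ proj₂ h) hs ⊎ 1 ≤ ∑ hs (λ h → on h x)
      avoids? x []             = inj₁ []
      avoids? x ((ξ , b) ∷ hs) with dot ξ x ≟ᶠ b | avoids? x hs
      ... | yes eq | _         = inj₂ (s≤s z≤n)
      ... | no neq | inj₁ rest = inj₁ (neq ∷ rest)
      ... | no neq | inj₂ 1≤   = inj₂ 1≤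
      search : ∀ S → (∃[ x ] (x ∈ S × Avoids x)) ⊎ length S ≤ ∑ S (λ x → ∑ hs (λ h → on h x))
      search []      = inj₂ z≤n
      search (x ∷ S) with avoids? x hs | search S
      ... | inj₁ ok | _                  = inj₁ (x , here refl , ok)
      ... | inj₂ _  | inj₁ (y , y∈ , ok) = inj₁ (y , there y∈ , ok)
      ... | inj₂ 1≤ | inj₂ len≤          = inj₂ (+-mono-≤ 1≤ len≤)
    ... | inj₁ found = found
    ... | inj₂ len≤  = contradiction (begin-strict
      length S                                                     ≤⟨ len≤ ⟩
      ∑ S (λ x → ∑ hs (λ h → 𝟙? (dot (proj₁ h) x ≟ᶠ proj₂ h)))     ≡⟨ ∑-swap S hs _ ⟩
      ∑ hs (λ h → count (proj₁ h) (proj₂ h) S)                     ≤⟨ ∑-mono-∈ hs (λ {h} h∈ → thin _ _ (All.lookup hs≢𝟎 h∈)) ⟩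
      ∑ hs (λ _ → m)                                               ≡⟨ ∑-const hs m ⟩
      length hs * m                                                ≤⟨ *-monoˡ-≤ m hs≤C ⟩
      C * m                                                        <⟨ large ⟩
      length S                                                     ∎) (<-irrefl refl)
      where open ≤-Reasoning

    -- The difference x ⊕ ⊖ x₀ avoids ξ = b exactly when x avoids the parallel hyperplane ξ = b + ξ
    -- · x₀.
    Spread-translate : ∀ {C D} x₀ → Spread C D → Spread C (λ a → ∃[ x ] (D x × a ≡ x ⊕ ⊖ x₀))
    Spread-translate x₀ spread hs hs≤C hs≢𝟎
      with x , Dx , avoid ← spread (map (λ h → proj₁ h , proj₂ h +ᶠ dot (proj₁ h) x₀) hs)
             (≤-trans (≤-reflexive (length-map _ hs)) hs≤C) (All.map⁺ hs≢𝟎)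
      = x ⊕ ⊖ x₀ , (x , Dx , refl) , All.map (λ {h} ≢b eq → ≢b (begin
          dot (proj₁ h) x                                        ≡⟨ cong (dot (proj₁ h)) (x∙a⁻¹∙a x x₀) ⟨
          dot (proj₁ h) ((x ⊕ ⊖ x₀) ⊕ x₀)                        ≡⟨ dot-⊕ʳ (proj₁ h) _ x₀ ⟩
          dot (proj₁ h) (x ⊕ ⊖ x₀) +ᶠ dot (proj₁ h) x₀           ≡⟨ cong (_+ᶠ dot (proj₁ h) x₀) eq ⟩
          proj₂ h +ᶠ dot (proj₁ h) x₀                            ∎)) (All.map⁻ avoid)
      where open ≡-Reasoning

    module _ (W : ℕ) .{{_ : NonZero W}} (W<p : W < p) where
      C : ℕ
      C = suc ((2 * (W * W * W)) ^ suc d)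

      -- Growth is applied to the differences with the first available term x. The difference of x
      -- with itself moves nothing, whereas the bound forces something to move, so y is a further
      -- term of the list.
      step : ∀ S ps → Thin m S → C * m < length S → 1 ≤ card (Sums ps) → ∀ {Q} → Regime (Sums ps) W W<p Q →
             ∃[ x ] ∃[ y ] ∃[ S′ ] (S ↭ x ∷ y ∷ S′ × card (Sums ps) ≤ Q * leave (Sums ps) (y ⊕ ⊖ x))
      step []       ps thin () 1≤ regime
      step (x ∷ S₁) ps thin large 1≤ {Q} regime =
        finish (growth (Sums ps) W W<p (Spread-translate x (avoiding-point (x ∷ S₁) thin large)) regime)
        where
        stuck : card (Sums ps) ≤ Q * leave (Sums ps) (x ⊕ ⊖ x) → card (Sums ps) ≤ 0
        stuck card≤ = ≤-trans card≤ (≤-reflexive (trans (cong (λ a → Q * leave (Sums ps) a) (inverseʳ x))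
          (trans (cong (Q *_) (leave-ε (Sums ps))) (*-zeroʳ Q))))
        finish : ∃[ a ] ((∃[ y ] (y ∈ x ∷ S₁ × a ≡ y ⊕ ⊖ x)) × card (Sums ps) ≤ Q * leave (Sums ps) a) →
                 ∃[ x′ ] ∃[ y ] ∃[ S′ ] (x ∷ S₁ ↭ x′ ∷ y ∷ S′ × card (Sums ps) ≤ Q * leave (Sums ps) (y ⊕ ⊖ x′))
        finish (_ , (y , here refl , refl) , card≤)  = contradiction (≤-trans 1≤ (stuck card≤)) λ ()
        finish (_ , (y , there y∈S₁ , refl) , card≤) =
          x , y , proj₁ (∈⇒↭ y∈S₁) , prep x (proj₂ (∈⇒↭ y∈S₁)) , card≤

      Reach : List V → ℕ → (ℕ → Set) → Set
      Reach S n P = ∃[ ps ] ∃[ S′ ] (length ps ≤ n × S ↭ flat ps ++ S′ × P (card (Sums ps)))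

      module _ (S : List V) (thin : Thin m S) (N : ℕ) (large : C * m + 2 * N < length S) where

        remaining : ∀ ps S′ → S ↭ flat ps ++ S′ → length ps ≤ N → C * m < length S′
        remaining ps S′ r ps≤N = +-cancelˡ-< (2 * N) _ _ (begin-strict
          2 * N + C * m                ≡⟨ +-comm (2 * N) _ ⟩
          C * m + 2 * N                <⟨ large ⟩
          length S                     ≡⟨ trans (↭-length r) (length-++ (flat ps)) ⟩
          length (flat ps) + length S′ ≡⟨ cong (_+ length S′) (length-flat ps) ⟩
          2 * length ps + length S′    ≤⟨ +-monoˡ-≤ (length S′) (*-monoʳ-≤ 2 ps≤N) ⟩
          2 * N + length S′            ∎)
          where open ≤-Reasoning

        -- Below the target z every step adds at least a Q-th of the current size, hence of y; the
        -- invariant is kept multiplied by Q to avoid division.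
        run : ∀ {n y z Q} → 1 ≤ y → (∀ ps → card (Sums ps) < z → Regime (Sums ps) W W<p Q) →
              Reach S n (y ≤_) → ∀ k → n + k ≤ N →
              Reach S (n + k) (z ≤_) ⊎ Reach S (n + k) (λ c → y ≤ c × Q * y + k * y ≤ Q * c)
        run {n} {y} {z} {Q} 1≤y regime (ps , S′ , ps≤ , r , y≤) zero n≤N = inj₂ (ps , S′
          , ≤-trans ps≤ (m≤m+n n 0) , r , y≤ , ≤-trans (≤-reflexive (+-identityʳ _)) (*-monoʳ-≤ Q y≤))
        run {n} {y} {z} {Q} 1≤y regime start (suc k) n+sk≤N
          with run 1≤y regime start k (≤-trans (+-monoʳ-≤ n (n≤1+n k)) n+sk≤N)
        ... | inj₁ (ps , S′ , ps≤ , r , z≤) = inj₁ (ps , S′ , ≤-trans ps≤ (+-monoʳ-≤ n (n≤1+n k)) , r , z≤)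
        ... | inj₂ (ps , S′ , ps≤ , r , y≤ , Q≤) with z ≤? card (Sums ps)
        ...   | yes z≤ = inj₁ (ps , S′ , ≤-trans ps≤ (+-monoʳ-≤ n (n≤1+n k)) , r , z≤)
        ...   | no z≰
          with u , v , S″ , r′ , card≤ ← step S′ ps (Thin-resp-↭ (flat ps) S′ r thin)
                 (remaining ps S′ r (≤-trans ps≤ (≤-trans (+-monoʳ-≤ n (n≤1+n k)) n+sk≤N))) (≤-trans 1≤y y≤) (regime ps (≰⇒> z≰))
          = inj₂ ((u , v) ∷ ps , S″ , ≤-trans (s≤s ps≤) (≤-reflexive (sym (+-suc n k)))
                 , ↭-trans r (↭-trans (++⁺ˡ (flat ps) r′) (shifts (flat ps) (u ∷ v ∷ [])))
                 , ≤-trans y≤ (≤-trans (m≤m+n _ _) (≤-reflexive (sym (card-Sums-∷ u v ps)))) , (begin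
            Q * y + (y + k * y)                                ≡⟨ regroup (Q * y) y (k * y) ⟩
            Q * y + k * y + y                                  ≤⟨ +-mono-≤ Q≤ (≤-trans y≤ card≤) ⟩
            Q * card (Sums ps) + Q * leave (Sums ps) (v ⊕ ⊖ u) ≡⟨ *-distribˡ-+ Q _ _ ⟨
            Q * (card (Sums ps) + leave (Sums ps) (v ⊕ ⊖ u))   ≡⟨ cong (Q *_) (card-Sums-∷ u v ps) ⟨
            Q * card (Sums ((u , v) ∷ ps))                     ∎))
          where
          open ≤-Reasoning
          regroup : ∀ a b c → a + (b + c) ≡ a + c + b
          regroup = solve-∀

        weaken : ∀ {n n′ y y′} → n ≤ n′ → y′ ≤ y → Reach S n (y ≤_) → Reach S n′ (y′ ≤_)
        weaken n≤ y≤ (ps , S′ , ps≤ , r , c≤) = ps , S′ , ≤-trans ps≤ n≤ , r , ≤-trans y≤ c≤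

        -- Q steps, each adding at least y / Q points, double the size; f rounds reach any z ≤ 2 ^ f
        -- * y.
        doublings : ∀ f {n y z Q} → 1 ≤ y → 1 ≤ Q → (∀ ps → card (Sums ps) < z → Regime (Sums ps) W W<p Q) →
                    z ≤ 2 ^ f * y → n + f * Q ≤ N → Reach S n (y ≤_) → Reach S (n + f * Q) (z ≤_)
        doublings zero    {n} {y} 1≤y 1≤Q regime z≤ n≤N start =
          weaken (m≤m+n n 0) (≤-trans z≤ (≤-reflexive (*-identityˡ y))) start
        doublings (suc f) {n} {y} {z} {Q} 1≤y 1≤Q regime z≤ n≤N start
          with run 1≤y regime start Q (≤-trans (+-monoʳ-≤ n (m≤m+n Q _)) n≤N)
        ... | inj₁ reached = weaken (+-monoʳ-≤ n (m≤m+n Q _)) ≤-refl reached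
        ... | inj₂ (ps , S′ , ps≤ , r , _ , QQ≤) = weaken (≤-reflexive (+-assoc n Q _)) ≤-refl
          (doublings f {n + Q} (≤-trans 1≤y (m≤m+n y _)) 1≤Q regime
            (≤-trans z≤ (≤-reflexive (regroup (2 ^ f) y))) (≤-trans (≤-reflexive (+-assoc n Q _)) n≤N)
            (ps , S′ , ps≤ , r , *-cancelˡ-≤ Q {{>-nonZero 1≤Q}} (≤-trans (≤-reflexive (double Q y)) QQ≤)))
          where
          regroup : ∀ a y → 2 * a * y ≡ a * (2 * y)
          regroup = solve-∀
          double : ∀ Q y → Q * (2 * y) ≡ Q * y + Q * y
          double = solve-∀

        -- Passing from J to J + 1 takes d doublings with boxes of side 2 ^ (J + 2). They cost as
        -- many pairs as all earlier stages are allotted, so the allotment doubles: a geometric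
        -- series.
        dyadic : ∀ J → 2 ^ suc J ≤ p → 4 * d * suc d * 2 ^ suc J ≤ N → Reach S (4 * d * suc d * 2 ^ suc J) (2 ^ (d * J) ≤_)
        dyadic zero    2≤p n≤N = [] , S , z≤n , ↭-refl , ≤-reflexive (trans (cong (2 ^_) (*-zeroʳ d)) (sym card-Sums-[]))
        dyadic (suc J) 2k≤p n≤N = weaken (≤-reflexive cost) ≤-refl
          (doublings d (m^n>0 2 (d * J)) 1≤Q regime (≤-reflexive size) (≤-trans (≤-reflexive cost) n≤N)
            (dyadic J (≤-trans k≤2k 2k≤p) (≤-trans (*-monoʳ-≤ (4 * d * suc d) k≤2k) n≤N)))
          where
          k : ℕ
          k = 2 ^ suc J
          k≤2k : k ≤ 2 * k
          k≤2k = m≤m+n k _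
          1≤Q : 1 ≤ 2 * (2 * k) * suc d
          1≤Q = *-mono-≤ (*-mono-≤ {1} {2} (s≤s z≤n) (*-mono-≤ {1} {2} (s≤s z≤n) (m^n>0 2 (suc J)))) (s≤s {n = d} z≤n)
          expand : ∀ d k → 4 * d * suc d * k + d * (2 * (2 * k) * suc d) ≡ 4 * d * suc d * (2 * k)
          expand = solve-∀
          cost : 4 * d * suc d * k + d * (2 * (2 * k) * suc d) ≡ 4 * d * suc d * (2 * k)
          cost = expand d k
          size : 2 ^ (d * suc J) ≡ 2 ^ d * 2 ^ (d * J)
          size = trans (cong (2 ^_) (*-suc d J)) (^-distribˡ-+-* 2 d (d * J))
          regime : ∀ ps → card (Sums ps) < 2 ^ (d * suc J) → Regime (Sums ps) W W<p (2 * (2 * k) * suc d)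
          regime ps c< = sparse (2 * k) 2k≤p (begin
            2 * card (Sums ps)               ≤⟨ *-monoʳ-≤ 2 (<⇒≤ c<) ⟩
            2 * 2 ^ (d * suc J)              ≤⟨ *-monoˡ-≤ (2 ^ (d * suc J)) (^-monoʳ-≤ 2 {1} {d} (s≤s z≤n)) ⟩
            2 ^ d * 2 ^ (d * suc J)          ≡⟨ ^-distribˡ-+-* 2 d (d * suc J) ⟨
            2 ^ (d + d * suc J)              ≡⟨ cong (2 ^_) (trans (sym (*-suc d (suc J))) (*-comm d _)) ⟩
            2 ^ (suc (suc J) * d)            ≡⟨ ^-*-assoc 2 (suc (suc J)) d ⟨
            (2 ^ suc (suc J)) ^ d            ∎)
            where open ≤-Reasoning

n<2^n : ∀ n → n < 2 ^ n
n<2^n zero    = s≤s z≤n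
n<2^n (suc n) = ≤-trans (+-mono-≤ (m^n>0 2 n) (n<2^n n)) (≤-reflexive (cong (2 ^ n +_) (sym (+-identityʳ _))))

dyadic-scale : ∀ L p .{{_ : NonZero L}} → L ≤ p → ∃[ J ] (L * 2 ^ J ≤ p × p < L * 2 ^ suc J)
dyadic-scale L p L≤p = [ (λ found → found) , (λ le → contradiction (≤-trans (m≤n*m (2 ^ p) L) le) (<⇒≱ (n<2^n p))) ]′ (search p)
  where
  search : ∀ n → (∃[ J ] (L * 2 ^ J ≤ p × p < L * 2 ^ suc J)) ⊎ L * 2 ^ n ≤ p
  search zero = inj₂ (≤-trans (≤-reflexive (*-identityʳ L)) L≤p)
  search (suc n) with search n
  ... | inj₁ found = inj₁ found
  ... | inj₂ le with L * 2 ^ suc n ≤? p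
  ...   | yes le′ = inj₂ le′
  ...   | no ≰    = inj₁ (n , le , ≰⇒> ≰)

^-distrib-* : ∀ m n o → (m * n) ^ o ≡ m ^ o * n ^ o
^-distrib-* m n zero    = refl
^-distrib-* m n (suc o) = trans (cong (m * n *_) (^-distrib-* m n o)) (interchange m n (m ^ o) (n ^ o))
  where
  interchange : ∀ a b c d → a * b * (c * d) ≡ a * c * (b * d)
  interchange = solve-∀

-- L and W are such that each of the two phases (dyadic growth to size (p/2L)^d, then
-- doubling up to half of the space) consumes at most p/4 pairs.
module ThinSequences {p : ℕ} (K : PrimeField p) (1<p : 1 < p) (e : ℕ)
  (L W : ℕ) .{{_ : NonZero W}} (W<p : W < p)
  (32dd≤L : 32 * suc e * suc (suc e) ≤ L) (1536Ldd≤W : 1536 * L * suc e * suc (suc e) ≤ W) (L≤W : L ≤ W) where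
  open LinearAlgebra K
  open Process K 1<p e
  open Approximation K W W<p using (H; H>0)

  private
    d = suc e
    V = Vec F d
  open 𝕍 d

  2≤L : 2 ≤ L
  2≤L = ≤-trans (≤-trans (s≤s (s≤s z≤n)) (≤-trans (m≤m*n 32 d) (m≤m*n (32 * d) (suc d)))) 32dd≤L

  private
    instance
      L≢0 : NonZero L
      L≢0 = >-nonZero (≤-trans (s≤s z≤n) 2≤L)

  J : ℕ
  J = proj₁ (dyadic-scale L p (≤-trans L≤W (<⇒≤ W<p)))

  L2^J≤p : L * 2 ^ J ≤ p
  L2^J≤p = proj₁ (proj₂ (dyadic-scale L p (≤-trans L≤W (<⇒≤ W<p))))

  p<L2^sJ : p < L * 2 ^ suc J
  p<L2^sJ = proj₂ (proj₂ (dyadic-scale L p (≤-trans L≤W (<⇒≤ W<p))))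

  -- `n₁` pairs pay for the dyadic phase. From its size 2 ^ (d * J), which exceeds (p / 2 L) ^ d,
  -- the `f` doublings at `Q` pairs each suffice because 2 L ≤ 2 ^ (2 L). The target `z` is the
  -- least size above half of the space.
  n₁ f Q n₂ z : ℕ
  n₁ = 4 * d * suc d * 2 ^ suc J
  f  = d * (2 * L)
  Q  = 64 * suc (2 * H) * suc d
  n₂ = f * Q
  z  = suc (p ^ d / 2)

  4n₁≤p : 4 * n₁ ≤ p
  4n₁≤p = ≤-trans (≤-reflexive (regroup d (suc d) (2 ^ J))) (≤-trans (*-monoˡ-≤ (2 ^ J) 32dd≤L) L2^J≤p)
    where
    regroup : ∀ d d′ x → 4 * (4 * d * d′ * (2 * x)) ≡ 32 * d * d′ * x
    regroup = solve-∀

  4n₂≤p : 4 * n₂ ≤ p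
  4n₂≤p = begin
    4 * (f * (64 * suc (2 * H) * suc d))   ≤⟨ *-monoʳ-≤ 4 (*-monoʳ-≤ f (*-monoˡ-≤ (suc d) (*-monoʳ-≤ 64 (+-monoˡ-≤ (2 * H) H>0)))) ⟩
    4 * (f * (64 * (H + 2 * H) * suc d))   ≡⟨ regroup L d (suc d) H ⟩
    1536 * L * d * suc d * H               ≤⟨ *-monoˡ-≤ H 1536Ldd≤W ⟩
    W * H                                  ≡⟨ *-comm W H ⟩
    H * W                                  ≤⟨ m/n*n≤m p W ⟩
    p                                      ∎
    where
    open ≤-Reasoning
    regroup : ∀ L d d′ h → 4 * (d * (2 * L) * (64 * (h + 2 * h) * d′)) ≡ 1536 * L * d * d′ * h
    regroup = solve-∀

  2[n₁+n₂]≤p : 2 * (n₁ + n₂) ≤ p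
  2[n₁+n₂]≤p = *-cancelˡ-≤ 2 (≤-trans (≤-reflexive (regroup n₁ n₂)) (+-mono-≤ 4n₁≤p (≤-trans 4n₂≤p (m≤m+n p 0))))
    where
    regroup : ∀ a b → 2 * (2 * (a + b)) ≡ 4 * a + 4 * b
    regroup = solve-∀

  z≤2^f*2^dJ : z ≤ 2 ^ f * 2 ^ (d * J)
  z≤2^f*2^dJ = begin
    z                                  ≤⟨ m/n<m (p ^ d) 2 {{>-nonZero (m^n>0 p {{>-nonZero (<-trans (s≤s z≤n) 1<p)}} d)}} (s≤s (s≤s z≤n)) ⟩
    p ^ d                              ≤⟨ ^-monoˡ-≤ d (<⇒≤ p<L2^sJ) ⟩
    (L * 2 ^ suc J) ^ d                ≡⟨ cong (_^ d) (regroup L (2 ^ J)) ⟩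
    (2 * L * 2 ^ J) ^ d                ≡⟨ ^-distrib-* (2 * L) (2 ^ J) d ⟩
    (2 * L) ^ d * (2 ^ J) ^ d          ≤⟨ *-monoˡ-≤ ((2 ^ J) ^ d) (^-monoˡ-≤ d (<⇒≤ (n<2^n (2 * L)))) ⟩
    (2 ^ (2 * L)) ^ d * (2 ^ J) ^ d    ≡⟨ cong₂ _*_ (trans (^-*-assoc 2 (2 * L) d) (cong (2 ^_) (*-comm (2 * L) d)))
                                                    (trans (^-*-assoc 2 J d) (cong (2 ^_) (*-comm J d))) ⟩
    2 ^ f * 2 ^ (d * J)                ∎
    where
    open ≤-Reasoning
    regroup : ∀ L x → L * (2 * x) ≡ 2 * L * x
    regroup = solve-∀

  p^d<2z : p ^ d < 2 * z
  p^d<2z = begin-strict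
    p ^ d                            ≡⟨ m≡m%n+[m/n]*n (p ^ d) 2 ⟩
    p ^ d % 2 + p ^ d / 2 * 2        <⟨ +-monoˡ-< (p ^ d / 2 * 2) (m%n<n (p ^ d) 2) ⟩
    2 + p ^ d / 2 * 2                ≡⟨ regroup (p ^ d / 2) ⟩
    2 * z                            ∎
    where
    open ≤-Reasoning
    regroup : ∀ x → 2 + x * 2 ≡ 2 * suc x
    regroup = solve-∀

  dense-regime : ∀ ps → card (Sums ps) < z → Growth.Regime K 1<p e (Sums ps) W W<p Q
  dense-regime ps c< = Growth.dense (≤-trans (*-monoʳ-≤ 2 (s≤s⁻¹ c<))
    (≤-trans (≤-reflexive (*-comm 2 (p ^ d / 2))) (m/n*n≤m (p ^ d) 2)))

  module _ {m : ℕ} where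

    half-cover : ∀ S → Thin m S → C {m} W W<p * m + p < length S →
      ∃[ ps ] ∃[ S′ ] (2 * length ps ≤ p × S ↭ flat ps ++ S′ × p ^ d < 2 * card (Sums ps))
    half-cover S thin enough = unpack (doublings W W<p S thin N enough′ f (m^n>0 2 (d * J)) 1≤Q dense-regime z≤2^f*2^dJ ≤-refl
      (dyadic W W<p S thin N enough′ J 2^sJ≤p (m≤m+n n₁ n₂)))
      where
      N : ℕ
      N = n₁ + n₂
      enough′ : C {m} W W<p * m + 2 * N < length S
      enough′ = ≤-<-trans (+-monoʳ-≤ (C {m} W W<p * m) 2[n₁+n₂]≤p) enough
      1≤Q : 1 ≤ Q
      1≤Q = >-nonZero⁻¹ Q
      2^sJ≤p : 2 ^ suc J ≤ p
      2^sJ≤p = ≤-trans (*-monoˡ-≤ (2 ^ J) 2≤L) L2^J≤p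
      unpack : Reach {m} W W<p S (n₁ + f * Q) (z ≤_) →
        ∃[ ps ] ∃[ S′ ] (2 * length ps ≤ p × S ↭ flat ps ++ S′ × p ^ d < 2 * card (Sums ps))
      unpack (ps , S′ , ps≤ , r , z≤) = ps , S′ , ≤-trans (*-monoʳ-≤ 2 ps≤) 2[n₁+n₂]≤p , r , <-≤-trans p^d<2z (*-monoʳ-≤ 2 z≤)

    after-pairs : ∀ {S S′ k} ps → 2 * length ps ≤ p → S ↭ flat ps ++ S′ → k + p < length S → k < length S′
    after-pairs {S} {S′} {k} ps ps≤ r lt = +-cancelˡ-< p _ _ (begin-strict
      p + k                          ≡⟨ +-comm p k ⟩
      k + p                          <⟨ lt ⟩
      length S                       ≡⟨ trans (↭-length r) (length-++ (flat ps)) ⟩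
      length (flat ps) + length S′   ≡⟨ cong (_+ length S′) (length-flat ps) ⟩
      2 * length ps + length S′      ≤⟨ +-monoˡ-≤ (length S′) ps≤ ⟩
      p + length S′                  ∎)
      where open ≤-Reasoning

    -- Two half covers add up to everything, so they can cancel any fixed filler.
    thin⇒zero-sum : ∀ S → Thin m S → C {m} W W<p * m + p + p + p < length S →
      ∃[ T ] ∃[ U ] (S ↭ T ++ U × length T ≡ p × sumᵛ T ≡ 𝟎)
    thin⇒zero-sum S thin enough =
      let k                             = C {m} W W<p * m
          ps₁ , S₁ , ps₁≤ , r₁ , half₁  = half-cover S thin (≤-<-trans (m≤m+n (k + p) p) (≤-<-trans (m≤m+n (k + p + p) p) enough))
          enough₁                       = after-pairs {k = k + p + p} ps₁ ps₁≤ r₁ enough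
          ps₂ , S₂ , ps₂≤ , r₂ , half₂  = half-cover S₁ (Thin-resp-↭ (flat ps₁) S₁ r₁ thin) (≤-<-trans (m≤m+n (k + p) p) enough₁)
          enough₂                       = after-pairs {k = k + p} ps₂ ps₂≤ r₂ enough₁
      in conclude ps₁ S₁ ps₁≤ r₁ half₁ ps₂ S₂ ps₂≤ r₂ half₂ (≤-trans (m≤n+m p k) (<⇒≤ enough₂))
      where
      conclude : ∀ ps₁ S₁ → 2 * length ps₁ ≤ p → S ↭ flat ps₁ ++ S₁ → p ^ d < 2 * card (Sums ps₁) →
        ∀ ps₂ S₂ → 2 * length ps₂ ≤ p → S₁ ↭ flat ps₂ ++ S₂ → p ^ d < 2 * card (Sums ps₂) → p ≤ length S₂ →
        ∃[ T ] ∃[ U ] (S ↭ T ++ U × length T ≡ p × sumᵛ T ≡ 𝟎)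
      conclude ps₁ S₁ ps₁≤ r₁ half₁ ps₂ S₂ ps₂≤ r₂ half₂ p≤S₂ =
        let x , x∈ , y∈             = two-sets-cover (Sums ps₁) (Sums ps₂) (⊖ sumᵛ T₃) total
            T₁ , U₁ , s₁ , l₁ , e₁  = Sums⇒choice ps₁ x x∈
            T₂ , U₂ , s₂ , l₂ , e₂  = Sums⇒choice ps₂ _ y∈
        in T₁ ++ T₂ ++ T₃ , U₁ ++ U₂ ++ U₃ , regroup T₁ U₁ s₁ T₂ U₂ s₂ , lengths T₁ T₂ l₁ l₂ , sums T₁ T₂ x e₁ e₂
        where
        r : ℕ
        -- Each half cover contributes one term per pair; the filler `T₃` brings the number of
        -- chosen terms to exactly p.
        r = p ∸ (length ps₁ + length ps₂)
        used≤p : length ps₁ + length ps₂ ≤ p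
        used≤p = *-cancelˡ-≤ 2 (≤-trans (≤-reflexive (*-distribˡ-+ 2 (length ps₁) (length ps₂))) (+-mono-≤ ps₁≤ (≤-trans ps₂≤ (m≤m+n p 0))))
        T₃ U₃ : List V
        T₃ = take r S₂
        U₃ = drop r S₂
        total : length (space d) < card (Sums ps₁) + card (Sums ps₂)
        total = *-cancelˡ-< 2 _ _ (begin-strict
          2 * length (space d)                           ≡⟨ cong (2 *_) (length-space d) ⟩
          2 * p ^ d                                      ≡⟨ cong (p ^ d +_) (+-identityʳ (p ^ d)) ⟩
          p ^ d + p ^ d                                  <⟨ +-mono-< half₁ half₂ ⟩
          2 * card (Sums ps₁) + 2 * card (Sums ps₂)      ≡⟨ *-distribˡ-+ 2 (card (Sums ps₁)) (card (Sums ps₂)) ⟨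
          2 * (card (Sums ps₁) + card (Sums ps₂))        ∎)
          where open ≤-Reasoning
        regroup : ∀ T₁ U₁ → flat ps₁ ↭ T₁ ++ U₁ → ∀ T₂ U₂ → flat ps₂ ↭ T₂ ++ U₂ → S ↭ (T₁ ++ T₂ ++ T₃) ++ (U₁ ++ U₂ ++ U₃)
        regroup T₁ U₁ s₁ T₂ U₂ s₂ = ↭-trans r₁ (↭-trans (++⁺ s₁ (↭-trans r₂
          (↭-trans (++⁺ s₂ (↭-reflexive (sym (take++drop≡id r S₂)))) (interchange-↭ T₂ U₂ T₃ U₃)))) (interchange-↭ T₁ U₁ (T₂ ++ T₃) (U₂ ++ U₃)))
        lengths : ∀ (T₁ T₂ : List V) → length T₁ ≡ length ps₁ → length T₂ ≡ length ps₂ → length (T₁ ++ T₂ ++ T₃) ≡ p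
        lengths T₁ T₂ l₁ l₂ = begin
          length (T₁ ++ T₂ ++ T₃)                        ≡⟨ trans (length-++ T₁) (cong (length T₁ +_) (length-++ T₂)) ⟩
          length T₁ + (length T₂ + length T₃)            ≡⟨ +-assoc (length T₁) (length T₂) (length T₃) ⟨
          length T₁ + length T₂ + length T₃              ≡⟨ cong₂ _+_ (cong₂ _+_ l₁ l₂) (trans (length-take r S₂) (m≤n⇒m⊓n≡m (≤-trans (m∸n≤m p (length ps₁ + length ps₂)) p≤S₂))) ⟩
          length ps₁ + length ps₂ + r                    ≡⟨ m+[n∸m]≡n used≤p ⟩
          p                                              ∎
          where open ≡-Reasoning
        sums : ∀ T₁ T₂ x → sumᵛ T₁ ≡ x → sumᵛ T₂ ≡ ⊖ sumᵛ T₃ ⊕ ⊖ x → sumᵛ (T₁ ++ T₂ ++ T₃) ≡ 𝟎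
        sums T₁ T₂ x e₁ e₂ = begin
          sumᵛ (T₁ ++ T₂ ++ T₃)                          ≡⟨ trans (sumᵛ-++ T₁ _) (cong (sumᵛ T₁ ⊕_) (sumᵛ-++ T₂ T₃)) ⟩
          sumᵛ T₁ ⊕ (sumᵛ T₂ ⊕ sumᵛ T₃)                  ≡⟨ cong₂ (λ a b → a ⊕ (b ⊕ sumᵛ T₃)) e₁ (trans e₂ (comm (⊖ sumᵛ T₃) (⊖ x))) ⟩
          x ⊕ ((⊖ x ⊕ ⊖ sumᵛ T₃) ⊕ sumᵛ T₃)              ≡⟨ cong (x ⊕_) (x∙a⁻¹∙a (⊖ x) (sumᵛ T₃)) ⟩
          x ⊕ ⊖ x                                        ≡⟨ inverseʳ x ⟩
          𝟎                                              ∎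
          where open ≡-Reasoning

-- Zero sums of length p

map-++⁻ : ∀ {A B : Set} (f : A → B) xs {ys zs} → map f xs ≡ ys ++ zs →
          ∃[ us ] ∃[ vs ] (xs ≡ us ++ vs × map f us ≡ ys × map f vs ≡ zs)
map-++⁻ f xs       {[]}     eq = [] , xs , refl , refl , eq
map-++⁻ f (x ∷ xs) {y ∷ ys} eq
  with refl , eq′ ← ∷-injective eq
  with us , vs , refl , refl , eq″ ← map-++⁻ f xs {ys} eq′
  = x ∷ us , vs , refl , refl , eq″

-- The constant is fixed before the prime, since `merge` is applied with one c for all primes
-- dividing n.
HasZeroSumConstant : ℕ → ℕ → Set₁
HasZeroSumConstant d c = ∀ {p} (K : PrimeField p) → 1 < p → let open LinearAlgebra K in
  (S : List (Vec F d)) → c * p ≤ length S → ∃[ T ] ∃[ U ] (S ↭ T ++ U × length T ≡ p × sumᵛ T ≡ 𝟎)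

module Hyperplanes {p : ℕ} (K : PrimeField p) where
  open LinearAlgebra K

  dot-removeAt : ∀ {d} (i : Fin (suc d)) (ξ x : Vec F (suc d)) → Vec.removeAt x i ≡ 𝟎 →
                 dot ξ x ≡ Vec.lookup ξ i *ᶠ Vec.lookup x i
  dot-removeAt Fin.zero (a ∷ ξ) (x ∷ v) refl = trans (cong (a *ᶠ x +ᶠ_) (dot-𝟎ʳ ξ)) (+ᶠ-identityʳ _)
  dot-removeAt {suc d} (Fin.suc i) (a ∷ ξ) (x ∷ v@(_ ∷ _)) eq with refl , eq′ ← ∷ᵛ-injective eq =
    trans (cong₂ _+ᶠ_ (*ᶠ-zeroʳ a) (dot-removeAt i ξ v eq′)) (+ᶠ-identityˡ _)

  removeAt-≡𝟎 : ∀ {d} (i : Fin (suc d)) (x : Vec F (suc d)) → Vec.removeAt x i ≡ 𝟎 → Vec.lookup x i ≡ 0ᶠ → x ≡ 𝟎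
  removeAt-≡𝟎 Fin.zero (x ∷ v) refl refl = refl
  removeAt-≡𝟎 {suc d} (Fin.suc i) (x ∷ v@(_ ∷ _)) eq x≡0 with refl , eq′ ← ∷ᵛ-injective eq =
    cong (0ᶠ ∷_) (removeAt-≡𝟎 i v eq′ x≡0)

  removeAt-⊕ : ∀ {d} (i : Fin (suc d)) (x y : Vec F (suc d)) → Vec.removeAt (x ⊕ y) i ≡ Vec.removeAt x i ⊕ Vec.removeAt y i
  removeAt-⊕ Fin.zero (x ∷ v) (y ∷ w) = refl
  removeAt-⊕ {suc d} (Fin.suc i) (x ∷ v@(_ ∷ _)) (y ∷ w@(_ ∷ _)) = cong (x +ᶠ y ∷_) (removeAt-⊕ i v w)

  removeAt-𝟎 : ∀ {d} (i : Fin (suc d)) → Vec.removeAt 𝟎 i ≡ 𝟎 {d}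
  removeAt-𝟎 Fin.zero            = refl
  removeAt-𝟎 {suc d} (Fin.suc i) = cong (0ᶠ ∷_) (removeAt-𝟎 i)

  sumᵛ-removeAt : ∀ {d} (i : Fin (suc d)) T → sumᵛ (map (λ x → Vec.removeAt x i) T) ≡ Vec.removeAt (sumᵛ T) i
  sumᵛ-removeAt i []      = sym (removeAt-𝟎 i)
  sumᵛ-removeAt i (x ∷ T) = trans (cong (Vec.removeAt x i ⊕_) (sumᵛ-removeAt i T)) (sym (removeAt-⊕ i x (sumᵛ T)))

  dot-sumᵛ : ∀ {d} (ξ : Vec F d) b {T} → All (λ x → dot ξ x ≡ b) T → dot ξ (sumᵛ T) ≡ ι (length T) *ᶠ b
  dot-sumᵛ ξ b []                    = trans (dot-𝟎ʳ ξ) (sym (trans (cong (_*ᶠ b) ι-0) (*ᶠ-zeroˡ b)))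
  dot-sumᵛ ξ b {x ∷ T} (eq ∷ eqs) = begin
    dot ξ (x ⊕ sumᵛ T)                   ≡⟨ dot-⊕ʳ ξ x (sumᵛ T) ⟩
    dot ξ x +ᶠ dot ξ (sumᵛ T)            ≡⟨ cong₂ _+ᶠ_ (trans eq (sym (*ᶠ-identityˡ b))) (dot-sumᵛ ξ b eqs) ⟩
    1ᶠ *ᶠ b +ᶠ ι (length T) *ᶠ b         ≡⟨ *ᶠ-distribʳ b _ _ ⟨
    (1ᶠ +ᶠ ι (length T)) *ᶠ b            ≡⟨ cong (_*ᶠ b) (trans (ι-+ 1 (length T)) (cong (_+ᶠ ι (length T)) ι-1)) ⟨
    ι (suc (length T)) *ᶠ b              ∎
    where open ≡-Reasoning

  nonzero-coordinate : ∀ {d} (ξ : Vec F d) → ξ ≢ 𝟎 → ∃[ i ] Vec.lookup ξ i ≢ 0ᶠ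
  nonzero-coordinate ξ ξ≢𝟎 with any? (λ i → ¬? (Vec.lookup ξ i ≟ᶠ 0ᶠ))
  ... | yes found = found
  ... | no none   = contradiction (lookup-≡ ξ 𝟎 (λ i → trans (vanish i) (sym (lookup-replicate i 0ᶠ)))) ξ≢𝟎
    where
    vanish : ∀ i → Vec.lookup ξ i ≡ 0ᶠ
    vanish i with Vec.lookup ξ i ≟ᶠ 0ᶠ
    ... | yes eq = eq
    ... | no neq = contradiction (i , neq) none

  module _ (1<p : 1 < p) {e : ℕ} where
    open Process K 1<p e

    on-hyperplane : ∀ (ξ : Vec F (suc e)) b S →
      ∃[ T ] ∃[ U ] (S ↭ T ++ U × All (λ x → dot ξ x ≡ b) T × count ξ b S ≡ length T)
    on-hyperplane ξ b [] = [] , [] , ↭-refl , [] , refl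
    on-hyperplane ξ b (x ∷ S) with dot ξ x ≟ᶠ b | on-hyperplane ξ b S
    ... | yes eq | T , U , r , eqs , len = x ∷ T , U , prep x r , eq ∷ eqs , cong suc len
    ... | no _   | T , U , r , eqs , len = T , x ∷ U , ↭-trans (prep x r) (↭-sym (shift x T U)) , eqs , len

    -- Dropping a coordinate on which ξ does not vanish is injective on the hyperplane
    -- ξ·x = b up to translation, and translations are harmless for sums of length p.
    thick⇒zero-sum : ∀ {c} → HasZeroSumConstant e c → ∀ S ξ b → ξ ≢ 𝟎 → c * p ≤ count ξ b S →
      ∃[ T ] ∃[ U ] (S ↭ T ++ U × length T ≡ p × sumᵛ T ≡ 𝟎)
    thick⇒zero-sum {c} zs S ξ b ξ≢𝟎 thick
      with i , ξᵢ≢0 ← nonzero-coordinate ξ ξ≢𝟎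
      with T , U , r , eqs , len ← on-hyperplane ξ b S
      with T′ , U′ , r′ , len′ , sum′ ← zs K 1<p (map (λ x → Vec.removeAt x i) T)
             (≤-trans thick (≤-reflexive (trans len (sym (length-map _ T)))))
      with ys , eq , s ← ↭-map-inv (λ x → Vec.removeAt x i) r′
      with us , vs , refl , refl , _ ← map-++⁻ (λ x → Vec.removeAt x i) ys {T′} (sym eq)
      = us , vs ++ U , ↭-trans r (↭-trans (++⁺ʳ U s) (++-assoc-↭ us vs U)) , length-us
      , removeAt-≡𝟎 i (sumᵛ us) removed (*ᶠ-cancelʳ-0 ξᵢ≢0 (trans (*ᶠ-comm _ _) product≡0))
      where
      length-us : length us ≡ p
      length-us = trans (sym (length-map _ us)) len′
      removed : Vec.removeAt (sumᵛ us) i ≡ 𝟎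
      removed = trans (sym (sumᵛ-removeAt i us)) sum′
      -- Only coordinate i of the sum can survive. There ξ sees ξ i times this coordinate, and it
      -- also sees p b = 0.
      product≡0 : Vec.lookup ξ i *ᶠ Vec.lookup (sumᵛ us) i ≡ 0ᶠ
      product≡0 = begin
        Vec.lookup ξ i *ᶠ Vec.lookup (sumᵛ us) i   ≡⟨ dot-removeAt i ξ (sumᵛ us) removed ⟨
        dot ξ (sumᵛ us)                            ≡⟨ dot-sumᵛ ξ b (All.++⁻ˡ us (All-resp-↭ s eqs)) ⟩
        ι (length us) *ᶠ b                         ≡⟨ cong (_*ᶠ b) (∣⇒ι≡0 _ (∣-reflexive (sym length-us))) ⟩
        0ᶠ *ᶠ b                                    ≡⟨ *ᶠ-zeroˡ b ⟩
        0ᶠ                                         ∎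
        where open ≡-Reasoning

    thick-or-thin : ∀ m S → (∃[ ξ ] ∃[ b ] (ξ ≢ 𝟎 × m < count ξ b S)) ⊎ Thin m S
    thick-or-thin m S
      with Any.any? (λ h → ¬? (proj₁ h ≟ᵛ 𝟎) ×-dec (m <? count (proj₁ h) (proj₂ h) S)) (cartesianProduct (space (suc e)) elements)
    ... | yes found with (ξ , b) , ξ≢𝟎 , m< ← Any.satisfied found = inj₁ (ξ , b , ξ≢𝟎 , m<)
    ... | no none = inj₂ (λ ξ b ξ≢𝟎 → ≮⇒≥ (λ m< → none (lose
          (∈-cartesianProduct⁺ (∈-vectors ξ (λ i → elements-complete _)) (elements-complete b)) (ξ≢𝟎 , m<))))

    -- The p parallel hyperplanes x₁ = b cover the whole space.
    thin⇒large-p : ∀ {m} W S → Thin m S → W * m < length S → W < p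
    thin⇒large-p {m} W S thin enough = ≰⇒> λ p≤W →
      let x , _ , avoid = avoiding-point S thin enough (map (ε ,_) elements)
                            (≤-trans (≤-reflexive (trans (length-map _ elements) length-elements)) p≤W)
                            (All.map⁺ (All.universal (λ _ → ε≢𝟎) elements))
      in All.lookup avoid (∈-map⁺ (ε ,_) (elements-complete (dot ε x))) refl
      where
      ε : Vec F (suc e)
      ε = 1ᶠ ∷ 𝟎
      ε≢𝟎 : ε ≢ 𝟎
      ε≢𝟎 eq = Frames.1≢0 K 1<p e (proj₁ (∷ᵛ-injective eq))

-- With m = c p, the summand W makes W m < `length S`, which forces W < p in the thin case; the
-- other summand supplies the C hyperplanes to be avoided. Of the 4 p, two parts pay for the half
-- covers, one for the filler and one for strictness.
zero-sum-suc : ∀ e L W → 32 * suc e * suc (suc e) ≤ L → 1536 * L * suc e * suc (suc e) ≤ W → L ≤ W → 0 < W →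
  ∀ c → HasZeroSumConstant e c → HasZeroSumConstant (suc e) ((W + suc ((2 * (W * W * W)) ^ suc (suc e))) * c + 4)
zero-sum-suc e L W hL hW L≤W 0<W c zs {p} K 1<p S large with Hyperplanes.thick-or-thin K 1<p (c * p) S
... | inj₁ (ξ , b , ξ≢𝟎 , thick) = Hyperplanes.thick⇒zero-sum K 1<p {c = c} zs S ξ b ξ≢𝟎 (<⇒≤ thick)
... | inj₂ thin = conclude (W + B) refl
  where
  instance
    W≢0 : NonZero W
    W≢0 = >-nonZero 0<W
  B : ℕ
  B = suc ((2 * (W * W * W)) ^ suc (suc e))
  conclude : ∀ A → A ≡ W + B → ∃[ T ] ∃[ U ] (S ↭ T ++ U × length T ≡ p × LinearAlgebra.sumᵛ K T ≡ LinearAlgebra.𝟎 K)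
  conclude A A≡ = ThinSequences.thin⇒zero-sum K 1<p e L W W<p hL hW L≤W S thin
    (≤-<-trans (+-monoˡ-≤ p (+-monoˡ-≤ p (+-monoˡ-≤ p (*-monoˡ-≤ (c * p) (≤-trans (m≤n+m B W) (≤-reflexive (sym A≡))))))) enough)
    where
    open ≤-Reasoning
    regroup : ∀ A c p → A * (c * p) + p + p + p + p ≡ (A * c + 4) * p
    regroup = solve-∀
    enough : A * (c * p) + p + p + p < length S
    enough = begin-strict
      A * (c * p) + p + p + p          <⟨ m<m+n (A * (c * p) + p + p + p) (<-trans (s≤s z≤n) 1<p) ⟩
      A * (c * p) + p + p + p + p      ≡⟨ regroup A c p ⟩
      (A * c + 4) * p                  ≡⟨ cong (λ A → (A * c + 4) * p) A≡ ⟩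
      ((W + B) * c + 4) * p            ≤⟨ large ⟩
      length S                         ∎
    W<p : W < p
    W<p = Hyperplanes.thin⇒large-p K 1<p W S thin (begin-strict
      W * (c * p)                      ≤⟨ *-monoˡ-≤ (c * p) (≤-trans (m≤m+n W B) (≤-reflexive (sym A≡))) ⟩
      A * (c * p)                      ≤⟨ m≤m+n _ p ⟩
      A * (c * p) + p                  ≤⟨ m≤m+n _ p ⟩
      A * (c * p) + p + p              ≤⟨ m≤m+n _ p ⟩
      A * (c * p) + p + p + p          <⟨ enough ⟩
      length S                         ∎)

zero-sum : ∀ d → ∃[ c ] HasZeroSumConstant d c
zero-sum zero    = 1 , λ {p} K 1<p S p≤S → take p S , drop p S , ↭-reflexive (sym (take++drop≡id p S))
  , trans (length-take p S) (m≤n⇒m⊓n≡m (≤-trans (≤-reflexive (sym (+-identityʳ p))) p≤S)) , empty _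
  where
  empty : ∀ {A : Set} (v : Vec A 0) {w} → v ≡ w
  empty [] {[]} = refl
zero-sum (suc e) = (W + suc ((2 * (W * W * W)) ^ suc (suc e))) * c + 4
  , zero-sum-suc e L W ≤-refl (m≤n⇒m≤1+n (m≤m+n M L)) (m≤n⇒m≤1+n (m≤n+m L M)) (s≤s z≤n) c (proj₂ (zero-sum e))
  where
  c L M W : ℕ
  c = proj₁ (zero-sum e)
  L = 32 * suc e * suc (suc e)
  M = 1536 * L * suc e * suc (suc e)
  W = suc (M + L)

-- Pebbling on divisors

concat-↭ : ∀ {A : Set} {Ts Us : List (List A)} → Ts ↭ Us → concat Ts ↭ concat Us
concat-↭ ↭-nil          = ↭-refl
concat-↭ (prep T r)     = ++⁺ˡ T (concat-↭ r)
concat-↭ (↭-swap′ T U r) = ↭-trans (shifts T U) (++⁺ˡ U (++⁺ˡ T (concat-↭ r)))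
concat-↭ (↭-comp r s)   = ↭-trans (concat-↭ r) (concat-↭ s)

partition-⊎ : ∀ {A : Set} {P Q : A → Set} {xs} → All (λ x → P x ⊎ Q x) xs →
              ∃[ ys ] ∃[ zs ] (xs ↭ ys ++ zs × All P ys × All Q zs)
partition-⊎ [] = [] , [] , ↭-refl , [] , []
partition-⊎ {xs = x ∷ _} (pq ∷ pqs) with ys , zs , r , ps , qs ← partition-⊎ pqs with pq
... | inj₁ p = x ∷ ys , zs , prep x r , p ∷ ps , qs
... | inj₂ q = ys , x ∷ zs , ↭-trans (prep x r) (↭-sym (shift x ys zs)) , ps , q ∷ qs

-- An abstract pebbling game: among c q pebbles on a label q m, some q can be traded for one on m.
module Pebbling {A : Set} (Valid : List A → ℕ → Set) (c : ℕ)
  (merge : ∀ {q} → Prime q → ∀ m Ts → All (λ T → Valid T (q * m)) Ts → c * q ≤ length Ts →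
    ∃[ Us ] ∃[ Rs ] (Ts ↭ Us ++ Rs × length Us ≡ q × Valid (concat Us) m)) where

  -- Merge as long as c q blocks are available: each merge uses up q blocks, and fewer than c q
  -- remain. The number n bounds the recursion.
  drain : ∀ {q} → Prime q → ∀ m n Ts → length Ts ≤ n → All (λ T → Valid T (q * m)) Ts →
    ∃[ Vs ] ∃[ R ] (All (λ V → Valid V m) Vs × concat Ts ↭ concat Vs ++ R × length Ts ≤ c * q + q * length Vs)
  drain {q} q-prime m n Ts Ts≤n valid with c * q ≤? length Ts
  ... | no few = [] , concat Ts , [] , ↭-refl , ≤-trans (<⇒≤ (≰⇒> few)) (m≤m+n (c * q) _)
  ... | yes many with Us , Rs , r , refl , validU ← merge q-prime m Ts valid many with n
  ...   | zero  = contradiction (≤-trans (≤-trans (>-nonZero⁻¹ (length Us) {{prime⇒nonZero q-prime}}) (≤-trans (m≤m+n (length Us) (length Rs))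
                    (≤-reflexive (sym (trans (↭-length r) (length-++ Us)))))) Ts≤n) λ ()
  ...   | suc n
    with Vs , R , validV , s , len ← drain q-prime m n Rs (s≤s⁻¹ (≤-trans (+-monoˡ-≤ (length Rs) (>-nonZero⁻¹ (length Us) {{prime⇒nonZero q-prime}}))
           (≤-trans (≤-reflexive (sym (trans (↭-length r) (length-++ Us)))) Ts≤n))) (All.++⁻ʳ Us (All-resp-↭ r valid))
    = concat Us ∷ Vs , R , validU ∷ validV
    , ↭-trans (concat-↭ r) (↭-trans (↭-reflexive (sym (concat-++ Us Rs)))
        (↭-trans (++⁺ˡ (concat Us) s) (↭-sym (++-assoc-↭ (concat Us) (concat Vs) R))))
    , (begin
        length Ts                              ≡⟨ trans (↭-length r) (length-++ Us) ⟩
        length Us + length Rs                  ≤⟨ +-monoʳ-≤ (length Us) len ⟩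
        length Us + (c * q + q * length Vs)    ≡⟨ regroup q c (length Vs) ⟩
        c * q + q * suc (length Vs)            ∎)
    where
    open ≤-Reasoning
    regroup : ∀ q c v → q + (c * q + q * v) ≡ c * q + q * suc v
    regroup = solve-∀

  Item : Set
  Item = List A × ℕ

  support : List Item → List A
  support xs = concat (map proj₁ xs)

  support-↭ : ∀ {xs ys} → xs ↭ ys → support xs ↭ support ys
  support-↭ r = concat-↭ (↭-map⁺ proj₁ r)

  support-++ : ∀ xs ys → support (xs ++ ys) ≡ support xs ++ support ys
  support-++ xs ys = trans (cong concat (map-++ proj₁ xs ys)) (sym (concat-++ (map proj₁ xs) (map proj₁ ys)))

  Labelled : List ℕ → Item → Set
  Labelled L (T , m) = Valid T m × m ∈ L

  drain-all : ∀ {q} → Prime q → ∀ L xs → All (Labelled (map (q *_) L)) xs →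
    ∃[ ys ] ∃[ R ] (All (Labelled L) ys × support xs ↭ support ys ++ R × length xs ≤ c * q * length L + q * length ys)
  drain-all q-prime []      []      []               = [] , [] , [] , ↭-refl , z≤n
  drain-all q-prime []      (_ ∷ _) ((_ , ()) ∷ _)
  drain-all {q} q-prime (m ∷ L) xs labelled
    with us , vs , r , top , below ← partition-⊎ {P = λ x → Valid (proj₁ x) (q * m)} {Q = Labelled (map (q *_) L)}
           (All.map (λ { (valid , here refl) → inj₁ valid ; (valid , there i) → inj₂ (valid , i) }) labelled)
    with Vs , R , validV , s , len ← drain q-prime m (length us) (map proj₁ us) (≤-reflexive (length-map proj₁ us)) (All.map⁺ top)
    with ys , R′ , labelled′ , s′ , len′ ← drain-all q-prime L vs below
    = map (_, m) Vs ++ ys , R ++ R′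
    , All.++⁺ (All.map⁺ (All.map (λ valid → valid , here refl) validV)) (All.map (λ { (valid , i) → valid , there i }) labelled′)
    , ↭-trans (support-↭ r) (↭-trans (↭-reflexive (support-++ us vs)) (↭-trans (++⁺ s s′) (rearrange Vs ys R R′)))
    , (begin
        length xs                                                         ≡⟨ trans (↭-length r) (length-++ us) ⟩
        length us + length vs                                             ≤⟨ +-mono-≤ (≤-trans (≤-reflexive (sym (length-map proj₁ us))) len) len′ ⟩
        (c * q + q * length Vs) + (c * q * length L + q * length ys)      ≡⟨ regroup c q (length L) (length Vs) (length ys) ⟩
        c * q * suc (length L) + q * (length Vs + length ys)              ≡⟨ cong (λ k → c * q * suc (length L) + q * k)
                                                                               (trans (cong (_+ length ys) (sym (length-map (_, m) Vs))) (sym (length-++ (map (_, m) Vs)))) ⟩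
        c * q * suc (length L) + q * length (map (_, m) Vs ++ ys)         ∎)
    where
    open ≤-Reasoning
    regroup : ∀ c q l v y → (c * q + q * v) + (c * q * l + q * y) ≡ c * q * suc l + q * (v + y)
    regroup = solve-∀
    support-map : ∀ Vs → support (map (_, m) Vs) ≡ concat Vs
    support-map []       = refl
    support-map (V ∷ Vs) = cong (V ++_) (support-map Vs)
    rearrange : ∀ Vs ys R R′ → (concat Vs ++ R) ++ (support ys ++ R′) ↭ support (map (_, m) Vs ++ ys) ++ (R ++ R′)
    rearrange Vs ys R R′ = ↭-trans (interchange-↭ (concat Vs) R (support ys) R′)
      (↭-reflexive (cong (_++ (R ++ R′)) (sym (trans (support-++ (map (_, m) Vs) ys) (cong (_++ support ys) (support-map Vs))))))

  -- Blocks with a label in L are kept and only those in q L₀ are drained, at a loss of c q blocks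
  -- per label of L₀. Keeping L₀ separate from L allows draining few labels when q = 2.
  reduce-labels : ∀ {q} → Prime q → ∀ {L L₀ L′ f} → (∀ {m} → m ∈ L₀ → m ∈ L) →
    (∀ {m} → m ∈ L′ → m ∈ L ⊎ m ∈ map (q *_) L₀) →
    ∀ xs → All (Labelled L′) xs → q * f + c * q * length L₀ ≤ length xs →
    ∃[ ys ] ∃[ R ] (All (Labelled L) ys × support xs ↭ support ys ++ R × f ≤ length ys)
  reduce-labels {q} q-prime {L} {L₀} {L′} {f} L₀⊆L split xs labelled enough
    with us , vs , r , low , high ← partition-⊎ {P = Labelled L} {Q = Labelled (map (q *_) L₀)}
           (All.map (λ { (valid , m∈) → [ (λ i → inj₁ (valid , i)) , (λ i → inj₂ (valid , i)) ]′ (split m∈) }) labelled)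
    with ys , R , labelled′ , s , len ← drain-all q-prime L₀ vs high
    = us ++ ys , R , All.++⁺ low (All.map (λ { (valid , i) → valid , L₀⊆L i }) labelled′)
    , ↭-trans (support-↭ r) (↭-trans (↭-reflexive (support-++ us vs)) (↭-trans (++⁺ˡ (support us) s)
        (↭-trans (↭-sym (++-assoc-↭ (support us) (support ys) R)) (↭-reflexive (cong (_++ R) (sym (support-++ us ys)))))))
    , *-cancelˡ-≤ q (+-cancelˡ-≤ (c * q * length L₀) _ _ (begin
        c * q * length L₀ + q * f                               ≡⟨ +-comm (c * q * length L₀) (q * f) ⟩
        q * f + c * q * length L₀                               ≤⟨ enough ⟩
        length xs                                               ≡⟨ trans (↭-length r) (length-++ us) ⟩
        length us + length vs                                   ≤⟨ +-mono-≤ (m≤n*m (length us) q) len ⟩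
        q * length us + (c * q * length L₀ + q * length ys)     ≡⟨ regroup q (length us) (c * q * length L₀) (length ys) ⟩
        c * q * length L₀ + q * (length us + length ys)         ≡⟨ cong (λ k → c * q * length L₀ + q * k) (length-++ us) ⟨
        c * q * length L₀ + q * length (us ++ ys)               ∎))
    where
    open ≤-Reasoning
    instance
      q≢0 : NonZero q
      q≢0 = prime⇒nonZero q-prime
    regroup : ∀ q u a y → q * u + (a + q * y) ≡ a + q * (u + y)
    regroup = solve-∀

  Reaches1 : List ℕ → ℕ → Set
  Reaches1 L f = ∀ xs → All (Labelled L) xs → f ≤ length xs → ∃[ T ] ∃[ R ] (Valid T 1 × support xs ↭ T ++ R)

  Reaches1-step : ∀ {q} → Prime q → ∀ {L L₀ L′ f} → (∀ {m} → m ∈ L₀ → m ∈ L) →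
    (∀ {m} → m ∈ L′ → m ∈ L ⊎ m ∈ map (q *_) L₀) → Reaches1 L f → Reaches1 L′ (q * f + c * q * length L₀)
  Reaches1-step q-prime L₀⊆L split reaches xs labelled enough =
    let ys , R , labelled′ , s , len = reduce-labels q-prime L₀⊆L split xs labelled enough
        T , R′ , valid , s′          = reaches ys labelled′ len
    in T , R′ ++ R , valid , ↭-trans s (↭-trans (++⁺ʳ R s′) (++-assoc-↭ T R′ R))

  divides-prime* : ∀ {q} → Prime q → ∀ {m n} → m ∣ q * n → m ∣ n ⊎ ∃[ k ] (m ≡ q * k × k ∣ n)
  divides-prime* {q} q-prime {m} {n} (divides k qn≡km) with euclidsLemma k m q-prime (divides n (trans (sym qn≡km) (*-comm q n)))
  ... | inj₁ (divides j refl) = inj₁ (divides j (*-cancelˡ-≡ n (j * m) q {{prime⇒nonZero q-prime}} (trans qn≡km (regroup j q m))))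
    where
    regroup : ∀ j q m → j * q * m ≡ q * (j * m)
    regroup = solve-∀
  ... | inj₂ (divides j refl) = inj₂ (j , *-comm j q , divides k (*-cancelˡ-≡ n (k * j) q {{prime⇒nonZero q-prime}} (trans qn≡km (regroup k j q))))
    where
    regroup : ∀ k j q → k * (j * q) ≡ q * (k * j)
    regroup = solve-∀

  -- The term 3c|L| is the slack that pays for the leftovers when passing to q n with
  -- q ≥ 3; it is not available for q = 2, so the powers of two are treated first.
  record Tower (n : ℕ) : Set where
    field
      labels   : List ℕ
      bound    : ℕ
      complete : ∀ {m} → m ∣ n → m ∈ labels
      bound≤   : bound + 3 * c * length labels ≤ (1 + 5 * c) * n
      reaches  : Reaches1 labels bound
  open Tower

  powersOf2 : ℕ → List ℕ
  powersOf2 zero    = 1 ∷ []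
  powersOf2 (suc a) = 2 ^ suc a ∷ powersOf2 a

  bound2 : ℕ → ℕ
  bound2 zero    = 1
  bound2 (suc a) = 2 * bound2 a + c * 2 * 1

  ∣2^⇒ : ∀ a {m} → m ∣ 2 ^ a → m ≡ 2 ^ a ⊎ 2 * m ∣ 2 ^ a
  ∣2^⇒ zero    m∣1 = inj₁ (∣1⇒≡1 m∣1)
  ∣2^⇒ (suc a) m∣  with divides-prime* prime[2] {n = 2 ^ a} m∣
  ... | inj₁ m∣2^a            = inj₂ (*-monoʳ-∣ 2 m∣2^a)
  ... | inj₂ (k , refl , k∣) = [ (λ eq → inj₁ (cong (2 *_) eq)) , (λ 2k∣ → inj₂ (*-monoʳ-∣ 2 2k∣)) ]′ (∣2^⇒ a k∣)

  ∈-powersOf2 : ∀ a {m} → m ∣ 2 ^ a → m ∈ powersOf2 a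
  ∈-powersOf2 zero    m∣1 = here (∣1⇒≡1 m∣1)
  ∈-powersOf2 (suc a) m∣  = [ here , (λ 2m∣ → there (∈-powersOf2 a (*-cancelˡ-∣ 2 2m∣))) ]′ (∣2^⇒ (suc a) m∣)

  2^∈powersOf2 : ∀ a → 2 ^ a ∈ powersOf2 a
  2^∈powersOf2 a = ∈-powersOf2 a ∣-refl

  -- Only the top divisor of 2 ^ (a + 1) fails to divide 2 ^ a, so each step drains a single label
  -- and loses 2 c blocks.
  reaches-powersOf2 : ∀ a → Reaches1 (powersOf2 a) (bound2 a)
  reaches-powersOf2 zero    []             _                          ()
  reaches-powersOf2 zero    ((T , m) ∷ xs) ((valid , here refl) ∷ _) _ = T , support xs , valid , ↭-refl
  reaches-powersOf2 (suc a) = Reaches1-step prime[2] {L₀ = 2 ^ a ∷ []} (λ { (here refl) → 2^∈powersOf2 a })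
    (λ { (here refl) → inj₂ (here refl) ; (there i) → inj₁ i }) (reaches-powersOf2 a)

  bound2-eq : ∀ a → bound2 a + 2 * c ≡ (1 + 2 * c) * 2 ^ a
  bound2-eq zero    = sym (*-identityʳ _)
  bound2-eq (suc a) = trans (regroup (bound2 a) c) (trans (cong (2 *_) (bound2-eq a)) (regroup′ (1 + 2 * c) (2 ^ a)))
    where
    regroup : ∀ b c → 2 * b + c * 2 * 1 + 2 * c ≡ 2 * (b + 2 * c)
    regroup = solve-∀
    regroup′ : ∀ k x → 2 * (k * x) ≡ k * (2 * x)
    regroup′ = solve-∀

  length-powersOf2 : ∀ a → length (powersOf2 a) ≤ 2 ^ a
  length-powersOf2 zero    = ≤-refl
  length-powersOf2 (suc a) = ≤-trans (+-mono-≤ (m^n>0 2 a) (length-powersOf2 a)) (≤-reflexive (cong (2 ^ a +_) (sym (+-identityʳ _))))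

  tower-2^ : ∀ a → Tower (2 ^ a)
  tower-2^ a = record
    { labels   = powersOf2 a
    ; bound    = bound2 a
    ; complete = ∈-powersOf2 a
    ; bound≤   = begin
        bound2 a + 3 * c * length (powersOf2 a)       ≤⟨ +-mono-≤ (m≤m+n (bound2 a) (2 * c)) (*-monoʳ-≤ (3 * c) (length-powersOf2 a)) ⟩
        bound2 a + 2 * c + 3 * c * 2 ^ a              ≡⟨ cong (_+ 3 * c * 2 ^ a) (bound2-eq a) ⟩
        (1 + 2 * c) * 2 ^ a + 3 * c * 2 ^ a           ≡⟨ collect c (2 ^ a) ⟩
        (1 + 5 * c) * 2 ^ a                           ∎
    ; reaches  = reaches-powersOf2 a
    }
    where
    open ≤-Reasoning
    collect : ∀ c x → (1 + 2 * c) * x + 3 * c * x ≡ (1 + 5 * c) * x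
    collect = solve-∀

  -- The list of labels doubles. The loss c q l and the new slack 6 c l, for l old labels, fit into
  -- q times the old slack 3 c l because 6 ≤ 2 q.
  tower-odd : ∀ {q n} → Prime q → 3 ≤ q → Tower n → Tower (q * n)
  tower-odd {q} {n} q-prime 3≤q t = record
    { labels   = L ++ map (q *_) L
    ; bound    = q * f + c * q * length L
    ; complete = λ m∣ → [ (λ m∣n → ∈-++⁺ˡ (complete t m∣n))
                        , (λ { (k , refl , k∣n) → ∈-++⁺ʳ L (∈-map⁺ (q *_) (complete t k∣n)) }) ]′ (divides-prime* q-prime m∣)
    ; bound≤   = begin
        q * f + c * q * length L + 3 * c * length (L ++ map (q *_) L)
          ≡⟨ cong (λ k → q * f + c * q * length L + 3 * c * k) (trans (length-++ L) (cong (length L +_) (length-map (q *_) L))) ⟩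
        q * f + c * q * length L + 3 * c * (length L + length L)
          ≡⟨ regroup q f c (length L) ⟩
        q * f + (q * (c * length L) + 3 * (2 * (c * length L)))
          ≤⟨ +-monoʳ-≤ (q * f) (+-monoʳ-≤ (q * (c * length L)) (*-monoˡ-≤ (2 * (c * length L)) 3≤q)) ⟩
        q * f + (q * (c * length L) + q * (2 * (c * length L)))
          ≡⟨ regroup′ q f c (length L) ⟩
        q * (f + 3 * c * length L)
          ≤⟨ *-monoʳ-≤ q (bound≤ t) ⟩
        q * ((1 + 5 * c) * n)
          ≡⟨ regroup″ q (1 + 5 * c) n ⟩
        (1 + 5 * c) * (q * n) ∎
    ; reaches  = Reaches1-step q-prime {L₀ = L} (λ i → i) (∈-++⁻ L) (reaches t)
    }
    where
    open ≤-Reasoning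
    L : List ℕ
    L = labels t
    f : ℕ
    f = bound t
    regroup : ∀ q f c l → q * f + c * q * l + 3 * c * (l + l) ≡ q * f + (q * (c * l) + 3 * (2 * (c * l)))
    regroup = solve-∀
    regroup′ : ∀ q f c l → q * f + (q * (c * l) + q * (2 * (c * l))) ≡ q * (f + 3 * c * l)
    regroup′ = solve-∀
    regroup″ : ∀ q k n → q * (k * n) ≡ k * (q * n)
    regroup″ = solve-∀

  -- Factors 2 are moved into the exponent a wherever they occur, so they end up at the base of the
  -- tower, below all odd primes.
  tower-product : ∀ a ps → All Prime ps → Tower (2 ^ a * product ps)
  tower-product a []       []              = subst Tower (sym (*-identityʳ (2 ^ a))) (tower-2^ a)
  tower-product a (q ∷ ps) (q-prime ∷ primes) with q ≟ 2
  ... | yes refl = subst Tower (regroup (2 ^ a) (product ps)) (tower-product (suc a) ps primes)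
    where
    regroup : ∀ x y → 2 * x * y ≡ x * (2 * y)
    regroup = solve-∀
  ... | no q≢2   = subst Tower (regroup q (2 ^ a) (product ps))
      (tower-odd q-prime (≤∧≢⇒< (nonTrivial⇒n>1 q {{prime⇒nonTrivial q-prime}}) (q≢2 ∘ sym)) (tower-product a ps primes))
    where
    regroup : ∀ q x y → q * (x * y) ≡ x * (q * y)
    regroup = solve-∀

  tower : ∀ n .{{_ : NonZero n}} → Tower n
  tower n = subst Tower (trans (+-identityʳ _) (sym (PrimeFactorisation.isFactorisation (factorise n))))
    (tower-product 0 (PrimeFactorisation.factors (factorise n)) (PrimeFactorisation.factorsPrime (factorise n)))

  pebbling : ∀ n .{{_ : NonZero n}} xs → All (λ x → Valid (proj₁ x) (proj₂ x) × proj₂ x ∣ n) xs → (1 + 5 * c) * n ≤ length xs →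
             ∃[ T ] ∃[ R ] (Valid T 1 × support xs ↭ T ++ R)
  pebbling n xs labelled enough = reaches t xs (All.map (λ { (valid , m∣n) → valid , complete t m∣n }) labelled)
    (≤-trans (m≤m+n (bound t) _) (≤-trans (bound≤ t) enough))
    where
    t : Tower n
    t = tower n

-- Tiny zero-sum subsequences

-- Merging reorders terms while the theorem asks for a sublist of the given sequence, so the block
-- found is put back into the original order.
↭-⊆ : ∀ {A : Set} {S S′ T : List A} → S ↭ S′ → T ⊆ S′ → ∃[ T′ ] (T′ ⊆ S × T′ ↭ T)
↭-⊆ ↭-nil s = _ , s , ↭-refl
↭-⊆ (prep x r) (_ ∷ʳ s) with T′ , s′ , r′ ← ↭-⊆ r s = T′ , x ∷ʳ s′ , r′
↭-⊆ (prep x r) (refl ∷ s) with T′ , s′ , r′ ← ↭-⊆ r s = x ∷ T′ , refl ∷ s′ , prep x r′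
↭-⊆ (↭-swap′ x y r) (_ ∷ʳ _ ∷ʳ s) with T′ , s′ , r′ ← ↭-⊆ r s = T′ , x ∷ʳ y ∷ʳ s′ , r′
↭-⊆ (↭-swap′ x y r) (_ ∷ʳ refl ∷ s) with T′ , s′ , r′ ← ↭-⊆ r s = x ∷ T′ , refl ∷ y ∷ʳ s′ , prep x r′
↭-⊆ (↭-swap′ x y r) (refl ∷ _ ∷ʳ s) with T′ , s′ , r′ ← ↭-⊆ r s = y ∷ T′ , x ∷ʳ refl ∷ s′ , prep y r′
↭-⊆ (↭-swap′ x y r) (refl ∷ refl ∷ s) with T′ , s′ , r′ ← ↭-⊆ r s = x ∷ y ∷ T′ , refl ∷ refl ∷ s′ , ↭-swap′ x y r′
↭-⊆ (↭-comp r₁ r₂) s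
  with T₂ , s₂ , q₂ ← ↭-⊆ r₂ s
  with T₁ , s₁ , q₁ ← ↭-⊆ r₁ s₂ = T₁ , s₁ , ↭-trans q₁ q₂

-- Unnormalised denominators are stored as predecessors: with order o + 1 and w the cofactor of the
-- order, 1 / (o + 1) is w over the common denominator.
n/1+o+s/n : ∀ o n w s → suc o * w ≡ suc n → mkℚᵘ (ℤ.+ 1) o ℚᵘ.+ mkℚᵘ (ℤ.+ s) n ≃ mkℚᵘ (ℤ.+ (w + s)) n
n/1+o+s/n o n w s ow≡n = *≡* (trans
  (cong (ℤ._* ℤ.+ suc n) (cong₂ ℤ._+_ (sym (ℤ.pos-* 1 (suc n))) (sym (ℤ.pos-* s (suc o)))))
  (trans (sym (ℤ.pos-* (1 * suc n + s * suc o) (suc n)))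
  (trans (cong ℤ.+_ (trans (cong (λ k → (1 * k + s * suc o) * suc n) (sym ow≡n)) (regroup (suc o) w s (suc n))))
         (ℤ.pos-* (w + s) (suc o * suc n)))))
  where
  regroup : ∀ o w s n → (1 * (o * w) + s * o) * n ≡ (w + s) * (o * n)
  regroup = solve-∀

-- Orders of elements

prodFin>0 : ∀ r ns → (∀ i → 0 < ns i) → 0 < prodFin r ns
prodFin>0 zero    ns pos = s≤s z≤n
prodFin>0 (suc r) ns pos = *-mono-< {0} {ns Fin.zero} {0} (pos Fin.zero) (prodFin>0 r _ (pos ∘ Fin.suc))

≤prodFin : ∀ r ns → (∀ i → 0 < ns i) → ∀ i → ns i ≤ prodFin r ns
≤prodFin (suc r) ns pos Fin.zero    = m≤m*n (ns Fin.zero) (prodFin r _) {{>-nonZero (prodFin>0 r _ (pos ∘ Fin.suc))}}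
≤prodFin (suc r) ns pos (Fin.suc i) = ≤-trans (≤prodFin r _ (pos ∘ Fin.suc) i) (m≤n*m _ (ns Fin.zero) {{>-nonZero (pos Fin.zero)}})

∣exponent : ∀ k (ns : Fin (suc k) → ℕ) → (∀ i j → toℕ j ≡ suc (toℕ i) → ns i ∣ ns j) → ∀ i → ns i ∣ exponent k ns
∣exponent zero    ns chain Fin.zero    = ∣-refl
∣exponent (suc k) ns chain Fin.zero    = ∣-trans (chain Fin.zero (Fin.suc Fin.zero) refl)
  (∣exponent k (ns ∘ Fin.suc) (λ i j eq → chain (Fin.suc i) (Fin.suc j) (cong suc eq)) Fin.zero)
∣exponent (suc k) ns chain (Fin.suc i) = ∣exponent k (ns ∘ Fin.suc) (λ i j eq → chain (Fin.suc i) (Fin.suc j) (cong suc eq)) i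

module _ {r : ℕ} {ns : Fin r → ℕ} where

  Kills : ℕ → Elem r ns → Set
  Kills m g = ∀ i → ns i ∣ m * toℕ (g i)

  -- The multiple N shows that the search succeeds within its fuel, so the fallback value never
  -- occurs.
  ordPredFrom-spec : ∀ fuel j N (g : Elem r ns) → (∀ {m} → 0 < m → m ≤ j → ¬ Kills m g) → j < N → N ≤ j + fuel → Kills N g →
    Kills (suc (ordPredFrom fuel j g)) g × (∀ {m} → 0 < m → m ≤ ordPredFrom fuel j g → ¬ Kills m g)
  ordPredFrom-spec zero       j N g minimal j<N N≤ kills = contradiction (≤-trans N≤ (≤-reflexive (+-identityʳ j))) (<⇒≱ j<N)
  ordPredFrom-spec (suc fuel) j N g minimal j<N N≤ kills with all? (λ i → ns i ∣? (suc j * toℕ (g i)))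
  ... | yes here′ = here′ , minimal
  ... | no ¬here  = ordPredFrom-spec fuel (suc j) N g minimal′ (≤∧≢⇒< j<N λ { refl → ¬here kills })
                      (≤-trans N≤ (≤-reflexive (+-suc j fuel))) kills
    where
    minimal′ : ∀ {m} → 0 < m → m ≤ suc j → ¬ Kills m g
    minimal′ {m} 0<m m≤ killsm with m ≟ suc j
    ... | yes refl = ¬here killsm
    ... | no m≢    = minimal 0<m (s≤s⁻¹ (≤∧≢⇒< m≤ m≢)) killsm

  -- The remainder of n modulo the order also kills g, and by minimality of the order it is 0.
  ord-spec : ∀ n (g : Elem r ns) → 0 < n → n ≤ prodFin r ns → Kills n g → Kills (ord g) g × ord g ∣ n
  ord-spec n g 0<n n≤ kills = killed , m%n≡0⇒n∣m n (ord g) (n%o≡0 (n % ord g) refl)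
    where
    spec : Kills (ord g) g × (∀ {m} → 0 < m → m ≤ ordPred g → ¬ Kills m g)
    spec = ordPredFrom-spec (prodFin r ns) 0 n g (λ { (s≤s _) () }) 0<n n≤ kills
    killed : Kills (ord g) g
    killed = proj₁ spec
    kills-remainder : Kills (n % ord g) g
    kills-remainder i = ∣m+n∣m⇒∣n {ns i} {n / ord g * (ord g * toℕ (g i))}
      (subst (ns i ∣_) (trans (cong (_* toℕ (g i)) (m≡m%n+[m/n]*n n (ord g))) (regroup (n % ord g) (n / ord g) (ord g) (toℕ (g i)))) (kills i))
      (∣n⇒∣m*n (n / ord g) (killed i))
      where
      regroup : ∀ s q o x → (s + q * o) * x ≡ q * (o * x) + s * x
      regroup = solve-∀
    n%o≡0 : ∀ s → n % ord g ≡ s → n % ord g ≡ 0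
    n%o≡0 zero    eq = eq
    n%o≡0 (suc s) eq = contradiction (subst (λ m → Kills m g) eq kills-remainder)
      (proj₂ spec (s≤s z≤n) (s≤s⁻¹ (subst (_< ord g) eq (m%n<n n (ord g)))))

  sumComp-++ : ∀ (S T : List (Elem r ns)) i → sumComp (S ++ T) i ≡ sumComp S i + sumComp T i
  sumComp-++ []      T i = refl
  sumComp-++ (g ∷ S) T i = trans (cong (toℕ (g i) +_) (sumComp-++ S T i)) (sym (+-assoc (toℕ (g i)) _ _))

  sumComp-concat : ∀ (Ts : List (List (Elem r ns))) i → sumComp (concat Ts) i ≡ ∑ Ts (λ T → sumComp T i)
  sumComp-concat []       i = refl
  sumComp-concat (T ∷ Ts) i = trans (sumComp-++ T (concat Ts) i) (cong (sumComp T i +_) (sumComp-concat Ts i))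

  sumComp-∑ : ∀ (S : List (Elem r ns)) i → sumComp S i ≡ ∑ S (λ g → toℕ (g i))
  sumComp-∑ []      i = refl
  sumComp-∑ (g ∷ S) i = cong (toℕ (g i) +_) (sumComp-∑ S i)

-- Blocks, their labels and their cross numbers

∑-concat : ∀ {A : Set} (Ts : List (List A)) f → ∑ (concat Ts) f ≡ ∑ Ts (λ T → ∑ T f)
∑-concat []       f = refl
∑-concat (T ∷ Ts) f = trans (∑-++ T (concat Ts) f) (cong (∑ T f +_) (∑-concat Ts f))

module TinyZeroSums (k : ℕ) (ns : Fin (suc k) → ℕ) (invariants : IsInvariants (suc k) ns) where

  private
    r = suc k
    n = exponent k ns
    G = Elem r ns

  ns>0 : ∀ i → 0 < ns i
  ns>0 i = <-trans (s≤s z≤n) (proj₁ invariants i)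

  private
    instance
      ns≢0 : ∀ {i} → NonZero (ns i)
      ns≢0 {i} = >-nonZero (ns>0 i)

  n-kills : ∀ g → Kills n g
  n-kills g i = ∣m⇒∣m*n (toℕ (g i)) (∣exponent k ns (proj₂ invariants) i)

  ord-properties : ∀ (g : G) → Kills (ord g) g × ord g ∣ n
  ord-properties g = ord-spec n g (ns>0 (fromℕ k)) (≤prodFin r ns ns>0 (fromℕ k)) (n-kills g)

  -- Sums of weights are n times the cross number.
  weight : G → ℕ
  weight g = n / ord g

  ord*weight : ∀ g → ord g * weight g ≡ n
  ord*weight g = m*[n/m]≡n (proj₂ (ord-properties g))

  -- `light` says k(T) ≤ 1/m, cleared of denominators through multiplication by m n.
  record Valid (T : List G) (m : ℕ) : Set where
    field
      nonEmpty : T ≢ []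
      killed   : ∀ i → ns i ∣ m * sumComp T i
      light    : m * ∑ T weight ≤ n
  open Valid

  module _ (c : ℕ) (zs : HasZeroSumConstant r c) where

    -- A zero sum of the quotient vectors says that q n_i divides q m σ_i of the union, and q
    -- cancels. Likewise the q inequalities for the weights add up to q times the one wanted.
    merge : ∀ {q} → Prime q → ∀ m Ts → All (λ T → Valid T (q * m)) Ts → c * q ≤ length Ts →
      ∃[ Us ] ∃[ Rs ] (Ts ↭ Us ++ Rs × length Us ≡ q × Valid (concat Us) m)
    merge {zero}  q-prime = contradiction q-prime ¬prime[0]
    merge {suc q′} q-prime m Ts valid enough =
      let T′ , U′ , r , len , sum≡0 = zs K 1<q (map ψ Ts) (≤-trans enough (≤-reflexive (sym (length-map ψ Ts))))
          ys , eq , s               = ↭-map-inv ψ r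
      in pull-back ys T′ U′ s (sym eq) len sum≡0
      where
      q : ℕ
      q = suc q′
      K : PrimeField q
      K = Residues.primeField q′ q-prime
      open LinearAlgebra K
      1<q : 1 < q
      1<q = nonTrivial⇒n>1 q {{prime⇒nonTrivial q-prime}}
      -- q m σ_i(T) is a multiple of n_i; modulo q the quotient measures whether
      -- m already kills the sum.
      quot : Fin (suc k) → List G → ℕ
      quot i T = q * m * sumComp T i / ns i
      ψ : List G → Vec F (suc k)
      ψ T = Vec.tabulate (λ i → ι (quot i T))
      lookup-sum : ∀ i Us → Vec.lookup (sumᵛ (map ψ Us)) i ≡ ι (∑ Us (quot i))
      lookup-sum i []       = trans (lookup-replicate i 0ᶠ) (sym ι-0)
      lookup-sum i (T ∷ Us) = trans (lookup-zipWith _+ᶠ_ i (ψ T) (sumᵛ (map ψ Us)))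
        (trans (cong₂ _+ᶠ_ (lookup∘tabulate (λ i → ι (quot i T)) i) (lookup-sum i Us)) (sym (ι-+ (quot i T) _)))
      ns*quot : ∀ i {Us} → All (λ T → Valid T (q * m)) Us → ∑ Us (quot i) * ns i ≡ q * (m * sumComp (concat Us) i)
      ns*quot i {Us} valid = trans (go valid) (cong (λ x → q * (m * x)) (sym (sumComp-concat Us i)))
        where
        regroup : ∀ q m a b → q * m * a + q * (m * b) ≡ q * (m * (a + b))
        regroup = solve-∀
        go : ∀ {Us} → All (λ T → Valid T (q * m)) Us → ∑ Us (quot i) * ns i ≡ q * (m * ∑ Us (λ T → sumComp T i))
        go []                    = sym (trans (cong (q *_) (*-zeroʳ m)) (*-zeroʳ q))
        go {T ∷ Us} (v ∷ valid) = trans (*-distribʳ-+ (ns i) (quot i T) _)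
          (trans (cong₂ _+_ (m/n*n≡m (killed v i)) (go valid)) (regroup q m (sumComp T i) _))
      total-weight : ∀ {Us} → All (λ T → Valid T (q * m)) Us → q * (m * ∑ (concat Us) weight) ≤ length Us * n
      total-weight {Us} valid = ≤-trans (≤-reflexive (cong (λ x → q * (m * x)) (∑-concat Us weight))) (go valid)
        where
        regroup : ∀ q m a b → q * (m * (a + b)) ≡ q * m * a + q * (m * b)
        regroup = solve-∀
        go : ∀ {Us} → All (λ T → Valid T (q * m)) Us → q * (m * ∑ Us (λ T → ∑ T weight)) ≤ length Us * n
        go []                    = ≤-reflexive (trans (cong (q *_) (*-zeroʳ m)) (*-zeroʳ q))
        go {T ∷ Us} (v ∷ valid) = ≤-trans (≤-reflexive (regroup q m (∑ T weight) _)) (+-mono-≤ (light v) (go valid))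
      merged : ∀ {Us} → All (λ T → Valid T (q * m)) Us → length Us ≡ q → sumᵛ (map ψ Us) ≡ 𝟎 → Valid (concat Us) m
      merged {Us} valid len sum≡0 = record
        { nonEmpty = non-empty valid len
        ; killed   = λ i → *-cancelˡ-∣ q (subst (q * ns i ∣_) (ns*quot i valid)
            (*-monoˡ-∣ (ns i) (ι≡0⇒∣ (∑ Us (quot i)) (trans (sym (lookup-sum i Us)) (trans (cong (λ v → Vec.lookup v i) sum≡0) (lookup-replicate i 0ᶠ))))))
        ; light    = *-cancelˡ-≤ q (≤-trans (total-weight valid) (≤-reflexive (cong (_* n) len)))
        }
        where
        non-empty : ∀ {Us} → All (λ T → Valid T (q * m)) Us → length Us ≡ q → concat Us ≢ []
        non-empty {[] ∷ Us}      (v ∷ _) len eq = nonEmpty v refl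
        non-empty {(_ ∷ _) ∷ Us} (v ∷ _) len ()
      pull-back : ∀ ys T′ U′ → Ts ↭ ys → map ψ ys ≡ T′ ++ U′ → length T′ ≡ q → sumᵛ T′ ≡ 𝟎 →
        ∃[ Us ] ∃[ Rs ] (Ts ↭ Us ++ Rs × length Us ≡ q × Valid (concat Us) m)
      pull-back ys T′ U′ s eq len sum≡0 with Us , Rs , refl , refl , _ ← map-++⁻ ψ ys {T′} eq =
        Us , Rs , s , length-Us , merged (All.++⁻ˡ Us (All-resp-↭ s valid)) length-Us sum≡0
        where
        length-Us : length Us ≡ q
        length-Us = trans (sym (length-map ψ Us)) len

    open Pebbling Valid c merge using (pebbling; support)

    singletons : List G → List (List G × ℕ)
    singletons = map (λ g → g ∷ [] , ord g)

    support-singletons : ∀ S → support (singletons S) ≡ S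
    support-singletons []      = refl
    support-singletons (g ∷ S) = cong (g ∷_) (support-singletons S)

    singleton-valid : ∀ g → Valid (g ∷ []) (ord g)
    singleton-valid g = record
      { nonEmpty = λ ()
      ; killed   = λ i → subst (λ x → ns i ∣ ord g * x) (sym (+-identityʳ (toℕ (g i)))) (proj₁ (ord-properties g) i)
      ; light    = ≤-reflexive (trans (cong (ord g *_) (+-identityʳ (weight g))) (ord*weight g))
      }

    crossNumber≃ : ∀ n′ → n ≡ suc n′ → ∀ T → toℚᵘ (crossNumber T) ≃ mkℚᵘ (ℤ.+ ∑ T weight) n′
    crossNumber≃ n′ n≡ []      = *≡* refl
    crossNumber≃ n′ n≡ (g ∷ T) = ℚᵘ.≃-trans (ℚ.toℚᵘ-homo-+ ((ℤ.+ 1) ℚ./ suc (ordPred g)) (crossNumber T))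
      (ℚᵘ.≃-trans (ℚᵘ.+-cong (ℚ.toℚᵘ-fromℚᵘ (mkℚᵘ (ℤ.+ 1) (ordPred g))) (crossNumber≃ n′ n≡ T))
        (n/1+o+s/n (ordPred g) n′ (weight g) (∑ T weight) (trans (ord*weight g) n≡)))

    light⇒crossNumber≤1 : ∀ T → ∑ T weight ≤ n → crossNumber T ℚ.≤ 1ℚ
    light⇒crossNumber≤1 T light = go (pred n) (sym (suc-pred n))
      where
      go : ∀ n′ → n ≡ suc n′ → crossNumber T ℚ.≤ 1ℚ
      go n′ n≡ = ℚ.toℚᵘ-cancel-≤ (ℚᵘ.≤-respˡ-≃ (ℚᵘ.≃-sym (crossNumber≃ n′ n≡ T)) (*≤*
        (ℤ.≤-trans (ℤ.≤-reflexive (ℤ.*-identityʳ _)) (ℤ.≤-trans (ℤ.+≤+ (≤-trans light (≤-reflexive n≡))) (ℤ.≤-reflexive (sym (ℤ.*-identityˡ _)))))))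

    tiny-zero-sum : ∀ S → (1 + 5 * c) * n ≤ length S → HasTinyZeroSum S
    tiny-zero-sum S enough =
      let T , R , valid , r = pebbling n (singletons S)
                                (All.map⁺ (All.universal (λ g → singleton-valid g , proj₂ (ord-properties g)) S))
                                (≤-trans enough (≤-reflexive (sym (length-map _ S))))
          T′ , T′⊆S , p     = ↭-⊆ (subst (_↭ T ++ R) (support-singletons S) r) (⊆-++ʳ R ⊆-refl)
      in T′ , T′⊆S , (λ eq → nonEmpty valid (↭-empty-inv (subst (T ↭_) eq (↭-sym p))))
       , (λ i → subst (ns i ∣_) (trans (*-identityˡ _) (trans (sumComp-∑ T i) (trans (sym (∑-↭ _ p)) (sym (sumComp-∑ T′ i))))) (killed valid i))
       , light⇒crossNumber≤1 T′ (≤-trans (≤-reflexive (trans (∑-↭ weight p) (sym (*-identityˡ _)))) (light valid))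

theorem4 : (k : ℕ) → ∃[ d ] (1 ≤ d × ((ns : Fin (suc k) → ℕ) → IsInvariants (suc k) ns → TinyBound (suc k) ns (d * (exponent k ns ∸ 1) + 1)))
-- The factor 2 comes from n ≤ 2 (n - 1), valid because the exponent is at least 2.
theorem4 k = 2 * (1 + 5 * c) , s≤s z≤n , λ ns invariants S long →
  TinyZeroSums.tiny-zero-sum k ns invariants c (proj₂ (zero-sum (suc k))) S
    (≤-trans (bound (exponent k ns) (proj₁ invariants (fromℕ k))) long)
  where
  c : ℕ
  c = proj₁ (zero-sum (suc k))
  bound : ∀ n → 1 < n → (1 + 5 * c) * n ≤ 2 * (1 + 5 * c) * (n ∸ 1) + 1
  bound (suc zero)    (s≤s ())
  bound (suc (suc n)) _ = ≤-trans (*-monoʳ-≤ (1 + 5 * c) (m≤m+n (suc (suc n)) n))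
    (≤-trans (≤-reflexive (regroup (1 + 5 * c) n)) (m≤m+n _ 1))
    where
    regroup : ∀ A n → A * (suc (suc n) + n) ≡ 2 * A * suc n
    regroup = solve-∀
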